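{- For every integer $k\ge 3$ and every $\gamma>0$ there exist $c>0$ and $n_0>0$ such that the following holds. If $(\mathcal H,\phi)$ is an $n$-vertex colored $k$-graph with $n\ge n_0$, $\delta_{k-1}(\mathcal H)\ge (1/2+\gamma)n$ and $\Delta_{k-1}(\mathcal H_i)\le cn$ for every $i\in\mathbb N$, then $(\mathcal H,\phi)$ contains a properly colored tight Hamilton cycle $C_n^{(k)}(k-1)$.
   Context: A $k$-graph is a $k$-uniform hypergraph. A colored hypergraph is a pair $(\mathcal H,\phi)$ where $\phi:\mathcal H\to\mathbb N$ colors the edges; $\mathcal H_i=\{e\in\mathcal H:\phi(e)=i\}$. For $S\subseteq V(\mathcal H)$, $\deg(S)$ is the number of edges containing $S$; $\delta_s(\mathcal H)=\min\{\deg(S):|S|=s\}$ and $\Delta_s(\mathcal H)=\max\{\deg(S):|S|=s\}$. For $1\le \ell\le k-1$, a $(k,\ell)$-cycle $C_n^{(k)}(\ell)$ is an $n$-vertex $k$-graph whose vertices can be cyclically ordered so that every edge consists of $k$ consecutive vertices and every two consecutive edges share exactly $\ell$ vertices; a tight cycle is the case $\ell=k-1$. A Hamilton cycle in $\mathcal H$ is one that is a spanning subhypergraph. A hypergraph is properly colored if every two intersecting edges receive different colors. -}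

module Defs where

open import Data.Nat using (ℕ; zero; suc; _<?_)
open import Data.Bool using (Bool; true; false; _∧_)
open import Data.Fin using (Fin; zero; suc; toℕ; fromℕ<)
open import Data.Fin.Subset using (Subset; ⁅_⁆; _∪_; _∩_; _⊆_; ∣_∣; Nonempty; inside; outside)
open import Data.Fin.Subset.Properties using (_⊆?_)
open import Data.Fin.Permutation using (Permutation′; _⟨$⟩ʳ_)
open import Data.List using (List; []; _∷_; _++_; map; filter; length; upTo; foldr)
open import Data.Vec using (_∷_; [])
open import Data.Product using (_×_)
open import Relation.Nullary using (Dec; yes; no; ¬_)
open import Relation.Nullary.Decidable using (_×-dec_)
open import Relation.Binary.PropositionalEquality using (_≡_)
import Data.Nat.Properties as ℕP
open import Data.Integer using (+_)
open import Data.Rational using (ℚ; _/_)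

-- A colored k-graph on vertex set Fin n: the edge set is given by its
-- (decidable) indicator on subsets of Fin n, every edge has exactly k
-- vertices; the coloring assigns a color in ℕ to each edge (values of φ
-- on non-edges are irrelevant).
IsKGraph : (k n : ℕ) → (Subset n → Bool) → Set
IsKGraph k n H = ∀ (e : Subset n) → H e ≡ true → ∣ e ∣ ≡ k

allSubsets : (n : ℕ) → List (Subset n)
allSubsets zero = [] ∷ []
allSubsets (suc n) = map (outside ∷_) (allSubsets n) ++ map (inside ∷_) (allSubsets n)

deg : ∀ {n} → (Subset n → Bool) → Subset n → ℕ
deg {n} H S = length (filter (λ e → (H e ≟b true) ×-dec (S ⊆? e)) (allSubsets n))
  where
  _≟b_ : (a b : Bool) → Dec (a ≡ b)
  _≟b_ = Data.Bool._≟_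
    where import Data.Bool

colDeg : ∀ {n} → (Subset n → Bool) → (Subset n → ℕ) → ℕ → Subset n → ℕ
colDeg {n} H φ i S =
  length (filter (λ e → ((H e ≟b true) ×-dec (φ e ℕP.≟ i)) ×-dec (S ⊆? e)) (allSubsets n))
  where
  _≟b_ : (a b : Bool) → Dec (a ≡ b)
  _≟b_ = Data.Bool._≟_
    where import Data.Bool

ℕ→ℚ : ℕ → ℚ
ℕ→ℚ n = + n / 1

next : ∀ {n} → Fin n → Fin n
next {suc m} i with suc (toℕ i) <? suc m
... | yes p = fromℕ< p
... | no _  = zero

shift : ∀ {n} → ℕ → Fin n → Fin n
shift zero i = i
shift (suc j) i = shift j (next i)

-- In the cyclic ordering of the vertices given by σ (position p holds
-- vertex σ p), the i-th edge of the tight cycle consists of the k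
-- consecutive vertices at positions i, i+1, …, i+k-1 (mod n).
window : ∀ {n} → ℕ → Permutation′ n → Fin n → Subset n
window k σ i = foldr (λ j acc → ⁅ σ ⟨$⟩ʳ shift j i ⁆ ∪ acc) (Data.Fin.Subset.⊥) (upTo k)
  where import Data.Fin.Subset

-- (H, φ) contains a properly colored tight Hamilton cycle: the vertices
-- of H are cyclically ordered by σ, every k consecutive vertices form an
-- edge of H, and any two distinct intersecting edges of the cycle have
-- different colors.  (Consecutive edges then share exactly k-1 vertices.)
HasProperlyColoredTightHamCycle : (k n : ℕ) → (Subset n → Bool) → (Subset n → ℕ) → Set
HasProperlyColoredTightHamCycle k n H φ =
  Data.Product.Σ (Permutation′ n) λ σ →
    (∀ i → H (window k σ i) ≡ true) ×
    (∀ i j → ¬ (window k σ i ≡ window k σ j) →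
             Nonempty (window k σ i ∩ window k σ j) →
             ¬ (φ (window k σ i) ≡ φ (window k σ j)))
  where import Data.Product

{-# OPTIONS --safe #-}
module Submission where

-- The proof is by absorption, with every random choice made deterministic.
--
-- A sequence of vertices is good if each k consecutive vertices form an edge and
-- overlapping windows have different colors.  Goodness is local: two good
-- sequences that overlap in 2(k-1) vertices can be glued.  A structure with free
-- vertices that occurs with positive density as far as the edges are concerned
-- still does so with good colors, since for two distinct windows one of them has
-- a free vertex outside the other, and that vertex hits a prescribed color in at
-- most cn ways.
--
-- Absorbers (P₁P₂ such that P₁P₂ and P₁vP₂ are good) are dense because each new
-- vertex has to satisfy at most two degree conditions, and 2(1/2 + γ) > 1.  To
-- connect x to y, one goes through tuples T₀, …, T_{k-1}, each obtained from the
-- previous one by exchanging one vertex, consecutive ones being joined by a common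
-- neighbour; this walk repeats vertices, and supersaturation turns it into a
-- positive density of paths.  A weighted greedy selection yields disjoint families
-- in which each vertex has linearly many absorbers, resp. each pair of ends
-- linearly many connectors.
--
-- The remaining vertices are almost covered by paths of constant length M.  If
-- linearly many vertices are uncovered, most (k-1)-tuples u of them are adjacent to
-- half of the vertices of many groups of size M, so a positive density of them
-- share halves of two groups Q and Q′; weaving these halves into the tuples gives a
-- path on at least 3M vertices that meets at most two of the old paths.  Finally
-- the family of connectors closes everything into a cycle and the leftover
-- vertices are absorbed.

-- Two overlapping windows span up to `2k - 1` vertices; the overlap `2(k-1)` in gluing comes from
-- there. The cleaning of colors fails for two windows that differ only in prescribed vertices. An
-- absorber has a single prescribed vertex, and the two prescribed ends of a connector lie too far
-- apart to matter jointly; but in the long paths of the tiling the vertices taken from old groups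
-- are prescribed and stand at distance `k`, so that two neighbouring windows may differ in nothing
-- else. This is why two groups are needed there, with halves that see different colors. The sizes
-- look circular: the absorbers must be able to take in the whole reservoir of connectors, the
-- reservoir must link all tiles, and both must be small compared with n. The circle is broken by
-- the tile length `M`, fixed after the relative sizes of the two families: it makes the number of
-- tiles as small as desired. The deterministic selection succeeds because there are only
-- polynomially many requirements, fewer than `2 ^ s` for a linear `s`.

module Proof where
  open import Defs
  open import Data.Nat
  open import Data.Nat.Properties
  open import Data.Nat.DivMod using (m≡m%n+[m/n]*n; m%n<n; m/n*n≤m)
  open import Data.Nat.Tactic.RingSolver using (solve-∀)
  open import Data.Bool using (Bool; true; false; if_then_else_)
  import Data.Bool
  open import Data.Empty using (⊥; ⊥-elim)
  open import Data.Unit using (⊤; tt)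
  open import Data.Fin as Fin using (Fin; zero; suc; toℕ; fromℕ<; _↑ˡ_; _↑ʳ_; combine)
  import Data.Fin.Properties as FinP
  open import Data.Fin.Subset as Sub using (Subset; ⁅_⁆; _∪_; _∩_; ∣_∣; Nonempty; inside; outside)
  import Data.Fin.Subset.Properties as SubP
  open import Data.List as List using (List; []; _∷_; _++_; [_]; _∷ʳ_; map; length; concat; concatMap; take; drop; filter; allFin; upTo)
  import Data.List.Properties as ListP
  open import Data.List.Membership.Propositional using (_∈_; _∉_; find)
  import Data.List.Membership.Propositional.Properties as MemP
  open import Data.List.Relation.Unary.Any as Any using (Any; here; there)
  open import Data.List.Relation.Unary.All as All using (All; []; _∷_)
  import Data.List.Relation.Unary.All.Properties as AllP
  open import Data.List.Relation.Unary.AllPairs using ([]; _∷_)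
  open import Data.List.Relation.Unary.Unique.Propositional using (Unique)
  import Data.List.Relation.Unary.Unique.Propositional.Properties as UniP
  open import Data.List.Relation.Binary.Permutation.Propositional using (_↭_; ↭-sym; ↭-trans; ↭-refl; prep; swap)
  import Data.List.Relation.Binary.Permutation.Propositional as Perm
  import Data.List.Relation.Binary.Permutation.Propositional.Properties as PermP
  open import Data.Vec as Vec using (Vec; []; _∷_; lookup; _[_]≔_; toList)
  import Data.Vec.Properties as VecP
  open import Data.Product using (Σ; ∃; _×_; _,_; proj₁; proj₂)
  open import Data.Sum using (_⊎_; inj₁; inj₂; [_,_]′)
  open import Function using (_∘_; id; case_of_)
  open import Relation.Binary.Definitions using (tri<; tri≈; tri>)
  open import Relation.Nullary using (Dec; yes; no; does; ¬_; contradiction)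
  open import Relation.Nullary.Decidable using (_×-dec_; _→-dec_; ¬?; map′)
  open import Relation.Binary.PropositionalEquality using (_≡_; _≢_; refl; sym; trans; cong; cong₂; subst; subst₂; module ≡-Reasoning)

  -- Finite sums, averaging and counting of tuples

  module Sums where
    private variable
      A B : Set

    sumL : List A → (A → ℕ) → ℕ
    sumL [] f = 0
    sumL (x ∷ xs) f = f x + sumL xs f

    sumL-mono∈ : (xs : List A) {f g : A → ℕ} → (∀ x → x ∈ xs → f x ≤ g x) → sumL xs f ≤ sumL xs g
    sumL-mono∈ [] h = z≤n
    sumL-mono∈ (x ∷ xs) h = +-mono-≤ (h x (here refl)) (sumL-mono∈ xs (λ y m → h y (there m)))

    sumL-mono : (xs : List A) {f g : A → ℕ} → (∀ x → f x ≤ g x) → sumL xs f ≤ sumL xs g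
    sumL-mono xs h = sumL-mono∈ xs (λ x _ → h x)

    sumL-cong : (xs : List A) {f g : A → ℕ} → (∀ x → f x ≡ g x) → sumL xs f ≡ sumL xs g
    sumL-cong [] h = refl
    sumL-cong (x ∷ xs) h = cong₂ _+_ (h x) (sumL-cong xs h)

    private
      interchange : ∀ a b c d → (a + b) + (c + d) ≡ (a + c) + (b + d)
      interchange = solve-∀

    sumL-+ : (xs : List A) (f g : A → ℕ) → sumL xs (λ x → f x + g x) ≡ sumL xs f + sumL xs g
    sumL-+ [] f g = refl
    sumL-+ (x ∷ xs) f g = trans (cong (f x + g x +_) (sumL-+ xs f g)) (interchange (f x) (g x) _ _)

    sumL-* : (xs : List A) (c : ℕ) (f : A → ℕ) → sumL xs (λ x → c * f x) ≡ c * sumL xs f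
    sumL-* [] c f = sym (*-zeroʳ c)
    sumL-* (x ∷ xs) c f = trans (cong (c * f x +_) (sumL-* xs c f)) (sym (*-distribˡ-+ c (f x) _))

    sumL-*ʳ : (xs : List A) (c : ℕ) (f : A → ℕ) → sumL xs (λ x → f x * c) ≡ sumL xs f * c
    sumL-*ʳ xs c f = trans (sumL-cong xs (λ x → *-comm (f x) c)) (trans (sumL-* xs c f) (*-comm c _))

    sumL-const : (xs : List A) (c : ℕ) → sumL xs (λ _ → c) ≡ length xs * c
    sumL-const [] c = refl
    sumL-const (x ∷ xs) c = cong (c +_) (sumL-const xs c)

    sumL-++ : (xs ys : List A) (f : A → ℕ) → sumL (xs ++ ys) f ≡ sumL xs f + sumL ys f
    sumL-++ [] ys f = refl
    sumL-++ (x ∷ xs) ys f = trans (cong (f x +_) (sumL-++ xs ys f)) (sym (+-assoc (f x) _ _))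

    sumL-map : (h : A → B) (xs : List A) (f : B → ℕ) → sumL (map h xs) f ≡ sumL xs (f ∘ h)
    sumL-map h [] f = refl
    sumL-map h (x ∷ xs) f = cong (f (h x) +_) (sumL-map h xs f)

    sumL-concatMap : (h : A → List B) (xs : List A) (f : B → ℕ) →
      sumL (concatMap h xs) f ≡ sumL xs (λ x → sumL (h x) f)
    sumL-concatMap h [] f = refl
    sumL-concatMap h (x ∷ xs) f =
      trans (sumL-++ (h x) _ f) (cong (sumL (h x) f +_) (sumL-concatMap h xs f))

    sumL-concat : (xss : List (List A)) (f : A → ℕ) → sumL (concat xss) f ≡ sumL xss (λ xs → sumL xs f)
    sumL-concat [] f = refl
    sumL-concat (xs ∷ xss) f = trans (sumL-++ xs _ f) (cong (sumL xs f +_) (sumL-concat xss f))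

    sumL-swap : (xs : List A) (ys : List B) (f : A → B → ℕ) →
      sumL xs (λ x → sumL ys (f x)) ≡ sumL ys (λ y → sumL xs (λ x → f x y))
    sumL-swap [] ys f = sym (trans (sumL-const ys 0) (*-zeroʳ (length ys)))
    sumL-swap (x ∷ xs) ys f = trans (cong (sumL ys (f x) +_) (sumL-swap xs ys f))
      (sym (sumL-+ ys (f x) (λ y → sumL xs (λ x → f x y))))

    sumL-∃ : (xs : List A) {f g : A → ℕ} → sumL xs f < sumL xs g → ∃ λ x → x ∈ xs × f x < g x
    sumL-∃ (x ∷ xs) {f} {g} lt with f x <? g x
    ... | yes p = x , here refl , p
    ... | no ¬p with sumL xs f <? sumL xs g
    ...   | yes q = let y , m , r = sumL-∃ xs q in y , there m , r
    ...   | no ¬q = contradiction (+-mono-≤ (≮⇒≥ ¬p) (≮⇒≥ ¬q)) (<⇒≱ lt)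

    ≤-sumL : {xs : List A} (f : A → ℕ) {x : A} → x ∈ xs → f x ≤ sumL xs f
    ≤-sumL f (here refl) = m≤m+n _ _
    ≤-sumL f (there m) = ≤-trans (≤-sumL f m) (m≤n+m _ _)

    ind : {P : Set} → Dec P → ℕ
    ind (yes _) = 1
    ind (no _) = 0

    ind≤1 : {P : Set} (p : Dec P) → ind p ≤ 1
    ind≤1 (yes _) = ≤-refl
    ind≤1 (no _) = z≤n

    ind-mono : {P Q : Set} (p : Dec P) (q : Dec Q) → (P → Q) → ind p ≤ ind q
    ind-mono (yes a) (yes _) f = ≤-refl
    ind-mono (yes a) (no b) f = contradiction (f a) b
    ind-mono (no a) q f = z≤n

    ind-yes : {P : Set} (p : Dec P) → P → ind p ≡ 1
    ind-yes (yes _) x = refl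
    ind-yes (no ¬x) x = contradiction x ¬x

    ind-pos : {P : Set} (p : Dec P) → 0 < ind p → P
    ind-pos (yes x) _ = x

    ind-scale : {P : Set} (p : Dec P) {a b : ℕ} → (P → a ≤ b) → a * ind p ≤ b
    ind-scale (yes x) {a} h rewrite *-identityʳ a = h x
    ind-scale (no _) {a} h rewrite *-zeroʳ a = z≤n

    ind-⊎ : {P Q R : Set} (p : Dec P) (q : Dec Q) (r : Dec R) → (P → Q ⊎ R) → ind p ≤ ind q + ind r
    ind-⊎ (no _) q r f = z≤n
    ind-⊎ (yes x) q r f with f x
    ... | inj₁ y rewrite ind-yes q y = s≤s z≤n
    ... | inj₂ z rewrite ind-yes r z = m≤n+m 1 (ind q)

    ind-∧ : {P Q R : Set} (p : Dec P) (q : Dec Q) (r : Dec R) → (P → Q → R) → ind p * ind q ≤ ind r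
    ind-∧ (no _) q r f = z≤n
    ind-∧ (yes x) q r f = ≤-trans (≤-reflexive (+-identityʳ _)) (ind-mono q r (f x))

    count : {P : A → Set} → List A → (∀ x → Dec (P x)) → ℕ
    count xs P? = sumL xs (λ x → ind (P? x))

    count-mono : {P Q : A → Set} (xs : List A) (P? : ∀ x → Dec (P x)) (Q? : ∀ x → Dec (Q x)) →
      (∀ x → P x → Q x) → count xs P? ≤ count xs Q?
    count-mono xs P? Q? h = sumL-mono xs (λ x → ind-mono (P? x) (Q? x) (h x))

    count≤length : {P : A → Set} (xs : List A) (P? : ∀ x → Dec (P x)) → count xs P? ≤ length xs
    count≤length xs P? = ≤-trans (sumL-mono xs (λ x → ind≤1 (P? x)))
      (≤-reflexive (trans (sumL-const xs 1) (*-identityʳ _)))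

    count-∃ : {P : A → Set} (xs : List A) (P? : ∀ x → Dec (P x)) → 0 < count xs P? → ∃ λ x → x ∈ xs × P x
    count-∃ xs P? h =
      let x , m , lt = sumL-∃ xs {f = λ _ → 0} {g = λ x → ind (P? x)}
                         (subst (_< count xs P?) (sym (trans (sumL-const xs 0) (*-zeroʳ (length xs)))) h)
      in x , m , ind-pos (P? x) lt

    count-filter : {P : A → Set} (xs : List A) (P? : ∀ x → Dec (P x)) → length (filter P? xs) ≡ count xs P?
    count-filter [] P? = refl
    count-filter (x ∷ xs) P? with P? x
    ... | yes _ = cong suc (count-filter xs P?)
    ... | no _ = count-filter xs P?

    -- An entry below the threshold `N / (2β)` contributes at most half of the average `N / β`, so
    -- the other half comes from entries above it; as each of these is at most `N`, there must be
    -- many of them.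
    markov : (xs : List A) (f : A → ℕ) (N β : ℕ) → 0 < N → (∀ x → f x ≤ N) →
      length xs * N ≤ β * sumL xs f →
      length xs ≤ (2 * β) * count xs (λ x → N ≤? (2 * β) * f x)
    markov xs f N@(suc _) β 0<N fN h = *-cancelʳ-≤ (length xs) _ N (+-cancelʳ-≤ (length xs * N) _ _ (begin
        length xs * N + length xs * N ≡⟨ dbl (length xs * N) ⟩
        2 * (length xs * N) ≤⟨ *-monoʳ-≤ 2 h ⟩
        2 * (β * sumL xs f) ≡⟨ sym (*-assoc 2 β _) ⟩
        (2 * β) * sumL xs f ≡⟨ sym (sumL-* xs (2 * β) f) ⟩
        sumL xs (λ x → (2 * β) * f x) ≤⟨ sumL-mono xs pt ⟩
        sumL xs (λ x → (2 * β) * N * ind (N ≤? (2 * β) * f x) + N)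
          ≡⟨ sumL-+ xs (λ x → (2 * β) * N * ind (N ≤? (2 * β) * f x)) (λ _ → N) ⟩
        sumL xs (λ x → (2 * β) * N * ind (N ≤? (2 * β) * f x)) + sumL xs (λ _ → N)
          ≡⟨ cong₂ _+_ (sumL-* xs ((2 * β) * N) _) (sumL-const xs N) ⟩
        (2 * β) * N * G + length xs * N ≡⟨ cong (_+ length xs * N) (rearr (2 * β) N G) ⟩
        (2 * β) * G * N + length xs * N ∎))
      where
      open ≤-Reasoning
      G = count xs (λ x → N ≤? (2 * β) * f x)
      dbl : ∀ a → a + a ≡ 2 * a
      dbl = solve-∀
      rearr : ∀ a b c → a * b * c ≡ a * c * b
      rearr = solve-∀
      pt : ∀ x → (2 * β) * f x ≤ (2 * β) * N * ind (N ≤? (2 * β) * f x) + N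
      pt x with N ≤? (2 * β) * f x
      ... | yes _ rewrite *-identityʳ ((2 * β) * N) = ≤-trans (*-monoʳ-≤ (2 * β) (fN x)) (m≤m+n _ _)
      ... | no ¬p = ≤-trans (<⇒≤ (≰⇒> ¬p)) (m≤n+m _ _)

    vecs : List A → (m : ℕ) → List (Vec A m)
    vecs xs zero = [] ∷ []
    vecs xs (suc m) = concatMap (λ w → map (_∷ w) xs) (vecs xs m)

    sumL-vecs : (xs : List A) (m : ℕ) (f : Vec A (suc m) → ℕ) →
      sumL (vecs xs (suc m)) f ≡ sumL (vecs xs m) (λ w → sumL xs (λ v → f (v ∷ w)))
    sumL-vecs xs m f = trans (sumL-concatMap _ (vecs xs m) f)
      (sumL-cong (vecs xs m) (λ w → sumL-map (_∷ w) xs f))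

    sumL-vecs′ : (xs : List A) (m : ℕ) (f : Vec A (suc m) → ℕ) →
      sumL (vecs xs (suc m)) f ≡ sumL xs (λ v → sumL (vecs xs m) (λ w → f (v ∷ w)))
    sumL-vecs′ xs m f = trans (sumL-vecs xs m f) (sumL-swap (vecs xs m) xs (λ w v → f (v ∷ w)))

    sumL-vecs-+ : (xs : List A) (m n : ℕ) (f : Vec A (m + n) → ℕ) →
      sumL (vecs xs (m + n)) f ≡ sumL (vecs xs n) (λ w → sumL (vecs xs m) (λ u → f (u Vec.++ w)))
    sumL-vecs-+ xs zero n f = sumL-cong (vecs xs n) (λ w → sym (+-identityʳ _))
    sumL-vecs-+ xs (suc m) n f = trans (sumL-vecs xs (m + n) f)
      (trans (sumL-vecs-+ xs m n _)
             (sumL-cong (vecs xs n) (λ w → sym (sumL-vecs xs m (λ u → f (u Vec.++ w))))))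

    length-as-sum : (xs : List A) → length xs ≡ sumL xs (λ _ → 1)
    length-as-sum xs = sym (trans (sumL-const xs 1) (*-identityʳ _))

    length-vecs : (xs : List A) (m : ℕ) → length (vecs xs m) ≡ length xs ^ m
    length-vecs xs zero = refl
    length-vecs xs (suc m) = begin
      length (vecs xs (suc m)) ≡⟨ length-as-sum (vecs xs (suc m)) ⟩
      sumL (vecs xs (suc m)) (λ _ → 1) ≡⟨ sumL-vecs xs m _ ⟩
      sumL (vecs xs m) (λ _ → sumL xs (λ _ → 1)) ≡⟨ sumL-const (vecs xs m) _ ⟩
      length (vecs xs m) * sumL xs (λ _ → 1) ≡⟨ cong₂ _*_ (length-vecs xs m) (sym (length-as-sum xs)) ⟩
      length xs ^ m * length xs ≡⟨ *-comm _ (length xs) ⟩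
      length xs * length xs ^ m ∎
      where open ≡-Reasoning

    ∈-vecs : (xs : List A) {m : ℕ} (τ : Vec A m) → (∀ p → lookup τ p ∈ xs) → τ ∈ vecs xs m
    ∈-vecs xs [] h = here refl
    ∈-vecs xs {suc m} (v ∷ w) h = MemP.∈-concatMap⁺ (λ w → map (_∷ w) xs)
      (Any.map (λ { refl → MemP.∈-map⁺ (_∷ w) (h zero) }) (∈-vecs xs w (h ∘ suc)))

    vecs-∈ : (xs : List A) {m : ℕ} (τ : Vec A m) → τ ∈ vecs xs m → ∀ p → lookup τ p ∈ xs
    vecs-∈ xs {suc m} τ τ∈ p with find (MemP.∈-concatMap⁻ (λ w → map (_∷ w) xs) {xs = vecs xs m} τ∈)
    ... | w , w∈ , τ∈m with MemP.∈-map⁻ (_∷ w) τ∈m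
    vecs-∈ xs {suc m} τ τ∈ zero | w , w∈ , τ∈m | v , v∈ , refl = v∈
    vecs-∈ xs {suc m} τ τ∈ (suc p) | w , w∈ , τ∈m | v , v∈ , refl = vecs-∈ xs w w∈ p

    -- Freezing all coordinates except `p` splits the tuples into lines of `length xs` points, and
    -- each line carries at most `B`.
    coord-bound : (xs : List A) {m : ℕ} (p : Fin m) (f : Vec A m → ℕ) (B : ℕ) →
      (∀ τ → sumL xs (λ v → f (τ [ p ]≔ v)) ≤ B) →
      length xs * sumL (vecs xs m) f ≤ length xs ^ m * B
    coord-bound xs {suc m} zero f B h = begin
      length xs * sumL (vecs xs (suc m)) f ≡⟨ cong (length xs *_) (sumL-vecs xs m f) ⟩
      length xs * sumL (vecs xs m) (λ w → sumL xs (λ v → f (v ∷ w)))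
        ≤⟨ *-monoʳ-≤ (length xs) (sumL-mono (vecs xs m) (inner xs refl)) ⟩
      length xs * sumL (vecs xs m) (λ _ → B)
        ≡⟨ cong (length xs *_) (trans (sumL-const (vecs xs m) B) (cong (_* B) (length-vecs xs m))) ⟩
      length xs * (length xs ^ m * B) ≡⟨ sym (*-assoc (length xs) _ B) ⟩
      length xs ^ suc m * B ∎
      where
      open ≤-Reasoning
      -- The hypothesis speaks of a full vector, whose entry at `zero` is overwritten anyway. That
      -- entry is borrowed from `xs`; if `xs` is empty, so is the sum.
      inner : ∀ ys → ys ≡ xs → ∀ w → sumL xs (λ v → f (v ∷ w)) ≤ B
      inner [] refl w = z≤n
      inner (y ∷ _) refl w = h (y ∷ w)
    coord-bound xs {suc m} (suc p) f B h = begin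
      length xs * sumL (vecs xs (suc m)) f ≡⟨ cong (length xs *_) (sumL-vecs′ xs m f) ⟩
      length xs * sumL xs (λ v → sumL (vecs xs m) (λ w → f (v ∷ w))) ≡⟨ sym (sumL-* xs (length xs) _) ⟩
      sumL xs (λ v → length xs * sumL (vecs xs m) (λ w → f (v ∷ w)))
        ≤⟨ sumL-mono xs (λ v → coord-bound xs p (λ w → f (v ∷ w)) B (λ τ → h (v ∷ τ))) ⟩
      sumL xs (λ _ → length xs ^ m * B) ≡⟨ sumL-const xs _ ⟩
      length xs * (length xs ^ m * B) ≡⟨ sym (*-assoc (length xs) _ B) ⟩
      length xs ^ suc m * B ∎
      where open ≤-Reasoning

    module _ (xs : List A) {Ω : List A → Set} (Ω? : ∀ w → Dec (Ω w)) (q : ℕ) where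
      private N = length xs

      greedy-cons : ∀ m → (∀ w → length w < m → Ω w → N ≤ q * count xs (λ v → Ω? (v ∷ w))) → Ω [] →
        N ^ m ≤ q ^ m * count (vecs xs m) (λ τ → Ω? (toList τ))
      greedy-cons zero step Ω[] rewrite ind-yes (Ω? []) Ω[] = s≤s z≤n
      greedy-cons (suc m) step Ω[] = begin
        N * N ^ m ≤⟨ *-monoʳ-≤ N (greedy-cons m (λ w lt → step w (m<n⇒m<1+n lt)) Ω[]) ⟩
        N * (q ^ m * S) ≡⟨ r1 N (q ^ m) S ⟩
        q ^ m * (N * S) ≡⟨ cong (q ^ m *_) (sym (sumL-* (vecs xs m) N _)) ⟩
        q ^ m * sumL (vecs xs m) (λ w → N * ind (Ω? (toList w)))
          ≤⟨ *-monoʳ-≤ (q ^ m) (sumL-mono (vecs xs m) (λ w → ind-scale (Ω? (toList w))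
               (step (toList w) (s≤s (≤-reflexive (VecP.length-toList w)))))) ⟩
        q ^ m * sumL (vecs xs m) (λ w → q * count xs (λ v → Ω? (v ∷ toList w)))
          ≡⟨ cong (q ^ m *_) (sumL-* (vecs xs m) q _) ⟩
        q ^ m * (q * sumL (vecs xs m) (λ w → count xs (λ v → Ω? (v ∷ toList w)))) ≡⟨ r2 (q ^ m) q _ ⟩
        q * q ^ m * sumL (vecs xs m) (λ w → count xs (λ v → Ω? (v ∷ toList w)))
          ≡⟨ cong (q * q ^ m *_) (sym (sumL-vecs xs m (λ τ → ind (Ω? (toList τ))))) ⟩
        q * q ^ m * count (vecs xs (suc m)) (λ τ → Ω? (toList τ)) ∎
        where
        open ≤-Reasoning
        S = count (vecs xs m) (λ τ → Ω? (toList τ))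
        r1 : ∀ a b c → a * (b * c) ≡ b * (a * c)
        r1 = solve-∀
        r2 : ∀ a b c → a * (b * c) ≡ b * a * c
        r2 = solve-∀

      -- Connectors grow away from both fixed ends: to the left of `y` by `greedy-cons`, to the
      -- right of `x` by this version. A vector is split at its head, so the induction carries the
      -- prefix `pre` chosen so far; `M` bounds the final length.
      greedy-snoc : ∀ M → (∀ w → length w < M → Ω w → N ≤ q * count xs (λ v → Ω? (w ∷ʳ v))) →
        ∀ m pre → length pre + m ≤ M → Ω pre →
        N ^ m ≤ q ^ m * count (vecs xs m) (λ τ → Ω? (pre ++ toList τ))
      greedy-snoc M step zero pre len Ωp
        rewrite ind-yes (Ω? (pre ++ [])) (subst Ω (sym (ListP.++-identityʳ pre)) Ωp) = s≤s z≤n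
      greedy-snoc M step (suc m) pre len Ωp = begin
        N * N ^ m ≤⟨ *-monoˡ-≤ (N ^ m) (step pre (≤-trans (≤-trans (m≤m+n (suc (length pre)) m)
                        (≤-reflexive (sym (+-suc (length pre) m)))) len) Ωp) ⟩
        q * count xs (λ v → Ω? (pre ∷ʳ v)) * N ^ m ≡⟨ r1 q _ (N ^ m) ⟩
        q * (N ^ m * count xs (λ v → Ω? (pre ∷ʳ v))) ≡⟨ cong (q *_) (sym (sumL-* xs (N ^ m) _)) ⟩
        q * sumL xs (λ v → N ^ m * ind (Ω? (pre ∷ʳ v)))
          ≤⟨ *-monoʳ-≤ q (sumL-mono xs (λ v → ind-scale (Ω? (pre ∷ʳ v)) (rec v))) ⟩
        q * sumL xs (λ v → q ^ m * sumL (vecs xs m) (λ w → ind (Ω? (pre ++ v ∷ toList w))))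
          ≡⟨ cong (q *_) (sumL-* xs (q ^ m) _) ⟩
        q * (q ^ m * sumL xs (λ v → sumL (vecs xs m) (λ w → ind (Ω? (pre ++ v ∷ toList w)))))
          ≡⟨ sym (*-assoc q (q ^ m) _) ⟩
        q * q ^ m * sumL xs (λ v → sumL (vecs xs m) (λ w → ind (Ω? (pre ++ v ∷ toList w))))
          ≡⟨ cong (q * q ^ m *_) (sym (sumL-vecs′ xs m (λ τ → ind (Ω? (pre ++ toList τ))))) ⟩
        q * q ^ m * count (vecs xs (suc m)) (λ τ → Ω? (pre ++ toList τ)) ∎
        where
        open ≤-Reasoning
        r1 : ∀ a b c → a * b * c ≡ a * (c * b)
        r1 = solve-∀
        rec : ∀ v → Ω (pre ∷ʳ v) →
          N ^ m ≤ q ^ m * sumL (vecs xs m) (λ w → ind (Ω? (pre ++ v ∷ toList w)))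
        rec v Ωv = ≤-trans
          (greedy-snoc M step m (pre ∷ʳ v)
            (≤-trans (≤-reflexive (trans (cong (_+ m) (ListP.length-++ pre))
               (trans (+-assoc (length pre) 1 m) refl))) len) Ωv)
          (*-monoʳ-≤ (q ^ m) (count-mono (vecs xs m) _ _
            (λ w → subst Ω (ListP.++-assoc pre [ v ] (toList w)))))

    count-vecs-all : {P : A → Set} (xs : List A) (P? : ∀ x → Dec (P x)) (t : ℕ) →
      count xs P? ^ t ≤ count (vecs xs t) (λ g → FinP.all? (λ j → P? (lookup g j)))
    count-vecs-all xs P? zero = ≤-reflexive (sym (trans (+-identityʳ _)
      (ind-yes (FinP.all? (λ j → P? (lookup [] j))) (λ ()))))
    count-vecs-all {P = P} xs P? (suc t) = begin
      count xs P? * count xs P? ^ t ≤⟨ *-monoʳ-≤ (count xs P?) (count-vecs-all xs P? t) ⟩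
      count xs P? * sumL (vecs xs t) (λ g → ind (all g)) ≡⟨ sym (sumL-* (vecs xs t) (count xs P?) _) ⟩
      sumL (vecs xs t) (λ g → count xs P? * ind (all g))
        ≡⟨ sumL-cong (vecs xs t) (λ g → sym (sumL-*ʳ xs (ind (all g)) (λ v → ind (P? v)))) ⟩
      sumL (vecs xs t) (λ g → sumL xs (λ v → ind (P? v) * ind (all g)))
        ≤⟨ sumL-mono (vecs xs t) (λ g → sumL-mono xs (λ v → ind-∧ (P? v) (all g) (all (v ∷ g))
             (λ pv pg → λ { zero → pv ; (suc j) → pg j }))) ⟩
      sumL (vecs xs t) (λ g → sumL xs (λ v → ind (all (v ∷ g)))) ≡⟨ sym (sumL-vecs xs t _) ⟩
      count (vecs xs (suc t)) all ∎
      where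
      open ≤-Reasoning
      all : ∀ {t} (g : Vec _ t) → Dec (∀ j → P (lookup g j))
      all g = FinP.all? (λ j → P? (lookup g j))

    ^-distribʳ-* : ∀ t a b → (a * b) ^ t ≡ a ^ t * b ^ t
    ^-distribʳ-* zero a b = refl
    ^-distribʳ-* (suc t) a b = trans (cong (a * b *_) (^-distribʳ-* t a b)) (r a b (a ^ t) (b ^ t))
      where
      r : ∀ a b c d → a * b * (c * d) ≡ a * c * (b * d)
      r = solve-∀

  open Sums

  -- Supersaturation: blowing up the variables

  blowConst : ℕ → ℕ → ℕ → ℕ
  blowConst t zero β = β
  blowConst t (suc m) β = 2 * (2 * β * (2 * β) ^ t) * blowConst t m (2 * (2 * β * (2 * β) ^ t))

  module _ {A : Set} (t : ℕ) where

    -- Reads `τ` as `m` groups of `t` copies and demands `Q` for every choice of one copy per group.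
    -- Peeling off one group at a time is the form that the induction in `blow-up` needs;
    -- `AllSel-pick` recovers the statement about choices, `combine i j` being the place of copy `j`
    -- of variable `i`.
    AllSel : ∀ m → (Vec A m → Set) → Vec A (m * t) → Set
    AllSel zero Q τ = Q []
    AllSel (suc m) Q τ = AllSel m (λ w → ∀ j → Q (lookup (Vec.take t τ) j ∷ w)) (Vec.drop t τ)

    AllSel? : ∀ m {Q : Vec A m → Set} → (∀ w → Dec (Q w)) → ∀ τ → Dec (AllSel m Q τ)
    AllSel? zero Q? τ = Q? []
    AllSel? (suc m) Q? τ = AllSel? m (λ w → FinP.all? (λ j → Q? (lookup (Vec.take t τ) j ∷ w))) (Vec.drop t τ)

    AllSel-pick : ∀ m {Q : Vec A m → Set} (τ : Vec A (m * t)) → AllSel m Q τ → (c : Fin m → Fin t) →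
      Q (Vec.tabulate (λ i → lookup τ (combine i (c i))))
    AllSel-pick zero τ h c = h
    AllSel-pick (suc m) {Q} τ h c = subst Q
      (cong₂ _∷_ eq₁ (VecP.tabulate-cong (λ i → eq₂ (combine i (c (suc i))))))
      (AllSel-pick m (Vec.drop t τ) h (c ∘ suc) (c zero))
      where
      eq₁ : lookup (Vec.take t τ) (c zero) ≡ lookup τ (c zero ↑ˡ (m * t))
      eq₁ = trans (sym (VecP.lookup-++ˡ (Vec.take t τ) (Vec.drop t τ) (c zero)))
                  (cong (λ v → lookup v (c zero ↑ˡ (m * t))) (VecP.take++drop≡id t τ))
      eq₂ : ∀ j → lookup (Vec.drop t τ) j ≡ lookup τ (t ↑ʳ j)
      eq₂ j = trans (sym (VecP.lookup-++ʳ (Vec.take t τ) (Vec.drop t τ) j))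
                    (cong (λ v → lookup v (t ↑ʳ j)) (VecP.take++drop≡id t τ))

    take-drop-++ : ∀ {m} (g : Vec A t) (w : Vec A m) → Vec.take t (g Vec.++ w) ≡ g × Vec.drop t (g Vec.++ w) ≡ w
    take-drop-++ g w = VecP.++-injective _ g (VecP.take++drop≡id t (g Vec.++ w))

    -- Supersaturation: each variable in turn is replaced by t independent copies,
    -- Markov's inequality being used once before and once after the replacement.
    blow-up : (xs : List A) → 0 < length xs → ∀ m β {Q : Vec A m → Set} (Q? : ∀ w → Dec (Q w)) →
      length xs ^ m ≤ β * count (vecs xs m) Q? →
      length xs ^ (m * t) ≤ blowConst t m β * count (vecs xs (m * t)) (AllSel? m Q?)
    blow-up xs 0<N zero β Q? h = h
    blow-up xs 0<N (suc m) β {Q} Q? h = begin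
      N ^ (t + m * t) ≡⟨ ^-distribˡ-+-* N t (m * t) ⟩
      N ^ t * N ^ (m * t)
        ≤⟨ *-monoˡ-≤ (N ^ (m * t)) (subst (_≤ β₂ * G) (length-vecs xs t) mark₂) ⟩
      β₂ * G * N ^ (m * t) ≡⟨ rot β₂ G (N ^ (m * t)) ⟩
      β₂ * (N ^ (m * t) * G) ≡⟨ cong (β₂ *_) (sym (sumL-* (vecs xs t) (N ^ (m * t)) _)) ⟩
      β₂ * sumL (vecs xs t) (λ g → N ^ (m * t) * ind (good g))
        ≤⟨ *-monoʳ-≤ β₂ (sumL-mono (vecs xs t) (λ g → ind-scale (good g) (IH g))) ⟩
      β₂ * sumL (vecs xs t) (λ g → b * count (vecs xs (m * t)) (AllSel? m (Qg? g)))
        ≡⟨ cong (β₂ *_) (sumL-* (vecs xs t) b _) ⟩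
      β₂ * (b * sumL (vecs xs t) (λ g → count (vecs xs (m * t)) (AllSel? m (Qg? g))))
        ≡⟨ sym (*-assoc β₂ b _) ⟩
      β₂ * b * sumL (vecs xs t) (λ g → count (vecs xs (m * t)) (AllSel? m (Qg? g)))
        ≡⟨ cong (β₂ * b *_) (sumL-swap (vecs xs t) (vecs xs (m * t)) _) ⟩
      β₂ * b * sumL (vecs xs (m * t)) (λ w → sumL (vecs xs t) (λ g → ind (AllSel? m (Qg? g) w)))
        ≤⟨ *-monoʳ-≤ (β₂ * b) (sumL-mono (vecs xs (m * t)) (λ w → sumL-mono (vecs xs t) (λ g →
             ind-mono (AllSel? m (Qg? g) w) (AllSel? (suc m) Q? (g Vec.++ w)) (fold g w)))) ⟩
      β₂ * b * sumL (vecs xs (m * t)) (λ w → sumL (vecs xs t) (λ g → ind (AllSel? (suc m) Q? (g Vec.++ w))))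
        ≡⟨ cong (β₂ * b *_) (sym (sumL-vecs-+ xs t (m * t) _)) ⟩
      β₂ * b * count (vecs xs (t + m * t)) (AllSel? (suc m) Q?) ∎
      where
      open ≤-Reasoning
      N = length xs
      -- The first use of Markov's inequality costs `2 * β` for the share of tails `w` with many
      -- heads; each such tail admits at least a `(2 * β) ^ t`-th part of all `t`-tuples of heads.
      -- The second use doubles the product, and `β₂` is both the price for the tuples `g` and the
      -- inverse density left for the other variables.
      β₁ = 2 * β * (2 * β) ^ t
      β₂ = 2 * β₁
      b = blowConst t m β₂
      rot : ∀ a b c → a * b * c ≡ a * (c * b)
      rot = solve-∀
      Qg : Vec A t → Vec A m → Set
      Qg g w = ∀ j → Q (lookup g j ∷ w)
      Qg? : ∀ g w → Dec (Qg g w)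
      Qg? g w = FinP.all? (λ j → Q? (lookup g j ∷ w))
      f : Vec A m → ℕ
      f w = count xs (λ v → Q? (v ∷ w))
      f′ : Vec A t → ℕ
      f′ g = count (vecs xs m) (Qg? g)
      good : ∀ g → Dec (N ^ m ≤ (2 * β₁) * f′ g)
      good g = N ^ m ≤? (2 * β₁) * f′ g
      G = count (vecs xs t) good
      good₀ : ∀ w → Dec (N ≤ (2 * β) * f w)
      good₀ w = N ≤? (2 * β) * f w
      mark₁ : length (vecs xs m) ≤ (2 * β) * count (vecs xs m) good₀
      mark₁ = markov (vecs xs m) f N β 0<N (λ w → count≤length xs _) (begin
        length (vecs xs m) * N ≡⟨ cong (_* N) (length-vecs xs m) ⟩
        N ^ m * N ≡⟨ *-comm (N ^ m) N ⟩
        N * N ^ m ≤⟨ h ⟩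
        β * count (vecs xs (suc m)) Q? ≡⟨ cong (β *_) (sumL-vecs xs m _) ⟩
        β * sumL (vecs xs m) f ∎)
      goodF : ∀ w → N ≤ (2 * β) * f w → N ^ t ≤ (2 * β) ^ t * count (vecs xs t) (λ g → Qg? g w)
      goodF w le = begin
        N ^ t ≤⟨ ^-monoˡ-≤ t le ⟩
        ((2 * β) * f w) ^ t ≡⟨ ^-distribʳ-* t (2 * β) (f w) ⟩
        (2 * β) ^ t * f w ^ t ≤⟨ *-monoʳ-≤ ((2 * β) ^ t) (count-vecs-all xs (λ v → Q? (v ∷ w)) t) ⟩
        (2 * β) ^ t * count (vecs xs t) (λ g → Qg? g w) ∎
      -- Pairs of a tail and a `t`-tuple of its heads are numerous as seen from the tails; they are
      -- now averaged over the tuples.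
      mark₂ : length (vecs xs t) ≤ (2 * β₁) * G
      mark₂ = markov (vecs xs t) f′ (N ^ m) β₁ (m^n>0 N ⦃ >-nonZero 0<N ⦄ m)
        (λ g → ≤-trans (count≤length (vecs xs m) _) (≤-reflexive (length-vecs xs m))) (begin
        length (vecs xs t) * N ^ m ≡⟨ cong₂ _*_ (length-vecs xs t) (sym (length-vecs xs m)) ⟩
        N ^ t * length (vecs xs m) ≤⟨ *-monoʳ-≤ (N ^ t) mark₁ ⟩
        N ^ t * ((2 * β) * count (vecs xs m) good₀) ≡⟨ r₁ (N ^ t) (2 * β) _ ⟩
        2 * β * (N ^ t * count (vecs xs m) good₀) ≡⟨ cong (2 * β *_) (sym (sumL-* (vecs xs m) (N ^ t) _)) ⟩
        2 * β * sumL (vecs xs m) (λ w → N ^ t * ind (good₀ w))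
          ≤⟨ *-monoʳ-≤ (2 * β) (sumL-mono (vecs xs m) (λ w → ind-scale (good₀ w) (goodF w))) ⟩
        2 * β * sumL (vecs xs m) (λ w → (2 * β) ^ t * count (vecs xs t) (λ g → Qg? g w))
          ≡⟨ cong (2 * β *_) (sumL-* (vecs xs m) ((2 * β) ^ t) _) ⟩
        2 * β * ((2 * β) ^ t * sumL (vecs xs m) (λ w → count (vecs xs t) (λ g → Qg? g w)))
          ≡⟨ sym (*-assoc (2 * β) _ _) ⟩
        β₁ * sumL (vecs xs m) (λ w → count (vecs xs t) (λ g → Qg? g w))
          ≡⟨ cong (β₁ *_) (sumL-swap (vecs xs m) (vecs xs t) _) ⟩
        β₁ * sumL (vecs xs t) f′ ∎)
        where
        r₁ : ∀ a b c → a * (b * c) ≡ b * (a * c)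
        r₁ = solve-∀
      IH : ∀ g → N ^ m ≤ (2 * β₁) * f′ g → N ^ (m * t) ≤ b * count (vecs xs (m * t)) (AllSel? m (Qg? g))
      IH g le = blow-up xs 0<N m β₂ (Qg? g) le
      fold : ∀ g w → AllSel m (Qg g) w → AllSel (suc m) Q (g Vec.++ w)
      fold g w = subst₂ (λ g′ w′ → AllSel m (λ u → ∀ j → Q (lookup g′ j ∷ u)) w′)
        (sym (proj₁ (take-drop-++ g w))) (sym (proj₂ (take-drop-++ g w)))

  -- Rare events and the union bound

  record Event {A : Set} (xs : List A) (m θ : ℕ) : Set where
    field
      -- A Boolean instead of a predicate, so that events of every kind form one list in `Set`.
      test : Vec A m → Bool
      coord : Fin m

    E : Vec A m → Set
    E τ = test τ ≡ true

    E? : ∀ τ → Dec (E τ)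
    E? τ = test τ Data.Bool.≟ true

    field
      -- The other coordinates are arbitrary: the event has probability at most `1 / θ` on every
      -- line in direction `coord`.
      bound : ∀ τ → θ * count xs (λ v → E? (τ [ coord ]≔ v)) ≤ length xs

  open Event

  does-true : {P : Set} (p : Dec P) → does p ≡ true → P
  does-true (yes x) _ = x

  true-does : {P : Set} (p : Dec P) → P → does p ≡ true
  true-does (yes _) _ = refl
  true-does (no ¬x) x = contradiction x ¬x

  mkEvent : {A : Set} {xs : List A} {m θ : ℕ} {P : Vec A m → Set} (P? : ∀ τ → Dec (P τ)) (p : Fin m) →
    (∀ τ → θ * count xs (λ v → P? (τ [ p ]≔ v)) ≤ length xs) → Event xs m θ
  mkEvent {xs = xs} {θ = θ} P? p h = record
    { test = λ τ → does (P? τ) ; coord = p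
    ; bound = λ τ → ≤-trans (*-monoʳ-≤ θ (count-mono xs _ _ (λ v → does-true (P? _)))) (h τ) }

  module _ {A : Set} (xs : List A) (0<N : 0 < length xs) {m θ : ℕ} where
    private N = length xs

    None : List (Event xs m θ) → Vec A m → Set
    None es τ = All (λ e → ¬ E e τ) es

    None? : ∀ es τ → Dec (None es τ)
    None? es τ = All.all? (λ e → ¬? (E? e τ)) es

    event-rare : (e : Event xs m θ) → θ * count (vecs xs m) (E? e) ≤ N ^ m
    event-rare e = *-cancelˡ-≤ N ⦃ >-nonZero 0<N ⦄ (begin
      N * (θ * count (vecs xs m) (E? e)) ≡⟨ cong (N *_) (sym (sumL-* (vecs xs m) θ _)) ⟩
      N * sumL (vecs xs m) (λ τ → θ * ind (E? e τ))
        ≤⟨ coord-bound xs (coord e) (λ τ → θ * ind (E? e τ)) N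
             (λ τ → ≤-trans (≤-reflexive (sumL-* xs θ _)) (bound e τ)) ⟩
      N ^ m * N ≡⟨ *-comm (N ^ m) N ⟩
      N * N ^ m ∎)
      where open ≤-Reasoning

    -- Union bound: each event spoils at most a `θ`-th part of all vectors, and
    -- `2 * β * length es ≤ θ` keeps the total loss within half of the guaranteed share `1 / β`.
    clean : {P : Vec A m → Set} (P? : ∀ τ → Dec (P τ)) (es : List (Event xs m θ)) (β : ℕ) → 0 < θ →
      2 * β * length es ≤ θ → N ^ m ≤ β * count (vecs xs m) P? →
      N ^ m ≤ 2 * β * count (vecs xs m) (λ τ → P? τ ×-dec None? es τ)
    clean {P} P? es β 0<θ few h = +-cancelʳ-≤ (N ^ m) _ _ (begin
      N ^ m + N ^ m ≡⟨ dbl (N ^ m) ⟩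
      2 * N ^ m ≤⟨ *-monoʳ-≤ 2 h ⟩
      2 * (β * cP) ≡⟨ sym (*-assoc 2 β cP) ⟩
      2 * β * cP ≤⟨ *-monoʳ-≤ (2 * β) split ⟩
      2 * β * (c′ + Y) ≡⟨ *-distribˡ-+ (2 * β) c′ Y ⟩
      2 * β * c′ + 2 * β * Y ≤⟨ +-monoʳ-≤ (2 * β * c′) Y-small ⟩
      2 * β * c′ + N ^ m ∎)
      where
      open ≤-Reasoning
      dbl : ∀ a → a + a ≡ 2 * a
      dbl = solve-∀
      cP = count (vecs xs m) P?
      c′ = count (vecs xs m) (λ τ → P? τ ×-dec None? es τ)
      Y = sumL es (λ e → count (vecs xs m) (E? e))
      some : ∀ es τ → 1 ≤ ind (None? es τ) + sumL es (λ e → ind (E? e τ))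
      some [] τ = s≤s z≤n
      some (e ∷ es) τ = helper (E? e τ)
        where
        helper : (d : Dec (E e τ)) → 1 ≤ ind (None? (e ∷ es) τ) + (ind d + sumL es (λ e → ind (E? e τ)))
        helper (yes _) = ≤-trans (s≤s z≤n) (m≤n+m (suc (sumL es (λ e → ind (E? e τ)))) (ind (None? (e ∷ es) τ)))
        helper (no ¬e) = ≤-trans (some es τ) (+-monoˡ-≤ _ (ind-mono (None? es τ) (None? (e ∷ es) τ) (¬e ∷_)))
      pt : ∀ τ → ind (P? τ) ≤ ind (P? τ ×-dec None? es τ) + sumL es (λ e → ind (E? e τ))
      pt τ with P? τ
      ... | no _ = z≤n
      ... | yes p = ≤-trans (some es τ) (+-monoˡ-≤ _ (ind-mono (None? es τ) (yes p ×-dec None? es τ) (p ,_)))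
      split : cP ≤ c′ + Y
      split = ≤-trans (sumL-mono (vecs xs m) pt) (≤-reflexive
        (trans (sumL-+ (vecs xs m) _ _) (cong (c′ +_) (sumL-swap (vecs xs m) es _))))
      Y-small : 2 * β * Y ≤ N ^ m
      Y-small = *-cancelˡ-≤ θ ⦃ >-nonZero 0<θ ⦄ (begin
        θ * (2 * β * Y) ≡⟨ r θ (2 * β) Y ⟩
        2 * β * (θ * Y) ≡⟨ cong (2 * β *_) (sym (sumL-* es θ _)) ⟩
        2 * β * sumL es (λ e → θ * count (vecs xs m) (E? e)) ≤⟨ *-monoʳ-≤ (2 * β) (sumL-mono es event-rare) ⟩
        2 * β * sumL es (λ _ → N ^ m) ≡⟨ cong (2 * β *_) (sumL-const es (N ^ m)) ⟩
        2 * β * (length es * N ^ m) ≡⟨ sym (*-assoc (2 * β) _ _) ⟩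
        2 * β * length es * N ^ m ≤⟨ *-monoˡ-≤ (N ^ m) few ⟩
        θ * N ^ m ∎)
        where
        r : ∀ a b c → a * (b * c) ≡ b * (a * c)
        r = solve-∀

  -- Pigeonhole, subsets and lists of vertices

  module _ {A B : Set} (R : A → B → Set) where

    rel-length : (xs : List A) (ys : List B) → Unique xs → (∀ x → x ∈ xs → ∃ λ y → y ∈ ys × R x y) →
      (∀ {x x′ y} → R x y → R x′ y → x ≡ x′) → length xs ≤ length ys
    rel-length [] ys u h inj = z≤n
    rel-length (x ∷ xs) ys (x# ∷ u) h inj with h x (here refl)
    ... | y , y∈ , Rxy with MemP.∈-∃++ y∈
    ... | as , bs , refl = ≤-trans (s≤s (rel-length xs (as ++ bs) u h′ inj))
        (≤-reflexive (trans (cong suc (ListP.length-++ as))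
          (trans (sym (+-suc (length as) (length bs))) (sym (ListP.length-++ as)))))
      where
      h′ : ∀ x → x ∈ xs → ∃ λ y → y ∈ as ++ bs × R x y
      h′ x′ x′∈ with h x′ (there x′∈)
      ... | y′ , y′∈ , Rxy′ with MemP.∈-++⁻ as y′∈
      ... | inj₁ m = y′ , MemP.∈-++⁺ˡ m , Rxy′
      ... | inj₂ (there m) = y′ , MemP.∈-++⁺ʳ as m , Rxy′
      ... | inj₂ (here refl) = contradiction (inj Rxy Rxy′) (All.lookup x# x′∈)

  ∈-allSubsets : ∀ {n} (S : Subset n) → S ∈ allSubsets n
  ∈-allSubsets [] = here refl
  ∈-allSubsets {suc n} (outside ∷ S) = MemP.∈-++⁺ˡ (MemP.∈-map⁺ (outside ∷_) (∈-allSubsets S))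
  ∈-allSubsets {suc n} (inside ∷ S) = MemP.∈-++⁺ʳ (map (outside ∷_) (allSubsets n)) (MemP.∈-map⁺ (inside ∷_) (∈-allSubsets S))

  Unique-allSubsets : ∀ n → Unique (allSubsets n)
  Unique-allSubsets zero = [] ∷ []
  Unique-allSubsets (suc n) = UniP.++⁺
    (UniP.map⁺ VecP.∷-injectiveʳ (Unique-allSubsets n)) (UniP.map⁺ VecP.∷-injectiveʳ (Unique-allSubsets n))
    λ { (m₁ , m₂) → case MemP.∈-map⁻ (outside ∷_) m₁ , MemP.∈-map⁻ (inside ∷_) m₂ of
        λ { ((_ , _ , refl) , (_ , _ , ())) } }

  module _ {n : ℕ} where

    ∣⁅v⁆∪S∣ : (v : Fin n) (S : Subset n) → v Sub.∉ S → ∣ ⁅ v ⁆ ∪ S ∣ ≡ suc ∣ S ∣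
    ∣⁅v⁆∪S∣ = go
      where
      go : ∀ {n} (v : Fin n) (S : Subset n) → v Sub.∉ S → ∣ ⁅ v ⁆ ∪ S ∣ ≡ suc ∣ S ∣
      go zero (true ∷ S) v∉ = contradiction Vec.here v∉
      go zero (false ∷ S) v∉ = cong (suc ∘ ∣_∣) (SubP.∪-identityˡ S)
      go (suc v) (true ∷ S) v∉ = cong suc (go v S (v∉ ∘ Vec.there))
      go (suc v) (false ∷ S) v∉ = go v S (v∉ ∘ Vec.there)

    ⁅v⁆∪S≡S : (v : Fin n) (S : Subset n) → v Sub.∈ S → ⁅ v ⁆ ∪ S ≡ S
    ⁅v⁆∪S≡S = go
      where
      go : ∀ {n} (v : Fin n) (S : Subset n) → v Sub.∈ S → ⁅ v ⁆ ∪ S ≡ S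
      go zero (true ∷ S) Vec.here = cong (true ∷_) (SubP.∪-identityˡ S)
      go (suc v) (s ∷ S) (Vec.there m) = cong (s ∷_) (go v S m)

    set : List (Fin n) → Subset n
    set = List.foldr (λ v S → ⁅ v ⁆ ∪ S) Sub.⊥

    set-↭ : {l l′ : List (Fin n)} → l ↭ l′ → set l ≡ set l′
    set-↭ Perm.refl = refl
    set-↭ (prep v p) = cong (⁅ v ⁆ ∪_) (set-↭ p)
    set-↭ (swap {xs} {ys} v w p) = begin
      ⁅ v ⁆ ∪ (⁅ w ⁆ ∪ set xs) ≡⟨ sym (SubP.∪-assoc ⁅ v ⁆ ⁅ w ⁆ (set xs)) ⟩
      (⁅ v ⁆ ∪ ⁅ w ⁆) ∪ set xs ≡⟨ cong₂ _∪_ (SubP.∪-comm ⁅ v ⁆ ⁅ w ⁆) (set-↭ p) ⟩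
      (⁅ w ⁆ ∪ ⁅ v ⁆) ∪ set ys ≡⟨ SubP.∪-assoc ⁅ w ⁆ ⁅ v ⁆ (set ys) ⟩
      ⁅ w ⁆ ∪ (⁅ v ⁆ ∪ set ys) ∎
      where open ≡-Reasoning
    set-↭ (Perm.trans p q) = trans (set-↭ p) (set-↭ q)

    ∈-set⁺ : {v : Fin n} {l : List (Fin n)} → v ∈ l → v Sub.∈ set l
    ∈-set⁺ {v} {w ∷ l} (here refl) = SubP.x∈p∪q⁺ (inj₁ (SubP.x∈⁅x⁆ v))
    ∈-set⁺ {v} {w ∷ l} (there m) = SubP.x∈p∪q⁺ (inj₂ (∈-set⁺ m))

    ∈-set⁻ : {v : Fin n} (l : List (Fin n)) → v Sub.∈ set l → v ∈ l
    ∈-set⁻ [] m = contradiction m SubP.∉⊥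
    ∈-set⁻ (w ∷ l) m with SubP.x∈p∪q⁻ ⁅ w ⁆ (set l) m
    ... | inj₁ m′ = here (SubP.x∈⁅y⁆⇒x≡y w m′)
    ... | inj₂ m′ = there (∈-set⁻ l m′)

    ∉⇒All≢ : {v : Fin n} {l : List (Fin n)} → v ∉ l → All (v ≢_) l
    ∉⇒All≢ v∉ = All.tabulate (λ { m refl → v∉ m })

    ∣set∣ : {l : List (Fin n)} → Unique l → ∣ set l ∣ ≡ length l
    ∣set∣ {[]} u = SubP.∣⊥∣≡0 n
    ∣set∣ {v ∷ l} (v# ∷ u) = trans (∣⁅v⁆∪S∣ v (set l) (λ m → All.lookup v# (∈-set⁻ l m) refl)) (cong suc (∣set∣ u))

    ∣set∣≤ : (l : List (Fin n)) → ∣ set l ∣ ≤ length l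
    ∣set∣≤ [] = ≤-reflexive (SubP.∣⊥∣≡0 n)
    ∣set∣≤ (v ∷ l) with v SubP.∈? set l
    ... | yes m rewrite ⁅v⁆∪S≡S v (set l) m = m≤n⇒m≤1+n (∣set∣≤ l)
    ... | no m rewrite ∣⁅v⁆∪S∣ v (set l) m = s≤s (∣set∣≤ l)

    -- A repeated vertex adds nothing to `set l`, so full cardinality excludes repetitions. This
    -- makes `Unique` decidable, and it makes every window that is an edge free of repetitions.
    set-Unique : (l : List (Fin n)) → ∣ set l ∣ ≡ length l → Unique l
    set-Unique [] eq = []
    set-Unique (v ∷ l) eq with v SubP.∈? set l
    ... | yes m rewrite ⁅v⁆∪S≡S v (set l) m = contradiction (≤-trans (≤-reflexive (sym eq)) (∣set∣≤ l)) (<⇒≱ ≤-refl)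
    ... | no m rewrite ∣⁅v⁆∪S∣ v (set l) m = ∉⇒All≢ (m ∘ ∈-set⁺) ∷ set-Unique l (suc-injective eq)

    ⊆-size-≡ : {p e : Subset n} → p Sub.⊆ e → ∣ p ∣ ≡ ∣ e ∣ → p ≡ e
    ⊆-size-≡ {p} {e} p⊆e eq = SubP.⊆-antisym p⊆e e⊆p
      where
      e⊆p : e Sub.⊆ p
      e⊆p {x} x∈e with x SubP.∈? p
      ... | yes m = m
      ... | no m = contradiction eq (<⇒≢ (SubP.p⊂q⇒∣p∣<∣q∣ (p⊆e , x , x∈e , m)))

    missing : (S e : Subset n) → ∣ S ∣ < ∣ e ∣ → ∃ λ v → v Sub.∈ e × v Sub.∉ S
    missing S e lt with FinP.any? (λ v → (v SubP.∈? e) ×-dec ¬? (v SubP.∈? S))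
    ... | yes p = p
    ... | no ¬p = contradiction (SubP.p⊆q⇒∣p∣≤∣q∣ e⊆S) (<⇒≱ lt)
      where
      e⊆S : e Sub.⊆ S
      e⊆S {x} x∈e with x SubP.∈? S
      ... | yes m = m
      ... | no m = contradiction (x , x∈e , m) ¬p

    _∈?_ : (v : Fin n) (l : List (Fin n)) → Dec (v ∈ l)
    v ∈? l = Any.any? (v FinP.≟_) l

    Unique? : (l : List (Fin n)) → Dec (Unique l)
    Unique? l = map′ (set-Unique l) ∣set∣ (∣ set l ∣ ≟ length l)

    length-allFin : length (allFin n) ≡ n
    length-allFin = ListP.length-tabulate {n = n} id

    count-∈ : (l : List (Fin n)) → count (allFin n) (λ v → v ∈? l) ≤ length l
    count-∈ l = ≤-trans (≤-reflexive (sym (count-filter (allFin n) (λ v → v ∈? l))))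
      (rel-length _≡_ (filter (λ v → v ∈? l) (allFin n)) l
        (UniP.filter⁺ (λ v → v ∈? l) (UniP.allFin⁺ n))
        (λ x m → x , proj₂ (MemP.∈-filter⁻ (λ v → v ∈? l) {xs = allFin n} m) , refl)
        (λ { refl refl → refl }))

    Unique⇒length≤ : {l : List (Fin n)} → Unique l → length l ≤ length (allFin n)
    Unique⇒length≤ {l} u = rel-length _≡_ l (allFin n) u (λ x _ → x , MemP.∈-allFin x , refl) (λ { refl refl → refl })

  Unique-++⁻ : {A : Set} (xs : List A) {ys : List A} → Unique (xs ++ ys) →
    Unique xs × Unique ys × (∀ {v} → v ∈ xs → v ∈ ys → ⊥)
  Unique-++⁻ [] u = [] , u , λ ()
  Unique-++⁻ (x ∷ xs) (x# ∷ u) with Unique-++⁻ xs u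
  ... | ux , uy , dis = AllP.++⁻ˡ xs x# ∷ ux , uy , λ
    { (here refl) m → All.lookup (AllP.++⁻ʳ xs x#) m refl ; (there m) m′ → dis m m′ }

  -- Helpers and the constants of the three constructions

  choose : {P A : Set} → Dec P → A → A → A
  choose (yes _) a b = a
  choose (no _) a b = b

  -- The demand of `clean`: `q ^ D` is the inverse density of the greedy choice, and the last factor
  -- counts events, `D + D * D` for single coordinates and for pairs of them, and at most `r` per
  -- position of the absorber without and with the absorbed vertex.
  absorbConst : ℕ → ℕ → ℕ
  absorbConst r q = let D = (r + r) + (r + r) in 2 * q ^ D * (D + D * D + (D * r + suc D * r))

  -- The walk has `r` separators and two tuples of `r` vertices; each of these variables gets
  -- `r + 1` copies, as many as there are blocks.
  connDim : ℕ → ℕ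
  connDim r = (r + (r + r)) * suc r

  -- One factor `q ^ r` for each of the choices of `b`, `a` and `z` in `hom-dense`, then blown up.
  connDensity : ℕ → ℕ → ℕ
  connDensity r q = blowConst (suc r) (r + (r + r)) (q ^ r * (q ^ r * q ^ r))

  connConst : ℕ → ℕ → ℕ
  connConst r q = let D = connDim r in
    2 * connDensity r q * (D + D * D + ((r + r) + ((r + r * suc r) + (r + r))) * r)

  -- A recursion in steps of two, unlike `h + h`, so that `alt` can be defined by matching on pairs
  -- of positions.
  double : ℕ → ℕ
  double zero = zero
  double (suc h) = suc (suc (double h))

  double≡ : ∀ h → double h ≡ h + h
  double≡ zero = refl
  double≡ (suc h) = cong suc (trans (cong suc (double≡ h)) (sym (+-suc h h)))

  -- The square of the factor `2 * q * h` in `G-big`: at least `N * N / tileKappa q h` pairs of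
  -- groups consist of two good ones.
  tileKappa : ℕ → ℕ → ℕ
  tileKappa q h = 2 * q * h * (2 * q * h)

  -- Inverse densities multiplied: `2 * e` for each vertex chosen among the uncovered ones,
  -- `2 * tileKappa q h` for the compatible pairs, and twice the number `(h + h) ^ h` of tuples in a
  -- group, over which `popular-pair` averages.
  tileBeta : ℕ → ℕ → ℕ → ℕ → ℕ
  tileBeta r q h e = (2 * e) ^ r * (2 * tileKappa q h) * ((h + h) ^ h * (h + h) ^ h)

  tileConst : ℕ → ℕ → ℕ → ℕ → ℕ
  tileConst r q h e = let M = double h; D = r * suc M in
    2 * blowConst (suc M) r (tileBeta r q h e) * (D + D * D + (r + M * suc r) * r)

  -- Here k = r + 1, γ ≥ 1 / q and c ≤ 1 / C, and the hypotheses are cleared of denominators.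
  module Hypergraph (n r q C : ℕ) (H : Subset n → Bool) (φ : Subset n → ℕ)
    (2≤r : 2 ≤ r) (2≤q : 2 ≤ q)
    (size-edge : ∀ e → H e ≡ true → ∣ e ∣ ≡ suc r)
    (deg-H : ∀ S → ∣ S ∣ ≡ r → (q + 2) * n ≤ 2 * q * deg H S)
    (deg-col : ∀ i S → ∣ S ∣ ≡ r → C * colDeg H φ i S ≤ n) where

    -- Good vertex sequences

    V : Set
    V = Fin n

    vs : List V
    vs = allFin n

    N : ℕ
    N = length vs

    k : ℕ
    k = suc r

    Edge : List V → Set
    Edge l = H (set l) ≡ true

    Edge? : ∀ l → Dec (Edge l)
    Edge? l = H (set l) Data.Bool.≟ true

    col : List V → ℕ
    col l = φ (set l)

    Edge-↭ : ∀ {l l′} → l ↭ l′ → Edge l → Edge l′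
    Edge-↭ p = subst (λ S → H S ≡ true) (set-↭ p)

    Edge-Unique : ∀ {l} → length l ≡ k → Edge l → Unique l
    Edge-Unique {l} len e = set-Unique l (trans (size-edge (set l) e) (sym len))

    -- An edge containing `w` has one vertex more than `w` and is determined by that vertex, so
    -- edges are mapped to vertices. For the upper bound in `col-list` vertices are mapped to edges
    -- instead.
    deg-list : ∀ {w} → Unique w → length w ≡ r → (q + 2) * N ≤ 2 * q * count vs (λ v → Edge? (v ∷ w))
    deg-list {w} u len = begin
      (q + 2) * N ≡⟨ cong ((q + 2) *_) length-allFin ⟩
      (q + 2) * n ≤⟨ deg-H (set w) ∣w∣ ⟩
      2 * q * deg H (set w) ≤⟨ *-monoʳ-≤ (2 * q) (rel-length (λ e v → e ≡ ⁅ v ⁆ ∪ set w) _ _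
          (UniP.filter⁺ _ (Unique-allSubsets n)) sub (λ { refl refl → refl })) ⟩
      2 * q * length (filter (λ v → Edge? (v ∷ w)) vs) ≡⟨ cong (2 * q *_) (count-filter vs _) ⟩
      2 * q * count vs (λ v → Edge? (v ∷ w)) ∎
      where
      open ≤-Reasoning
      ∣w∣ : ∣ set w ∣ ≡ r
      ∣w∣ = trans (∣set∣ u) len
      sub : ∀ e → e ∈ filter _ (allSubsets n) → ∃ λ v → v ∈ filter (λ v → Edge? (v ∷ w)) vs × e ≡ ⁅ v ⁆ ∪ set w
      sub e m with MemP.∈-filter⁻ _ {xs = allSubsets n} m
      ... | _ , He , w⊆e with missing (set w) e (≤-reflexive (trans (cong suc ∣w∣) (sym (size-edge e He))))
      ... | v , v∈e , v∉w = v , MemP.∈-filter⁺ (λ v → Edge? (v ∷ w)) (MemP.∈-allFin v) (trans (cong H (sym eq)) He) , eq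
        where
        eq : e ≡ ⁅ v ⁆ ∪ set w
        eq = sym (⊆-size-≡
          (λ x∈ → case SubP.x∈p∪q⁻ ⁅ v ⁆ (set w) x∈ of λ
            { (inj₁ m) → subst (Sub._∈ e) (sym (SubP.x∈⁅y⁆⇒x≡y v m)) v∈e ; (inj₂ m) → w⊆e m })
          (trans (∣⁅v⁆∪S∣ v (set w) v∉w) (trans (cong suc ∣w∣) (sym (size-edge e He)))))

    col-list : ∀ i {w} → Unique w → length w ≡ r →
      C * count vs (λ v → Edge? (v ∷ w) ×-dec (col (v ∷ w) ≟ i)) ≤ N
    col-list i {w} u len = begin
      C * count vs P? ≡⟨ cong (C *_) (sym (count-filter vs P?)) ⟩
      C * length (filter P? vs) ≤⟨ *-monoʳ-≤ C (rel-length (λ v e → (v Sub.∉ set w) × e ≡ ⁅ v ⁆ ∪ set w) (filter P? vs) _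
          (UniP.filter⁺ P? (UniP.allFin⁺ n)) sub inj) ⟩
      C * colDeg H φ i (set w) ≤⟨ deg-col i (set w) (trans (∣set∣ u) len) ⟩
      n ≡⟨ sym length-allFin ⟩
      N ∎
      where
      open ≤-Reasoning
      P? : ∀ v → Dec (Edge (v ∷ w) × col (v ∷ w) ≡ i)
      P? v = Edge? (v ∷ w) ×-dec (col (v ∷ w) ≟ i)
      sub : ∀ v → v ∈ filter P? vs → ∃ λ e → e ∈ filter _ (allSubsets n) × ((v Sub.∉ set w) × e ≡ ⁅ v ⁆ ∪ set w)
      sub v m with MemP.∈-filter⁻ P? {xs = vs} m
      ... | _ , Hv , cv = ⁅ v ⁆ ∪ set w
        , MemP.∈-filter⁺ _ (∈-allSubsets _) ((Hv , cv) , λ {x} → SubP.q⊆p∪q ⁅ v ⁆ (set w) {x})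
        , v∉ , refl
        where
        v∉ : v Sub.∉ set w
        v∉ m with Edge-Unique {v ∷ w} (cong suc len) Hv
        ... | v# ∷ _ = All.lookup v# (∈-set⁻ w m) refl
      inj : ∀ {v v′ e} → (v Sub.∉ set w) × e ≡ ⁅ v ⁆ ∪ set w → (v′ Sub.∉ set w) × e ≡ ⁅ v′ ⁆ ∪ set w → v ≡ v′
      inj {v} {v′} (v∉ , refl) (_ , eq) with SubP.x∈p∪q⁻ ⁅ v′ ⁆ (set w) (subst (v Sub.∈_) eq (SubP.x∈p∪q⁺ (inj₁ (SubP.x∈⁅x⁆ v))))
      ... | inj₁ m = SubP.x∈⁅y⁆⇒x≡y v′ m
      ... | inj₂ m = contradiction m v∉

    Many : {P : V → Set} → (∀ v → Dec (P v)) → Set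
    Many P? = (q + 2) * N ≤ 2 * q * count vs P?

    -- Inclusion and exclusion: two shares of `1/2 + 1/q` overlap in a share of at least `2/q`, of
    -- which the forbidden list `B` costs at most `1/q`.
    many-∩ : {P Q : V → Set} (P? : ∀ v → Dec (P v)) (Q? : ∀ v → Dec (Q v)) (B : List V) →
      Many P? → Many Q? → q * length B ≤ N →
      N ≤ q * count vs (λ v → P? v ×-dec (Q? v ×-dec ¬? (v ∈? B)))
    many-∩ P? Q? B mP mQ hB = *-cancelˡ-≤ 2 (+-cancelʳ-≤ (2 * q * N + 2 * N) _ _ (begin
      2 * N + (2 * q * N + 2 * N) ≡⟨ r₁ q N ⟩
      (q + 2) * N + (q + 2) * N ≤⟨ +-mono-≤ mP mQ ⟩
      2 * q * count vs P? + 2 * q * count vs Q? ≡⟨ sym (*-distribˡ-+ (2 * q) _ _) ⟩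
      2 * q * (count vs P? + count vs Q?) ≤⟨ *-monoʳ-≤ (2 * q) both ⟩
      2 * q * (c + (N + length B)) ≡⟨ r₂ q c N (length B) ⟩
      2 * (q * c) + (2 * q * N + 2 * (q * length B)) ≤⟨ +-monoʳ-≤ (2 * (q * c)) (+-monoʳ-≤ (2 * q * N) (*-monoʳ-≤ 2 hB)) ⟩
      2 * (q * c) + (2 * q * N + 2 * N) ∎))
      where
      open ≤-Reasoning
      c = count vs (λ v → P? v ×-dec (Q? v ×-dec ¬? (v ∈? B)))
      r₁ : ∀ q N → 2 * N + (2 * q * N + 2 * N) ≡ (q + 2) * N + (q + 2) * N
      r₁ = solve-∀
      r₂ : ∀ q c N b → 2 * q * (c + (N + b)) ≡ 2 * (q * c) + (2 * q * N + 2 * (q * b))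
      r₂ = solve-∀
      pt : ∀ {P Q R : Set} (p : Dec P) (q : Dec Q) (b : Dec R) →
        ind p + ind q ≤ ind (p ×-dec (q ×-dec ¬? b)) + (1 + ind b)
      pt (no _) q b = ≤-trans (ind≤1 q) (s≤s z≤n)
      pt (yes _) (no _) b = s≤s z≤n
      pt (yes _) (yes _) (yes _) = ≤-refl
      pt (yes _) (yes _) (no _) = ≤-refl
      both : count vs P? + count vs Q? ≤ c + (N + length B)
      both = begin
        count vs P? + count vs Q? ≡⟨ sym (sumL-+ vs _ _) ⟩
        sumL vs (λ v → ind (P? v) + ind (Q? v)) ≤⟨ sumL-mono vs (λ v → pt (P? v) (Q? v) (v ∈? B)) ⟩
        sumL vs (λ v → ind (P? v ×-dec (Q? v ×-dec ¬? (v ∈? B))) + (1 + ind (v ∈? B))) ≡⟨ sumL-+ vs _ _ ⟩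
        c + sumL vs (λ v → 1 + ind (v ∈? B)) ≡⟨ cong (c +_) (trans (sumL-+ vs _ _) (cong (_+ count vs (_∈? B)) (sym (length-as-sum vs)))) ⟩
        c + (N + count vs (_∈? B)) ≤⟨ +-monoʳ-≤ c (+-monoʳ-≤ N (count-∈ B)) ⟩
        c + (N + length B) ∎

    -- Vacuous below length `k`, so that greedy constructions can start from the empty sequence.
    HeadE : List V → Set
    HeadE l = k ≤ length l → Edge (take k l)

    HeadE? : ∀ l → Dec (HeadE l)
    HeadE? l = (k ≤? length l) →-dec Edge? (take k l)

    GE : List V → Set
    GE [] = ⊤
    GE (v ∷ l) = HeadE (v ∷ l) × GE l

    GE? : ∀ l → Dec (GE l)
    GE? [] = yes tt
    GE? (v ∷ l) = HeadE? (v ∷ l) ×-dec GE? l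

    -- The k-windows of l at positions 0 and suc j have different colors.
    NoConflict : List V → ℕ → Set
    NoConflict l j = k + suc j ≤ length l → col (take k l) ≢ col (take k (drop (suc j) l))

    NoConflict? : ∀ l j → Dec (NoConflict l j)
    NoConflict? l j = (k + suc j ≤? length l) →-dec ¬? (col (take k l) ≟ col (take k (drop (suc j) l)))

    -- The distances `1, …, r` are exactly those at which two windows of `r + 1` positions overlap.
    HeadC : List V → Set
    HeadC l = ∀ (i : Fin r) → NoConflict l (toℕ i)

    GC : List V → Set
    GC [] = ⊤
    GC (v ∷ l) = HeadC (v ∷ l) × GC l

    GC? : ∀ l → Dec (GC l)
    GC? [] = yes tt
    GC? (v ∷ l) = FinP.all? (λ i → NoConflict? (v ∷ l) (toℕ i)) ×-dec GC? l

    Good : List V → Set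
    Good l = GE l × GC l

    Good? : ∀ l → Dec (Good l)
    Good? l = GE? l ×-dec GC? l

    take-++-≤ : {A : Set} (m : ℕ) (l l′ : List A) → m ≤ length l → take m (l ++ l′) ≡ take m l
    take-++-≤ zero l l′ h = refl
    take-++-≤ (suc m) (x ∷ l) l′ (s≤s h) = cong (x ∷_) (take-++-≤ m l l′ h)

    drop-++-≤ : {A : Set} (m : ℕ) (l l′ : List A) → m ≤ length l → drop m (l ++ l′) ≡ drop m l ++ l′
    drop-++-≤ zero l l′ h = refl
    drop-++-≤ (suc m) (x ∷ l) l′ (s≤s h) = drop-++-≤ m l l′ h

    length-≤-++ : {A : Set} (l l′ : List A) → length l ≤ length (l ++ l′)
    length-≤-++ l l′ = ≤-trans (m≤m+n _ _) (≤-reflexive (sym (ListP.length-++ l)))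

    HeadE-ext : ∀ l l′ → k ≤ length l → HeadE l → HeadE (l ++ l′)
    HeadE-ext l l′ kl h _ = subst Edge (sym (take-++-≤ k l l′ kl)) (h kl)

    HeadE-pre : ∀ l l′ → HeadE (l ++ l′) → HeadE l
    HeadE-pre l l′ h kl = subst Edge (take-++-≤ k l l′ kl) (h (≤-trans kl (length-≤-++ l l′)))

    window-++ : ∀ (l l′ : List V) j → k + j ≤ length l → take k (drop j (l ++ l′)) ≡ take k (drop j l)
    window-++ l l′ j h = trans (cong (take k) (drop-++-≤ j l l′ (≤-trans (m≤n+m j k) h)))
      (take-++-≤ k (drop j l) l′ (≤-trans (≤-trans (≤-reflexive (sym (m+n∸n≡m k j))) (∸-monoˡ-≤ j h))
         (≤-reflexive (sym (ListP.length-drop j l)))))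

    NoConflict-ext : ∀ l l′ j → k + suc j ≤ length l → NoConflict l j → NoConflict (l ++ l′) j
    NoConflict-ext l l′ j kl h _ = subst₂ (λ a b → col a ≢ col b)
      (sym (take-++-≤ k l l′ (≤-trans (m≤m+n k (suc j)) kl))) (sym (window-++ l l′ (suc j) kl)) (h kl)

    NoConflict-pre : ∀ l l′ j → NoConflict (l ++ l′) j → NoConflict l j
    NoConflict-pre l l′ j h kl = subst₂ (λ a b → col a ≢ col b)
      (take-++-≤ k l l′ (≤-trans (m≤m+n k (suc j)) kl)) (window-++ l l′ (suc j) kl)
      (h (≤-trans kl (length-≤-++ l l′)))

    GE-suffix : ∀ l l′ → GE (l ++ l′) → GE l′
    GE-suffix [] l′ g = g
    GE-suffix (v ∷ l) l′ (_ , g) = GE-suffix l l′ g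

    GC-suffix : ∀ l l′ → GC (l ++ l′) → GC l′
    GC-suffix [] l′ g = g
    GC-suffix (v ∷ l) l′ (_ , g) = GC-suffix l l′ g

    GE-prefix : ∀ l l′ → GE (l ++ l′) → GE l
    GE-prefix [] l′ g = tt
    GE-prefix (v ∷ l) l′ (h , g) = HeadE-pre (v ∷ l) l′ h , GE-prefix l l′ g

    GC-prefix : ∀ l l′ → GC (l ++ l′) → GC l
    GC-prefix [] l′ g = tt
    GC-prefix (v ∷ l) l′ (h , g) = (λ i → NoConflict-pre (v ∷ l) l′ (toℕ i) (h i)) , GC-prefix l l′ g

    Good-suffix : ∀ l l′ → Good (l ++ l′) → Good l′
    Good-suffix l l′ (e , c) = GE-suffix l l′ e , GC-suffix l l′ c

    Good-prefix : ∀ l l′ → Good (l ++ l′) → Good l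
    Good-prefix l l′ (e , c) = GE-prefix l l′ e , GC-prefix l l′ c

    GE-glue : ∀ a p b → r ≤ length p → GE (a ++ p) → GE (p ++ b) → GE (a ++ p ++ b)
    GE-glue [] p b rp ga gb = gb
    GE-glue (v ∷ a) p b rp (h , ga) gb =
      subst HeadE (cong (v ∷_) (ListP.++-assoc a p b))
        (HeadE-ext (v ∷ a ++ p) b (s≤s (≤-trans rp (≤-trans (m≤n+m _ _) (≤-reflexive (sym (ListP.length-++ a)))))) h)
      , GE-glue a p b rp ga gb

    -- Two overlapping windows, the first of which starts at `v`, lie within `v` and the `2r`
    -- positions after it. Hence a conflict at a vertex of `a` never looks beyond `p`, and later
    -- conflicts belong to `p ++ b`.
    GC-glue : ∀ a p b → r + r ≤ length p → GC (a ++ p) → GC (p ++ b) → GC (a ++ p ++ b)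
    GC-glue [] p b rp ga gb = gb
    GC-glue (v ∷ a) p b rp (h , ga) gb =
      subst HeadC (cong (v ∷_) (ListP.++-assoc a p b))
        (λ i → NoConflict-ext (v ∷ a ++ p) b (toℕ i)
          (s≤s (≤-trans (≤-trans (+-monoʳ-≤ r (FinP.toℕ<n i)) rp) (≤-trans (m≤n+m _ _) (≤-reflexive (sym (ListP.length-++ a))))))
          (h i))
      , GC-glue a p b rp ga gb

    Good-glue : ∀ a p b → r + r ≤ length p → Good (a ++ p) → Good (p ++ b) → Good (a ++ p ++ b)
    Good-glue a p b rp (e₁ , c₁) (e₂ , c₂) =
      GE-glue a p b (≤-trans (m≤m+n r r) rp) e₁ e₂ , GC-glue a p b rp c₁ c₂

    lastR : List V → List V
    lastR l = drop (length l ∸ r) l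

    length-lastR : ∀ l → r ≤ length l → length (lastR l) ≡ r
    length-lastR l h = trans (ListP.length-drop (length l ∸ r) l) (m∸[m∸n]≡n h)

    lastR-cons : ∀ v l → r ≤ length l → lastR (v ∷ l) ≡ lastR l
    lastR-cons v l h rewrite +-∸-assoc 1 h = refl

    GE-snoc : ∀ l v → GE l → (r ≤ length l → Edge (v ∷ lastR l)) → GE (l ∷ʳ v)
    GE-snoc [] v g e = (λ kl → contradiction (≤-trans 2≤r (s≤s⁻¹ kl)) λ ()) , tt
    GE-snoc (u ∷ l) v (h , g) e = head , GE-snoc l v g (λ rl → subst (λ w → Edge (v ∷ w)) (lastR-cons u l rl) (e (m≤n⇒m≤1+n rl)))
      where
      head : HeadE (u ∷ l ∷ʳ v)
      -- If the old sequence was shorter than `k`, the head window is the whole new sequence; only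
      -- then does it contain `v`.
      head kl with k ≤? length (u ∷ l)
      ... | yes p = HeadE-ext (u ∷ l) [ v ] p h kl
      ... | no ¬p = subst Edge (sym (trans (cong (λ m → take m (u ∷ l ∷ʳ v)) keq) (ListP.take-all (suc (length (l ∷ʳ v))) (u ∷ l ∷ʳ v) ≤-refl)))
          (Edge-↭ (PermP.∷↭∷ʳ v (u ∷ l)) (subst (λ w → Edge (v ∷ w)) whole (e (≤-reflexive (sym leq)))))
        where
        len : length (u ∷ l ∷ʳ v) ≡ suc (length (u ∷ l))
        len = cong suc (trans (ListP.length-++ l) (+-comm (length l) 1))
        leq : length (u ∷ l) ≡ r
        leq = ≤-antisym (s≤s⁻¹ (≰⇒> ¬p)) (s≤s⁻¹ (subst (k ≤_) len kl))
        keq : k ≡ length (u ∷ l ∷ʳ v)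
        keq = sym (trans len (cong suc leq))
        whole : lastR (u ∷ l) ≡ u ∷ l
        whole rewrite leq | n∸n≡0 r = refl

    many-all : {P : V → Set} (P? : ∀ v → Dec (P v)) → (∀ v → P v) → Many P?
    many-all P? h = begin
      (q + 2) * N ≤⟨ *-monoˡ-≤ N (≤-trans (+-monoʳ-≤ q 2≤q) (≤-reflexive (cong (q +_) (sym (+-identityʳ q))))) ⟩
      2 * q * N ≡⟨ cong (2 * q *_) (length-as-sum vs) ⟩
      2 * q * sumL vs (λ _ → 1) ≤⟨ *-monoʳ-≤ (2 * q) (sumL-mono vs (λ v → ≤-reflexive (sym (ind-yes (P? v) (h v))))) ⟩
      2 * q * count vs P? ∎
      where open ≤-Reasoning

    many-mono : {P Q : V → Set} (P? : ∀ v → Dec (P v)) (Q? : ∀ v → Dec (Q v)) → (∀ v → P v → Q v) → Many P? → Many Q?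
    many-mono P? Q? h m = ≤-trans m (*-monoʳ-≤ (2 * q) (count-mono vs P? Q? h))

    many-head : ∀ l → Unique l → Many (λ u → HeadE? (u ∷ l))
    many-head l u with r ≤? length l
    ... | yes p = many-mono (λ v → Edge? (v ∷ take r l)) _ (λ v e _ → e)
          (deg-list (UniP.take⁺ r u) (trans (ListP.length-take r l) (m≤n⇒m⊓n≡m p)))
    ... | no ¬p = many-all _ (λ v kl → contradiction (s≤s⁻¹ kl) ¬p)

    many-last : ∀ l → Unique l → Many (λ u → (r ≤? length l) →-dec Edge? (u ∷ lastR l))
    many-last l u with r ≤? length l
    ... | yes p = many-mono (λ v → Edge? (v ∷ lastR l)) _ (λ v e _ → e)
          (deg-list (UniP.drop⁺ (length l ∸ r) u) (length-lastR l p))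
    ... | no ¬p = many-all (λ u → no ¬p →-dec Edge? (u ∷ lastR l)) (λ v rl → contradiction rl ¬p)

    -- Sequences with free vertices

    -- `inj₁` is a prescribed vertex and `inj₂` a free one; a list of terms is a shape, evaluated by
    -- each vector `τ`.
    Term : ℕ → Set
    Term D = V ⊎ Fin D

    ev : ∀ {D} → Vec V D → Term D → V
    ev τ (inj₁ a) = a
    ev τ (inj₂ p) = lookup τ p

    evs : ∀ {D} → Vec V D → List (Term D) → List V
    evs τ W = map (ev τ) W

    count-none : {A : Set} {P : A → Set} (xs : List A) (P? : ∀ x → Dec (P x)) → (∀ x → ¬ P x) → count xs P? ≡ 0
    count-none [] P? h = refl
    count-none (x ∷ xs) P? h with P? x
    ... | yes p = contradiction p (h x)
    ... | no _ = count-none xs P? h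

    module _ {D : ℕ} where

      _∈ₜ?_ : (t : Term D) (S : List (Term D)) → Dec (t ∈ S)
      t ∈ₜ? S = Any.any? (≡-dec t) S
        where
        import Data.Sum.Properties as SumP
        ≡-dec : (t t′ : Term D) → Dec (t ≡ t′)
        ≡-dec = SumP.≡-dec FinP._≟_ FinP._≟_

      evs-update : ∀ (τ : Vec V D) p v S → inj₂ p ∉ S → evs (τ [ p ]≔ v) S ≡ evs τ S
      evs-update τ p v [] p∉ = refl
      evs-update τ p v (inj₁ a ∷ S) p∉ = cong (a ∷_) (evs-update τ p v S (p∉ ∘ there))
      evs-update τ p v (inj₂ p′ ∷ S) p∉ =
        cong₂ _∷_ (VecP.lookup∘update′ (λ { refl → p∉ (here refl) }) τ v) (evs-update τ p v S (p∉ ∘ there))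

      GE-window : ∀ l j → GE l → k + j ≤ length l → Edge (take k (drop j l))
      GE-window (v ∷ l) zero (h , g) kl = h (subst (_≤ length (v ∷ l)) (+-identityʳ k) kl)
      GE-window (v ∷ l) (suc j) (h , g) kl = GE-window l j g (s≤s⁻¹ (subst (_≤ length (v ∷ l)) (+-suc k j) kl))
      GE-window [] j g ()

      -- A color conflict between the window of S at 0 and the one at suc j, blamed
      -- on a coordinate p that occurs in exactly one of the two windows: at the
      -- start of the first, or at the end of the second.
      HeadConflict : Fin D → List (Term D) → ℕ → Vec V D → Set
      HeadConflict p S j τ = (inj₂ p ∉ S × r ≤ length S) × Unique (take r (evs τ S)) ×
        Edge (lookup τ p ∷ take r (evs τ S)) ×
        col (lookup τ p ∷ take r (evs τ S)) ≡ col (take k (drop j (evs τ S)))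

      HeadConflict? : ∀ p S j τ → Dec (HeadConflict p S j τ)
      HeadConflict? p S j τ = (¬? (inj₂ p ∈ₜ? S) ×-dec (r ≤? length S)) ×-dec (Unique? _ ×-dec (Edge? (lookup τ p ∷ take r (evs τ S)) ×-dec (_ ≟ _)))

      LastConflict : Fin D → List (Term D) → ℕ → Vec V D → Set
      LastConflict p X j τ = (inj₂ p ∉ X × length X ≡ k + j) × Unique (drop (suc j) (evs τ X)) ×
        Edge (lookup τ p ∷ drop (suc j) (evs τ X)) ×
        col (lookup τ p ∷ drop (suc j) (evs τ X)) ≡ col (take k (evs τ X))

      LastConflict? : ∀ p S j τ → Dec (LastConflict p S j τ)
      LastConflict? p S j τ = (¬? (inj₂ p ∈ₜ? S) ×-dec (length S ≟ k + j)) ×-dec (Unique? _ ×-dec (Edge? (lookup τ p ∷ drop (suc j) (evs τ S)) ×-dec (_ ≟ _)))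

      -- Conflicts that no coordinate can be blamed for: both extreme vertices are constants.
      ConstOK : Vec V D → List (Term D) → Set
      ConstOK τ [] = ⊤
      ConstOK τ (inj₂ _ ∷ S) = ConstOK τ S
      ConstOK τ S@(inj₁ _ ∷ S′) =
        (∀ j → j < r → ∀ b R → drop (k + j) S ≡ inj₁ b ∷ R → NoConflict (evs τ S) j) × ConstOK τ S′

      ConstOK-vars : ∀ τ ps S → ConstOK τ S → ConstOK τ (map inj₂ ps ++ S)
      ConstOK-vars τ [] S ok = ok
      ConstOK-vars τ (p ∷ ps) S ok = ConstOK-vars τ ps S ok

    module Events (D θ : ℕ) (θ≤C : θ ≤ C) (B : List V) (θB : θ * suc (length B) ≤ N) where

      Ev : Set
      Ev = Event vs D θ

      headEvent : Fin D → List (Term D) → ℕ → Ev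
      headEvent p S j = mkEvent (HeadConflict? p S j) p bnd
        where
        bnd : ∀ τ → θ * count vs (λ v → HeadConflict? p S j (τ [ p ]≔ v)) ≤ N
        -- The side conditions do not depend on the value at `p`. If they fail, the event is empty;
        -- otherwise the color to be hit and the other `r` vertices of the window are fixed, and
        -- `col-list` bounds the number of values at `p`.
        bnd τ with (¬? (inj₂ p ∈ₜ? S) ×-dec (r ≤? length S)) ×-dec Unique? (take r (evs τ S))
        ... | no ¬h rewrite count-none vs (λ v → HeadConflict? p S j (τ [ p ]≔ v))
                (λ v → λ { ((p∉ , rl) , u , _) → ¬h ((p∉ , rl) , subst (Unique ∘ take r) (evs-update τ p v S p∉) u) })
              | *-zeroʳ θ = z≤n
        ... | yes ((p∉ , rl) , u) = ≤-trans (*-mono-≤ θ≤C (count-mono vs _ _ imp))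
                (col-list (col (take k (drop j (evs τ S)))) u
                  (trans (ListP.length-take r (evs τ S)) (m≤n⇒m⊓n≡m (≤-trans rl (≤-reflexive (sym (ListP.length-map (ev τ) S)))))))
          where
          imp : ∀ v → HeadConflict p S j (τ [ p ]≔ v) →
            Edge (v ∷ take r (evs τ S)) × col (v ∷ take r (evs τ S)) ≡ col (take k (drop j (evs τ S)))
          imp v (_ , _ , e , c) rewrite evs-update τ p v S p∉ | VecP.lookup∘update p τ v = e , c

      lastEvent : Fin D → List (Term D) → ℕ → Ev
      lastEvent p S j = mkEvent (LastConflict? p S j) p bnd
        where
        bnd : ∀ τ → θ * count vs (λ v → LastConflict? p S j (τ [ p ]≔ v)) ≤ N
        bnd τ with (¬? (inj₂ p ∈ₜ? S) ×-dec (length S ≟ k + j)) ×-dec Unique? (drop (suc j) (evs τ S))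
        ... | no ¬h rewrite count-none vs (λ v → LastConflict? p S j (τ [ p ]≔ v))
                (λ v → λ { ((p∉ , rl) , u , _) → ¬h ((p∉ , rl) , subst (Unique ∘ drop (suc j)) (evs-update τ p v S p∉) u) })
              | *-zeroʳ θ = z≤n
        ... | yes ((p∉ , len) , u) = ≤-trans (*-mono-≤ θ≤C (count-mono vs _ _ imp))
                (col-list (col (take k (evs τ S))) u
                  (trans (ListP.length-drop (suc j) (evs τ S)) (trans (cong (_∸ suc j) (trans (ListP.length-map (ev τ) S) len))
                    (m+n∸n≡m r j))))
          where
          imp : ∀ v → LastConflict p S j (τ [ p ]≔ v) →
            Edge (v ∷ drop (suc j) (evs τ S)) × col (v ∷ drop (suc j) (evs τ S)) ≡ col (take k (evs τ S))
          imp v (_ , _ , e , c) rewrite evs-update τ p v S p∉ | VecP.lookup∘update p τ v = e , c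

      avoidEvent : Fin D → Ev
      avoidEvent p = mkEvent (λ τ → lookup τ p ∈? B) p
        (λ τ → ≤-trans (*-monoʳ-≤ θ (≤-trans (count-mono vs _ (_∈? B) (λ v → subst (_∈ B) (VecP.lookup∘update p τ v))) (count-∈ B)))
          (≤-trans (*-monoʳ-≤ θ (n≤1+n (length B))) θB))

      clashEvent : Fin D → Fin D → Ev
      clashEvent p p′ = mkEvent (λ τ → ¬? (p FinP.≟ p′) ×-dec (lookup τ p FinP.≟ lookup τ p′)) p
        (λ τ → ≤-trans (*-monoʳ-≤ θ (≤-trans (count-mono vs _ (_∈? [ lookup τ p′ ])
            (λ v → λ { (p≢ , eq) → here (trans (sym (VecP.lookup∘update p τ v)) (trans eq (VecP.lookup∘update′ (p≢ ∘ sym) τ v))) }))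
            (count-∈ [ lookup τ p′ ])))
          (≤-trans (*-monoʳ-≤ θ (s≤s z≤n)) θB))

      coordEvents : List Ev
      coordEvents = map avoidEvent (allFin D) ++ concatMap (λ p → map (clashEvent p) (allFin D)) (allFin D)

      lastEvents : List (Term D) → ℕ → List (Term D) → List Ev
      lastEvents S j (inj₂ p ∷ _) = [ lastEvent p (take (k + j) S) j ]
      lastEvents S j _ = []

      -- The first vertex of the earlier window takes the blame if it is free, otherwise the last
      -- vertex of the later window; with constants in both places the list is empty and `ConstOK`
      -- has to step in. So a position and a distance cost at most one event.
      eventsAt : List (Term D) → ℕ → List Ev
      eventsAt [] j = []
      eventsAt (inj₂ p ∷ S) j = [ headEvent p S j ]
      eventsAt S@(inj₁ _ ∷ _) j = lastEvents S j (drop (k + j) S)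

      colEvents : List (Term D) → List Ev
      colEvents [] = []
      colEvents (t ∷ S) = concatMap (eventsAt (t ∷ S)) (upTo r) ++ colEvents S

      length-concatMap-≤ : {A B : Set} (f : A → List B) (c : ℕ) (xs : List A) → (∀ x → length (f x) ≤ c) →
        length (concatMap f xs) ≤ length xs * c
      length-concatMap-≤ f c [] h = z≤n
      length-concatMap-≤ f c (x ∷ xs) h = ≤-trans (≤-reflexive (ListP.length-++ (f x)))
        (+-mono-≤ (h x) (length-concatMap-≤ f c xs h))

      length-coordEvents : length coordEvents ≤ D + D * D
      length-coordEvents = ≤-trans (≤-reflexive (ListP.length-++ (map avoidEvent (allFin D))))
        (+-mono-≤ (≤-reflexive (trans (ListP.length-map avoidEvent (allFin D)) (length-allFin {D})))
          (≤-trans (length-concatMap-≤ _ D (allFin D) (λ p → ≤-reflexive (trans (ListP.length-map (clashEvent p) (allFin D)) (length-allFin {D}))))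
            (≤-reflexive (cong (_* D) (length-allFin {D})))))

      length-eventsAt : ∀ S j → length (eventsAt S j) ≤ 1
      length-eventsAt [] j = z≤n
      length-eventsAt (inj₂ p ∷ S) j = ≤-refl
      length-eventsAt S@(inj₁ _ ∷ _) j = go (drop (k + j) S)
        where
        go : ∀ R → length (lastEvents S j R) ≤ 1
        go [] = z≤n
        go (inj₁ _ ∷ _) = z≤n
        go (inj₂ _ ∷ _) = ≤-refl

      length-colEvents : ∀ W → length (colEvents W) ≤ length W * r
      length-colEvents [] = z≤n
      length-colEvents (t ∷ S) = ≤-trans (≤-reflexive (ListP.length-++ (concatMap (eventsAt (t ∷ S)) (upTo r))))
        (+-mono-≤ (≤-trans (length-concatMap-≤ _ 1 (upTo r) (length-eventsAt (t ∷ S)))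
            (≤-reflexive (trans (*-identityʳ _) (ListP.length-upTo r))))
          (length-colEvents S))

      Avoids : Vec V D → Set
      Avoids τ = (∀ p → lookup τ p ∉ B) × (∀ p p′ → lookup τ p ≡ lookup τ p′ → p ≡ p′)

      none-Avoids : ∀ τ → All (λ e → ¬ Event.E e τ) coordEvents → Avoids τ
      none-Avoids τ none = av , inj
        where
        av : ∀ p → lookup τ p ∉ B
        av p m = All.lookup (AllP.map⁻ (AllP.++⁻ˡ (map avoidEvent (allFin D)) none)) (MemP.∈-allFin p) (true-does (lookup τ p ∈? B) m)
        inj : ∀ p p′ → lookup τ p ≡ lookup τ p′ → p ≡ p′
        inj p p′ eq with p FinP.≟ p′
        ... | yes e = e
        ... | no ne = contradiction (true-does (¬? (p FinP.≟ p′) ×-dec (lookup τ p FinP.≟ lookup τ p′)) (ne , eq))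
            (All.lookup (AllP.map⁻ (All.lookup (AllP.map⁻ (AllP.concat⁻ (AllP.++⁻ʳ (map avoidEvent (allFin D)) none))) (MemP.∈-allFin p))) (MemP.∈-allFin p′))

      Avoids-ev : ∀ {τ} → Avoids τ → ∀ t t′ → (∀ a → t ≡ inj₁ a → a ∈ B) → (∀ a → t′ ≡ inj₁ a → a ∈ B) →
        ev τ t ≡ ev τ t′ → t ≡ t′
      Avoids-ev av (inj₁ a) (inj₁ b) ta tb eq = cong inj₁ eq
      Avoids-ev av (inj₁ a) (inj₂ p) ta tb eq = contradiction (subst (_∈ B) eq (ta a refl)) (proj₁ av p)
      Avoids-ev av (inj₂ p) (inj₁ a) ta tb eq = contradiction (subst (_∈ B) (sym eq) (tb a refl)) (proj₁ av p)
      Avoids-ev av (inj₂ p) (inj₂ p′) ta tb eq = cong inj₂ (proj₂ av p p′ eq)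

      evs-Unique : ∀ {τ} W → Avoids τ → Unique W → (∀ a → inj₁ a ∈ W → a ∈ B) → Unique (evs τ W)
      evs-Unique [] av u h = []
      evs-Unique {τ} (t ∷ S) av (t# ∷ u) h =
        AllP.map⁺ (All.tabulate (λ {t′} m eq → All.lookup t# m (Avoids-ev av t t′ (λ a e → h a (here (sym e)))
          (λ a e → h a (there (subst (_∈ S) e m))) eq)))
        ∷ evs-Unique S av u (λ a m → h a (there m))

      -- Uniqueness supplies the side conditions of the events, namely that the blamed coordinate
      -- does not occur again in the stretch concerned. A conflict that escapes the events has
      -- constants at both extremes, where `ConstOK` excludes it.
      none-GC : ∀ τ W → All (λ e → ¬ Event.E e τ) (colEvents W) → Unique (evs τ W) → GE (evs τ W) → ConstOK τ W → GC (evs τ W)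
      none-GC τ [] none u ge ok = tt
      none-GC τ (inj₂ p ∷ S) none (p# ∷ u) (he , ge) ok = (λ i → hc (toℕ i) (FinP.toℕ<n i)) , none-GC τ S (AllP.++⁻ʳ (concatMap (eventsAt (inj₂ p ∷ S)) (upTo r)) none) u ge ok
        where
        len : length (evs τ S) ≡ length S
        len = ListP.length-map (ev τ) S
        hc : ∀ j → j < r → NoConflict (evs τ (inj₂ p ∷ S)) j
        hc j j<r kl eq = All.lookup (All.lookup (AllP.map⁻ (AllP.concat⁻ (AllP.++⁻ˡ (concatMap (eventsAt (inj₂ p ∷ S)) (upTo r)) none))) (MemP.∈-upTo⁺ j<r)) (here refl)
          (true-does (HeadConflict? p S j τ) (((λ m → All.lookup p# (MemP.∈-map⁺ (ev τ) m) refl)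
            , ≤-trans (m≤m+n r (suc j)) (≤-trans (s≤s⁻¹ kl) (≤-reflexive len)))
            , UniP.take⁺ r u , he (≤-trans (m≤m+n k (suc j)) kl) , eq))
      none-GC τ (inj₁ a ∷ S) none uu@(_ ∷ u) gee@(he , ge) (okh , ok) = (λ i → hc (toℕ i) (FinP.toℕ<n i)) , none-GC τ S (AllP.++⁻ʳ (concatMap (eventsAt W) (upTo r)) none) u ge ok
        where
        W = inj₁ a ∷ S
        len : length (evs τ W) ≡ length W
        len = ListP.length-map (ev τ) W
        hc : ∀ j → j < r → NoConflict (evs τ W) j
        hc j j<r kl = go (drop (k + j) W) refl
          where
          none′ : All (λ e → ¬ Event.E e τ) (lastEvents W j (drop (k + j) W))
          none′ = All.lookup (AllP.map⁻ (AllP.concat⁻ (AllP.++⁻ˡ (concatMap (eventsAt W) (upTo r)) none))) (MemP.∈-upTo⁺ j<r)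
          kl′ : suc (k + j) ≤ length W
          kl′ = ≤-trans (≤-reflexive (sym (+-suc k j))) (≤-trans kl (≤-reflexive len))
          -- Position `k + j` holds the last vertex of the window that starts at `suc j`; what
          -- stands there decides who is blamed.
          go : ∀ R → drop (k + j) W ≡ R → col (take k (evs τ W)) ≢ col (take k (drop (suc j) (evs τ W)))
          go [] eq = contradiction (trans (sym (ListP.length-drop (k + j) W)) (cong length eq)) (m>n⇒m∸n≢0 kl′)
          go (inj₁ b ∷ R) eq = okh j j<r b R eq kl
          go (inj₂ p ∷ R) eq colEq = All.lookup (subst (λ R → All (λ e → ¬ Event.E e τ) (lastEvents W j R)) eq none′) (here refl)
            (true-does (LastConflict? p X j τ) ((p∉X , lenX) , uX , Edge-↭ perm eW , trans (cong φ (set-↭ (↭-sym perm))) (trans (sym colEq′) (cong col e₁))))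
            where
            X = take (k + j) W
            X̂ = evs τ X
            v = lookup τ p
            W≡ : W ≡ X ++ inj₂ p ∷ R
            W≡ = trans (sym (ListP.take++drop≡id (k + j) W)) (cong (X ++_) eq)
            lenX : length X ≡ k + j
            lenX = trans (ListP.length-take (k + j) W) (m≤n⇒m⊓n≡m (<⇒≤ kl′))
            lenX̂ : length X̂ ≡ k + j
            lenX̂ = trans (ListP.length-map (ev τ) X) lenX
            Ŵ≡ : evs τ W ≡ X̂ ++ v ∷ evs τ R
            Ŵ≡ = trans (cong (evs τ) W≡) (ListP.map-++ (ev τ) X (inj₂ p ∷ R))
            uŴ : Unique (X̂ ++ v ∷ evs τ R)
            uŴ = subst Unique Ŵ≡ uu
            p∉X : inj₂ p ∉ X
            p∉X m with Unique-++⁻ X̂ uŴ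
            ... | _ , _ , dis = dis (MemP.∈-map⁺ (ev τ) m) (here refl)
            uX : Unique (drop (suc j) X̂)
            uX = UniP.drop⁺ (suc j) (proj₁ (Unique-++⁻ X̂ uŴ))
            e₁ : take k (evs τ W) ≡ take k X̂
            e₁ = trans (cong (take k) Ŵ≡) (take-++-≤ k X̂ _ (≤-trans (m≤m+n k j) (≤-reflexive (sym lenX̂))))
            lenY : length (drop (suc j) X̂) ≡ r
            lenY = trans (ListP.length-drop (suc j) X̂) (trans (cong (_∸ suc j) lenX̂) (m+n∸n≡m r j))
            e₂ : take k (drop (suc j) (evs τ W)) ≡ drop (suc j) X̂ ∷ʳ v
            e₂ = trans (cong (take k ∘ drop (suc j)) Ŵ≡)
              (trans (cong (take k) (drop-++-≤ (suc j) X̂ _ (≤-trans (s≤s (m≤n+m j r)) (≤-reflexive (sym lenX̂)))))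
              (trans (cong (take k) (sym (ListP.++-assoc (drop (suc j) X̂) [ v ] (evs τ R))))
              (trans (cong (λ m → take m ((drop (suc j) X̂ ∷ʳ v) ++ evs τ R)) kY)
              (trans (take-++-≤ (length (drop (suc j) X̂ ∷ʳ v)) (drop (suc j) X̂ ∷ʳ v) (evs τ R) ≤-refl)
                 (ListP.take-all _ (drop (suc j) X̂ ∷ʳ v) ≤-refl)))))
              where
              kY : k ≡ length (drop (suc j) X̂ ∷ʳ v)
              kY = sym (trans (ListP.length-++ (drop (suc j) X̂)) (trans (+-comm _ 1) (cong suc lenY)))
            perm : drop (suc j) X̂ ∷ʳ v ↭ v ∷ drop (suc j) X̂
            perm = ↭-sym (PermP.∷↭∷ʳ v (drop (suc j) X̂))
            eW : Edge (drop (suc j) X̂ ∷ʳ v)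
            eW = subst Edge e₂ (GE-window {D} (evs τ W) (suc j) gee kl)
            colEq′ : col (take k (evs τ W)) ≡ col (drop (suc j) X̂ ∷ʳ v)
            colEq′ = trans colEq (cong col e₂)

    -- Absorbers

    K : ℕ
    K = r + r

    Unique-↭ : {A : Set} {xs ys : List A} → xs ↭ ys → Unique xs → Unique ys
    Unique-↭ {A} p = PermSP.Unique-resp-↭ (Perm.↭⇒↭ₛ p)
      where
      open import Relation.Binary.PropositionalEquality using (setoid)
      import Data.List.Relation.Binary.Permutation.Setoid.Properties (setoid A) as PermSP

    tabulate-lookup-toList : {A : Set} {m : ℕ} (τ : Vec A m) → List.tabulate (lookup τ) ≡ toList τ
    tabulate-lookup-toList [] = refl
    tabulate-lookup-toList (x ∷ τ) = cong (x ∷_) (tabulate-lookup-toList τ)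

    map-lookup-allFin : {A : Set} {m : ℕ} (τ : Vec A m) → map (lookup τ) (allFin m) ≡ toList τ
    map-lookup-allFin τ = trans (ListP.map-tabulate id (lookup τ)) (tabulate-lookup-toList τ)

    lookup-toList : ∀ {m} (u : Vec V m) p → lookup u p ∈ toList u
    lookup-toList (x ∷ u) zero = here refl
    lookup-toList (x ∷ u) (suc p) = there (lookup-toList u p)

    lookup-injective : ∀ {m} (u : Vec V m) → Unique (toList u) → ∀ p p′ → lookup u p ≡ lookup u p′ → p ≡ p′
    lookup-injective (v ∷ u) (v# ∷ uu) zero zero eq = refl
    lookup-injective (v ∷ u) (v# ∷ uu) zero (suc p′) eq = contradiction eq (All.lookup v# (lookup-toList u p′))
    lookup-injective (v ∷ u) (v# ∷ uu) (suc p) zero eq = contradiction (sym eq) (All.lookup v# (lookup-toList u p))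
    lookup-injective (v ∷ u) (v# ∷ uu) (suc p) (suc p′) eq = cong suc (lookup-injective u uu p p′ eq)

    evs-vars : ∀ {D} (τ : Vec V D) ps → evs τ (map inj₂ ps) ≡ map (lookup τ) ps
    evs-vars τ ps = sym (ListP.map-∘ ps)

    evs-consts : ∀ {D} (τ : Vec V D) l → evs τ (map inj₁ l) ≡ l
    evs-consts τ l = trans (sym (ListP.map-∘ l)) (ListP.map-id l)

    no-const : {A B : Set} (m : ℕ) (ps : List B) {b : A} {R : List (A ⊎ B)} → drop m (map inj₂ ps) ≢ inj₁ b ∷ R
    no-const zero [] ()
    no-const zero (p ∷ ps) ()
    no-const (suc m) [] ()
    no-const (suc m) (p ∷ ps) eq = no-const m ps eq

    GE-short : ∀ l → length l ≤ r → GE l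
    GE-short [] h = tt
    GE-short (v ∷ l) h = (λ kl → contradiction (≤-trans kl h) (<⇒≱ ≤-refl)) , GE-short l (≤-trans (n≤1+n _) h)

    insertAbs : V → List V → List V
    insertAbs v l = take K l ++ v ∷ drop K l

    -- Each half has `K = 2r` vertices, enough for `Good-glue`: inside any good sequence the
    -- absorber can be exchanged for its extension without a look at the surroundings.
    Absorbs : V → List V → Set
    Absorbs v l = length l ≡ K + K × Good l × Good (insertAbs v l)

    Absorbs? : ∀ v l → Dec (Absorbs v l)
    Absorbs? v l = (length l ≟ K + K) ×-dec (Good? l ×-dec Good? (insertAbs v l))

    Fresh : List V → List V → Set
    Fresh B l = Unique l × All (_∉ B) l

    Fresh? : ∀ B l → Dec (Fresh B l)
    Fresh? B l = Unique? l ×-dec All.all? (λ v → ¬? (v ∈? B)) l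

    Avoids⇒Fresh : ∀ {D} (τ : Vec V D) B → (∀ p → lookup τ p ∉ B) → (∀ p p′ → lookup τ p ≡ lookup τ p′ → p ≡ p′) → Fresh B (toList τ)
    Avoids⇒Fresh τ B av inj = subst (Fresh B) (tabulate-lookup-toList τ)
      (UniP.tabulate⁺ (λ {i} {j} → inj i j) , AllP.tabulate⁺ av)

    module _ (v : V) where
      private
        D : ℕ
        D = K + K

      -- v is inserted in front of the last K vertices, once there are that many.
      insFrom : List V → List V
      insFrom w = choose (K ≤? length w) (take (length w ∸ K) w ++ v ∷ drop (length w ∸ K) w) w

      insFrom-short : ∀ w → length w < K → insFrom w ≡ w
      insFrom-short w lt with K ≤? length w
      ... | yes p = contradiction p (<⇒≱ lt)
      ... | no _ = refl

      insFrom-K : ∀ w → length w ≡ K → insFrom w ≡ v ∷ w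
      insFrom-K w eq with K ≤? length w
      ... | yes p rewrite eq | n∸n≡0 K = refl
      ... | no ¬p = contradiction (≤-reflexive (sym eq)) ¬p

      insFrom-∷ : ∀ u w → K ≤ length w → insFrom (u ∷ w) ≡ u ∷ insFrom w
      insFrom-∷ u w h with K ≤? length w | K ≤? length (u ∷ w)
      ... | yes p | yes _ rewrite +-∸-assoc 1 p = refl
      ... | yes p | no ¬p = contradiction (m≤n⇒m≤1+n p) ¬p
      ... | no ¬p | _ = contradiction h ¬p

      insFrom-full : ∀ w → length w ≡ D → insFrom w ≡ insertAbs v w
      insFrom-full w eq with K ≤? length w
      ... | yes p rewrite eq | m+n∸n≡m K K = refl
      ... | no ¬p = contradiction (≤-trans (m≤m+n K K) (≤-reflexive (sym eq))) ¬p

      insFrom-Unique : ∀ w → Unique (v ∷ w) → Unique (insFrom w)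
      insFrom-Unique w u with K ≤? length w
      ... | no _ = case u of λ { (_ ∷ u′) → u′ }
      ... | yes _ = Unique-↭ (↭-sym (↭-trans (PermP.shift v (take m w) (drop m w))
          (Perm.↭-reflexive (cong (v ∷_) (ListP.take++drop≡id m w))))) u
        where m = length w ∸ K

      Ω : List V → Set
      Ω w = Unique (v ∷ w) × GE w × GE (insFrom w)

      Ω? : ∀ w → Dec (Ω w)
      Ω? w = Unique? (v ∷ w) ×-dec (GE? w ×-dec GE? (insFrom w))

      private
        fresh-cons : ∀ {u w} → u ∉ v ∷ w → Unique (v ∷ w) → Unique (v ∷ u ∷ w)
        fresh-cons u∉ (v# ∷ uw) = ((λ { refl → u∉ (here refl) }) ∷ v#) ∷ (∉⇒All≢ (u∉ ∘ there) ∷ uw)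

        swap-head : ∀ u w → HeadE (u ∷ v ∷ w) → HeadE (v ∷ u ∷ w)
        swap-head u w h kl = swap-take 2≤r (h kl)
          where
          swap-take : ∀ {r} → 2 ≤ r → Edge (take (suc r) (u ∷ v ∷ w)) → Edge (take (suc r) (v ∷ u ∷ w))
          swap-take {suc r} _ = Edge-↭ {u ∷ v ∷ take r w} {v ∷ u ∷ take r w} (Perm.swap u v Perm.↭-refl)

      -- Vertices are chosen from right to left. A new `u` has to form an edge with what follows it
      -- in `w` and with what follows it in the version containing `v`: at most two degree
      -- conditions, so `many-∩` applies.
      Ω-step : q * suc D ≤ N → ∀ w → length w < D → Ω w → N ≤ q * count vs (λ u → Ω? (u ∷ w))
      Ω-step qN w lt (uw@(_ ∷ uw′) , ge , gi) with <-cmp (suc (length w)) K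
      ... | tri< a _ _ = ≤-trans (many-∩ (λ u → HeadE? (u ∷ w)) (λ u → HeadE? (u ∷ w)) (v ∷ w) (many-head w uw′) (many-head w uw′) hB)
            (*-monoʳ-≤ q (count-mono vs _ _ imp))
        where
        hB : q * length (v ∷ w) ≤ N
        hB = ≤-trans (*-monoʳ-≤ q (m≤n⇒m≤1+n lt)) qN
        imp : ∀ u → HeadE (u ∷ w) × HeadE (u ∷ w) × u ∉ v ∷ w → Ω (u ∷ w)
        imp u (h , _ , u∉) = fresh-cons u∉ uw , (h , ge) , subst GE (sym (insFrom-short (u ∷ w) a)) (h , ge)
      -- Here `v` lands in front of the new `u`. Its window is, as a set, `u`, `v` and the next
      -- vertices of `w`, so the condition can be imposed on `u` through `u ∷ v ∷ w`.
      ... | tri≈ _ b _ = ≤-trans (many-∩ (λ u → HeadE? (u ∷ w)) (λ u → HeadE? (u ∷ v ∷ w)) (v ∷ w) (many-head w uw′) (many-head (v ∷ w) uw) hB)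
            (*-monoʳ-≤ q (count-mono vs _ _ imp))
        where
        hB : q * length (v ∷ w) ≤ N
        hB = ≤-trans (*-monoʳ-≤ q (m≤n⇒m≤1+n lt)) qN
        imp : ∀ u → HeadE (u ∷ w) × HeadE (u ∷ v ∷ w) × u ∉ v ∷ w → Ω (u ∷ w)
        imp u (h , h′ , u∉) = fresh-cons u∉ uw , (h , ge) , subst GE (sym (insFrom-K (u ∷ w) b)) (swap-head u w h′ , h , ge)
      ... | tri> _ _ c = ≤-trans (many-∩ (λ u → HeadE? (u ∷ w)) (λ u → HeadE? (u ∷ insFrom w)) (v ∷ w) (many-head w uw′) (many-head (insFrom w) (insFrom-Unique w uw)) hB)
            (*-monoʳ-≤ q (count-mono vs _ _ imp))
        where
        hB : q * length (v ∷ w) ≤ N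
        hB = ≤-trans (*-monoʳ-≤ q (m≤n⇒m≤1+n lt)) qN
        imp : ∀ u → HeadE (u ∷ w) × HeadE (u ∷ insFrom w) × u ∉ v ∷ w → Ω (u ∷ w)
        imp u (h , h′ , u∉) = fresh-cons u∉ uw , (h , ge) , subst GE (sym (insFrom-∷ u w (s≤s⁻¹ c))) (h′ , gi)

      module _ (B : List V) (θ≤C : absorbConst r q ≤ C) (θB : absorbConst r q * suc (suc (length B)) ≤ N) (0<N : 0 < N) where
        private
          θ = absorbConst r q
          open Events D θ θ≤C (v ∷ B) θB
          W₁ W₂ : List (Term D)
          W₁ = map inj₂ (allFin D)
          W₂ = map inj₂ (take K (allFin D)) ++ inj₁ v ∷ map inj₂ (drop K (allFin D))
          es : List Ev
          es = coordEvents ++ (colEvents W₁ ++ colEvents W₂)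

          |W₁| : length W₁ ≡ D
          |W₁| = trans (ListP.length-map inj₂ (allFin D)) (length-allFin {D})
          |W₂| : length W₂ ≡ suc D
          |W₂| = begin
            length W₂ ≡⟨ ListP.length-++ (map inj₂ (take K (allFin D))) ⟩
            length (map inj₂ (take K (allFin D))) + suc (length (map inj₂ (drop K (allFin D)))) ≡⟨ +-suc _ _ ⟩
            suc (length (map inj₂ (take K (allFin D))) + length (map inj₂ (drop K (allFin D))))
              ≡⟨ cong suc (sym (ListP.length-++ (map inj₂ (take K (allFin D))))) ⟩
            suc (length (map inj₂ (take K (allFin D)) ++ map inj₂ (drop K (allFin D))))
              ≡⟨ cong (suc ∘ length) (sym (ListP.map-++ inj₂ (take K (allFin D)) (drop K (allFin D)))) ⟩
            suc (length (map inj₂ (take K (allFin D) ++ drop K (allFin D))))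
              ≡⟨ cong (λ l → suc (length (map inj₂ l))) (ListP.take++drop≡id K (allFin D)) ⟩
            suc (length W₁) ≡⟨ cong suc |W₁| ⟩
            suc D ∎
            where open ≡-Reasoning

          few : 2 * q ^ D * length es ≤ θ
          few = *-monoʳ-≤ (2 * q ^ D) (≤-trans (≤-reflexive (ListP.length-++ coordEvents))
            (+-mono-≤ length-coordEvents (≤-trans (≤-reflexive (ListP.length-++ (colEvents W₁)))
              (+-mono-≤ (≤-trans (length-colEvents W₁) (≤-reflexive (cong (_* r) |W₁|)))
                        (≤-trans (length-colEvents W₂) (≤-reflexive (cong (_* r) |W₂|)))))))

          qpos : 0 < q
          qpos = ≤-trans (s≤s z≤n) 2≤q
          1≤D : 1 ≤ D
          1≤D = ≤-trans (≤-trans (s≤s z≤n) 2≤r) (≤-trans (m≤m+n r r) (m≤m+n K K))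
          θ-big : q * suc D ≤ θ
          θ-big = *-mono-≤ {q} {2 * q ^ D} {suc D} {D + D * D + (D * r + suc D * r)}
            (≤-trans (≤-trans (≤-reflexive (sym (*-identityʳ q))) (^-monoʳ-≤ q ⦃ >-nonZero qpos ⦄ 1≤D)) (m≤m+n (q ^ D) (q ^ D + 0)))
            (≤-trans (≤-reflexive (sym (+-comm D 1))) (+-mono-≤ (m≤m+n D (D * D)) (≤-trans (≤-trans (≤-trans (s≤s z≤n) 2≤r) (m≤m+n r (D * r))) (m≤n+m (suc D * r) (D * r)))))
          0<θ : 0 < θ
          0<θ = ≤-trans (≤-trans qpos (≤-trans (≤-reflexive (sym (*-identityʳ q))) (*-monoʳ-≤ q (s≤s z≤n)))) θ-big

        absorbers-dense : N ^ D ≤ 2 * q ^ D * count (vecs vs D) (λ τ → Absorbs? v (toList τ) ×-dec Fresh? B (toList τ))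
        absorbers-dense = ≤-trans
          (clean vs 0<N (λ τ → Ω? (toList τ)) es (q ^ D) 0<θ few
            (greedy-cons vs Ω? q D (Ω-step (≤-trans θ-big (≤-trans (≤-trans (≤-reflexive (sym (*-identityʳ θ))) (*-monoʳ-≤ θ (s≤s z≤n))) θB)))
              ([] ∷ [] , tt , subst GE (sym (insFrom-short [] (≤-trans (≤-trans (s≤s z≤n) 2≤r) (m≤m+n r r)))) tt)))
          (*-monoʳ-≤ (2 * q ^ D) (count-mono (vecs vs D) _ _ final))
          where
          final : ∀ τ → Ω (toList τ) × None vs 0<N es τ → Absorbs v (toList τ) × Fresh B (toList τ)
          final τ ((uv@(_ ∷ u) , ge , gi) , none) = (len , (ge , gc₁) , subst Good e₂ (ge₂ , gc₂)) , Avoids⇒Fresh τ B (λ p m → proj₁ av p (there m)) (proj₂ av)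
            where
            l = toList τ
            len : length l ≡ D
            len = VecP.length-toList τ
            av : Avoids τ
            av = none-Avoids τ (AllP.++⁻ˡ coordEvents none)
            e₁ : l ≡ evs τ W₁
            e₁ = sym (trans (evs-vars τ (allFin D)) (map-lookup-allFin τ))
            gc₁ : GC l
            gc₁ = subst GC (sym e₁) (none-GC τ W₁ (AllP.++⁻ˡ (colEvents W₁) (AllP.++⁻ʳ coordEvents none)) (subst Unique e₁ u) (subst GE e₁ ge)
              (subst (ConstOK τ) (ListP.++-identityʳ W₁) (ConstOK-vars τ (allFin D) [] tt)))
            e₂ : evs τ W₂ ≡ insertAbs v l
            e₂ = trans (ListP.map-++ (ev τ) (map inj₂ (take K (allFin D))) _)
              (cong₂ (λ a b → a ++ v ∷ b)
                (trans (evs-vars τ (take K (allFin D))) (trans (sym (ListP.take-map K (allFin D))) (cong (take K) (map-lookup-allFin τ))))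
                (trans (evs-vars τ (drop K (allFin D))) (trans (sym (ListP.drop-map K (allFin D))) (cong (drop K) (map-lookup-allFin τ)))))
            e₃ : insFrom l ≡ evs τ W₂
            e₃ = trans (insFrom-full l len) (sym e₂)
            ge₂ : GE (evs τ W₂)
            ge₂ = subst GE e₃ gi
            -- With `v` as the only constant, two windows never have constants at both extremes.
            gc₂ : GC (evs τ W₂)
            gc₂ = none-GC τ W₂ (AllP.++⁻ʳ (colEvents W₁) (AllP.++⁻ʳ coordEvents none)) (subst Unique e₃ (insFrom-Unique l uv)) ge₂
              (ConstOK-vars τ (take K (allFin D)) _ ((λ j j<r b R eq → contradiction eq (no-const (r + j) (drop K (allFin D))))
                , subst (ConstOK τ) (ListP.++-identityʳ (map inj₂ (drop K (allFin D)))) (ConstOK-vars τ (drop K (allFin D)) [] tt)))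

    -- Interleaved blocks

    walk : {A : Set} → List A → List (A × List A) → List A
    walk b [] = b
    walk b ((s , b′) ∷ ps) = b ++ s ∷ walk b′ ps

    -- The shape shared by connectors and tile paths, where the blocks have `r` vertices and `s`
    -- holds the single vertices between them.
    walkOf : {A : Set} (m : ℕ) (blk : Fin (suc m) → List A) (s : Fin m → A) → List A
    walkOf m blk s = walk (blk zero) (List.tabulate (λ l → s l , blk (suc l)))

    map-walkOf : {A B : Set} (f : A → B) (m : ℕ) (blk : Fin (suc m) → List A) (s : Fin m → A) →
      map f (walkOf m blk s) ≡ walkOf m (map f ∘ blk) (f ∘ s)
    map-walkOf f zero blk s = refl
    map-walkOf f (suc m) blk s = trans (ListP.map-++ f (blk zero) _)
      (cong (λ l → map f (blk zero) ++ f (s zero) ∷ l) (map-walkOf f m (blk ∘ suc) (s ∘ suc)))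

    length-walkOf : {A : Set} (c m : ℕ) (blk : Fin (suc m) → List A) (s : Fin m → A) → (∀ i → length (blk i) ≡ c) →
      length (walkOf m blk s) ≡ c + m * suc c
    length-walkOf c zero blk s h = trans (h zero) (sym (+-identityʳ c))
    length-walkOf c (suc m) blk s h = trans (ListP.length-++ (blk zero))
      (cong₂ (λ a b → a + suc b) (h zero) (length-walkOf c m (blk ∘ suc) (s ∘ suc) (h ∘ suc)))

    ∈-walkOf : {A : Set} (m : ℕ) (blk : Fin (suc m) → List A) (s : Fin m → A) {x : A} → x ∈ walkOf m blk s →
      (∃ λ i → x ∈ blk i) ⊎ (∃ λ l → x ≡ s l)
    ∈-walkOf zero blk s x∈ = inj₁ (zero , x∈)
    ∈-walkOf (suc m) blk s x∈ with MemP.∈-++⁻ (blk zero) x∈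
    ... | inj₁ m₁ = inj₁ (zero , m₁)
    ... | inj₂ (here eq) = inj₂ (zero , eq)
    ... | inj₂ (there m₂) with ∈-walkOf m (blk ∘ suc) (s ∘ suc) m₂
    ... | inj₁ (i , h) = inj₁ (suc i , h)
    ... | inj₂ (l , h) = inj₂ (suc l , h)

    Unique-walkOf : {A : Set} (m : ℕ) (blk : Fin (suc m) → List A) (s : Fin m → A) → (∀ i → Unique (blk i)) →
      (∀ i i′ {x} → x ∈ blk i → x ∈ blk i′ → i ≡ i′) → (∀ i l → s l ∉ blk i) → (∀ l l′ → s l ≡ s l′ → l ≡ l′) →
      Unique (walkOf m blk s)
    Unique-walkOf zero blk s ub db sb si = ub zero
    Unique-walkOf {A} (suc m) blk s ub db sb si = UniP.++⁺ (ub zero)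
      (All.tabulate s#
       ∷ Unique-walkOf m (blk ∘ suc) (s ∘ suc) (ub ∘ suc) (λ i i′ m₁ m₂ → FinP.suc-injective (db (suc i) (suc i′) m₁ m₂))
          (λ i l → sb (suc i) (suc l)) (λ l l′ eq → FinP.suc-injective (si (suc l) (suc l′) eq)))
      dis
      where
      s# : ∀ {x} → x ∈ walkOf m (blk ∘ suc) (s ∘ suc) → s zero ≢ x
      s# x∈ refl with ∈-walkOf m (blk ∘ suc) (s ∘ suc) x∈
      ... | inj₁ (i , h) = sb (suc i) zero h
      ... | inj₂ (l , eq) = case si zero (suc l) eq of λ ()
      dis : ∀ {x} → x ∈ blk zero × x ∈ s zero ∷ walkOf m (blk ∘ suc) (s ∘ suc) → ⊥
      dis (x∈ , here refl) = sb zero zero x∈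
      dis (x∈ , there x∈′) with ∈-walkOf m (blk ∘ suc) (s ∘ suc) x∈′
      ... | inj₁ (i , h) = case db zero (suc i) x∈ h of λ ()
      ... | inj₂ (l , refl) = sb zero (suc l) x∈

    -- With blocks of `r` vertices a window of `r + 1` contains exactly one separator: it consists
    -- of the last `r - j` vertices of one block, the separator, and the first `j` of the next.
    LinkE : List V → V → List V → Set
    LinkE b s b′ = ∀ j → j ≤ r → Edge (drop j b ++ s ∷ take j b′)

    drop-suc : {A : Set} (j : ℕ) (l : List A) {x : A} {l′ : List A} → drop j l ≡ x ∷ l′ → drop (suc j) l ≡ l′
    drop-suc zero (y ∷ l) refl = refl
    drop-suc (suc j) (y ∷ l) eq = drop-suc j l eq

    take-mid : {A : Set} (X : List A) (m : ℕ) (Y : List A) → take (length X + m) (X ++ Y) ≡ X ++ take m Y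
    take-mid [] m Y = refl
    take-mid (x ∷ X) m Y = cong (x ∷_) (take-mid X m Y)

    GE-link : ∀ b s b′ → length b ≡ r → length b′ ≡ r → LinkE b s b′ → GE (b ++ s ∷ b′)
    GE-link b s b′ lb lb′ lk = go b 0 (trans (+-identityʳ _) lb) refl
      where
      edge : ∀ X j → length X + j ≡ r → drop j b ≡ X → Edge (take k (X ++ s ∷ b′))
      edge X j lX eq = subst Edge
        (trans (cong (_++ s ∷ take j b′) eq)
          (sym (trans (cong (λ m → take m (X ++ s ∷ b′)) (trans (cong suc (sym lX)) (sym (+-suc (length X) j)))) (take-mid X (suc j) (s ∷ b′)))))
        (lk j (≤-trans (m≤n+m j (length X)) (≤-reflexive lX)))
      go : ∀ X j → length X + j ≡ r → drop j b ≡ X → GE (X ++ s ∷ b′)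
      go [] j lX eq = (λ _ → edge [] j lX eq) , GE-short b′ (≤-reflexive lb′)
      go (x ∷ X) j lX eq = (λ _ → edge (x ∷ X) j lX eq) , go X (suc j) (trans (+-suc (length X) j) lX) (drop-suc j b eq)

    walkOf-head : {A : Set} (m : ℕ) (blk : Fin (suc m) → List A) (s : Fin m → A) → ∃ λ rest → walkOf m blk s ≡ blk zero ++ rest
    walkOf-head zero blk s = [] , sym (ListP.++-identityʳ (blk zero))
    walkOf-head (suc m) blk s = _ , refl

    walkOf-last : {A : Set} (m : ℕ) (blk : Fin (suc m) → List A) (s : Fin m → A) →
      ∃ λ rest → walkOf m blk s ≡ rest ++ blk (Fin.fromℕ m)
    walkOf-last zero blk s = [] , refl
    walkOf-last (suc m) blk s with walkOf-last m (blk ∘ suc) (s ∘ suc)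
    ... | rest , eq = blk zero ++ s zero ∷ rest , trans (cong (λ l → blk zero ++ s zero ∷ l) eq) (sym (ListP.++-assoc (blk zero) (s zero ∷ rest) _))

    walkOf-GE : (m : ℕ) (blk : Fin (suc m) → List V) (s : Fin m → V) → (∀ i → length (blk i) ≡ r) →
      (∀ l → LinkE (blk (Fin.inject₁ l)) (s l) (blk (suc l))) → GE (walkOf m blk s)
    walkOf-GE zero blk s len lk = GE-short _ (≤-reflexive (len zero))
    walkOf-GE (suc m) blk s len lk = step (walkOf-head m (blk ∘ suc) (s ∘ suc))
      where
      step : (∃ λ rest → walkOf m (blk ∘ suc) (s ∘ suc) ≡ blk (suc zero) ++ rest) → GE (walkOf (suc m) blk s)
      step (rest , eq) = subst GE
        (trans (ListP.++-assoc (blk zero) [ s zero ] _) (cong (λ l → blk zero ++ s zero ∷ l) (sym eq)))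
        (GE-glue (blk zero ∷ʳ s zero) (blk (suc zero)) rest (≤-reflexive (sym (len (suc zero))))
          (subst GE (sym (ListP.++-assoc (blk zero) [ s zero ] (blk (suc zero)))) (GE-link _ _ _ (len zero) (len (suc zero)) (lk zero)))
          (subst GE eq (walkOf-GE m (blk ∘ suc) (s ∘ suc) (len ∘ suc) (lk ∘ suc))))

    take-drop-tabulate : {A : Set} {m : ℕ} (f g : Fin m → A) (j : ℕ) →
      take j (List.tabulate f) ++ drop j (List.tabulate g) ≡ List.tabulate (λ l → if toℕ l <ᵇ j then f l else g l)
    take-drop-tabulate {m = zero} f g zero = refl
    take-drop-tabulate {m = zero} f g (suc j) = refl
    take-drop-tabulate {m = suc m} f g zero = refl
    take-drop-tabulate {m = suc m} f g (suc j) = cong (f zero ∷_) (take-drop-tabulate (f ∘ suc) (g ∘ suc) j)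

    -- As a set, such a window is the separator together with a mixed tuple, which takes its entries
    -- from `g` before position `j` and from `f` from there on.
    LinkE-tabulate : (f g : Fin r → V) (s : V) →
      (∀ j → j ≤ r → Edge (s ∷ List.tabulate (λ l → if toℕ l <ᵇ j then g l else f l))) →
      LinkE (List.tabulate f) s (List.tabulate g)
    LinkE-tabulate f g s h j jr = Edge-↭
      (↭-trans (prep s (Perm.↭-reflexive (sym (take-drop-tabulate g f j))))
       (↭-trans (prep s (PermP.++-comm (take j (List.tabulate g)) (drop j (List.tabulate f))))
        (↭-sym (PermP.shift s (drop j (List.tabulate f)) (take j (List.tabulate g))))))
      (h j jr)

    nest : {A : Set} {P : A → Set} (xs : List A) (P? : ∀ x → Dec (P x)) (F : A → ℕ) (X Y c d : ℕ) →
      X ≤ c * count xs P? → (∀ x → P x → Y ≤ d * F x) → X * Y ≤ c * d * sumL xs F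
    nest xs P? F X Y c d hX hY = begin
      X * Y ≤⟨ *-monoˡ-≤ Y hX ⟩
      c * count xs P? * Y ≡⟨ r₁ c (count xs P?) Y ⟩
      c * (Y * count xs P?) ≡⟨ cong (c *_) (sym (sumL-* xs Y _)) ⟩
      c * sumL xs (λ x → Y * ind (P? x)) ≤⟨ *-monoʳ-≤ c (sumL-mono xs (λ x → ind-scale (P? x) (hY x))) ⟩
      c * sumL xs (λ x → d * F x) ≡⟨ cong (c *_) (sumL-* xs d F) ⟩
      c * (d * sumL xs F) ≡⟨ sym (*-assoc c d _) ⟩
      c * d * sumL xs F ∎
      where
      open ≤-Reasoning
      r₁ : ∀ a b c → a * b * c ≡ a * (c * b)
      r₁ = solve-∀

    count-vecs-dep : {A : Set} (xs : List A) (m c : ℕ) {P : Fin m → A → Set} (P? : ∀ p x → Dec (P p x)) →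
      (∀ p → length xs ≤ c * count xs (P? p)) →
      length xs ^ m ≤ c ^ m * count (vecs xs m) (λ w → FinP.all? (λ p → P? p (lookup w p)))
    count-vecs-dep xs zero c P? h = ≤-reflexive (sym (trans (+-identityʳ _) (trans (+-identityʳ _)
      (ind-yes (FinP.all? (λ p → P? p (lookup [] p))) (λ ())))))
    count-vecs-dep xs (suc m) c {P} P? h = begin
      length xs * length xs ^ m ≤⟨ nest xs (P? zero) (λ x → sumL (vecs xs m) (λ w → ind (all (x ∷ w)))) (length xs) (length xs ^ m) c (c ^ m) (h zero)
         (λ x px → ≤-trans (count-vecs-dep xs m c (P? ∘ suc) (h ∘ suc))
            (*-monoʳ-≤ (c ^ m) (count-mono (vecs xs m) _ (λ w → all (x ∷ w)) (λ w pw → λ { zero → px ; (suc p) → pw p })))) ⟩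
      c * c ^ m * sumL xs (λ x → sumL (vecs xs m) (λ w → ind (all (x ∷ w)))) ≡⟨ cong (c * c ^ m *_) (sym (sumL-vecs′ xs m (λ w → ind (all w)))) ⟩
      c * c ^ m * count (vecs xs (suc m)) all ∎
      where
      open ≤-Reasoning
      all : ∀ (w : Vec _ (suc m)) → Dec (∀ p → P p (lookup w p))
      all w = FinP.all? (λ p → P? p (lookup w p))

    <ᵇ-mono : ∀ a {b c} → (a <ᵇ b) ≡ true → b ≤ c → (a <ᵇ c) ≡ true
    <ᵇ-mono zero {suc b} {suc c} h le = refl
    <ᵇ-mono (suc a) {suc b} {suc c} h (s≤s le) = <ᵇ-mono a h le

    <ᵇ-refl : ∀ m → (m <ᵇ suc m) ≡ true
    <ᵇ-refl zero = refl
    <ᵇ-refl (suc m) = <ᵇ-refl m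

    -- Connectors

    module Connector where

      m₀ : ℕ
      m₀ = r + (r + r)

      iz ia ib : Fin r → Fin m₀
      iz l = l ↑ˡ (r + r)
      ia l = r ↑ʳ (l ↑ˡ r)
      ib l = r ↑ʳ (r ↑ʳ l)

      D : ℕ
      D = connDim r

      ab : ℕ → Fin r → Fin m₀
      ab i l = if toℕ l <ᵇ i then ib l else ia l

      -- The path is T₀ z₀ T₁ z₁ … T_r, where T_i agrees with b before position i and
      -- with a from there on; of each blown-up variable, T_i uses the copy i.
      blkP : Fin (suc r) → List (Fin D)
      blkP i = List.tabulate (λ l → combine (ab (toℕ i) l) i)

      -- A separator occurs only once on the path, so copy `zero` is enough for it.
      sepP : Fin r → Fin D
      sepP l = combine (iz l) zero

      connP : List (Fin D)
      connP = walkOf r blkP sepP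

      conn : Vec V D → List V
      conn τ = map (lookup τ) connP

      ↑ˡ≢↑ʳ : ∀ {m n} (i : Fin m) (j : Fin n) → i ↑ˡ n ≢ m ↑ʳ j
      ↑ˡ≢↑ʳ {m} {n} i j eq = <⇒≱ (≤-trans (s≤s (≤-reflexive (trans (cong toℕ (sym eq)) (FinP.toℕ-↑ˡ i n)))) (FinP.toℕ<n i))
        (≤-trans (m≤m+n m (toℕ j)) (≤-reflexive (sym (FinP.toℕ-↑ʳ m j))))

      ab-injective : ∀ i {l l′} → ab i l ≡ ab i l′ → l ≡ l′
      ab-injective i {l} {l′} eq with toℕ l <ᵇ i | toℕ l′ <ᵇ i
      ... | true | true = FinP.↑ʳ-injective r l l′ (FinP.↑ʳ-injective r _ _ eq)
      ... | true | false = contradiction (sym (FinP.↑ʳ-injective r _ _ eq)) (↑ˡ≢↑ʳ l′ l)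
      ... | false | true = contradiction (FinP.↑ʳ-injective r _ _ eq) (↑ˡ≢↑ʳ l l′)
      ... | false | false = FinP.↑ˡ-injective r l l′ (FinP.↑ʳ-injective r _ _ eq)

      iz≢ab : ∀ i l l′ → iz l ≢ ab i l′
      iz≢ab i l l′ eq with toℕ l′ <ᵇ i
      ... | true = ↑ˡ≢↑ʳ l _ eq
      ... | false = ↑ˡ≢↑ʳ l _ eq

      ∈-blkP : ∀ i {p} → p ∈ blkP i → ∃ λ l → p ≡ combine (ab (toℕ i) l) i
      ∈-blkP i p∈ = MemP.∈-tabulate⁻ p∈

      Unique-connP : Unique connP
      Unique-connP = Unique-walkOf r blkP sepP
        (λ i → UniP.tabulate⁺ (λ {l} {l′} eq → ab-injective (toℕ i) (FinP.combine-injectiveˡ (ab (toℕ i) l) i (ab (toℕ i) l′) i eq)))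
        dis sep
        (λ l l′ eq → FinP.↑ˡ-injective (r + r) l l′ (FinP.combine-injectiveˡ (iz l) zero (iz l′) zero eq))
        where
        dis : ∀ i i′ {p} → p ∈ blkP i → p ∈ blkP i′ → i ≡ i′
        dis i i′ p∈ p∈′ with ∈-blkP i p∈ | ∈-blkP i′ p∈′
        ... | l , refl | l′ , eq = FinP.combine-injectiveʳ (ab (toℕ i) l) i (ab (toℕ i′) l′) i′ eq
        sep : ∀ i l → sepP l ∉ blkP i
        sep i l p∈ with ∈-blkP i p∈
        ... | l′ , eq = iz≢ab (toℕ i) l l′ (FinP.combine-injectiveˡ (iz l) zero (ab (toℕ i) l′) i eq)

      length-connP : length connP ≡ r + r * suc r
      length-connP = length-walkOf r r blkP sepP (λ i → ListP.length-tabulate (λ l → combine (ab (toℕ i) l) i))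

      length-conn : ∀ τ → length (conn τ) ≡ r + r * suc r
      length-conn τ = trans (ListP.length-map (lookup τ) connP) length-connP

      T : (a b : Fin r → V) → ℕ → List V
      T a b i = List.tabulate (λ l → if toℕ l <ᵇ i then b l else a l)

      module _ (x y : List V) where

        Connects : Vec V D → Set
        Connects τ = Good (x ++ conn τ ++ y) × Unique (x ++ conn τ ++ y)

        Connects? : ∀ τ → Dec (Connects τ)
        Connects? τ = Good? (x ++ conn τ ++ y) ×-dec Unique? (x ++ conn τ ++ y)

        -- The walk before the blow-up, in which entries of `a` and `b` serve in several blocks.
        -- Once `a` and `b` are fixed, each `z l` faces just two degree conditions.
        Q3 : (z a b : Fin r → V) → Set
        Q3 z a b = GE (x ++ List.tabulate a) × GE (List.tabulate b ++ y) ×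
          (∀ l → Edge (z l ∷ T a b (toℕ l)) × Edge (z l ∷ T a b (suc (toℕ l))))

        Q3? : ∀ z a b → Dec (Q3 z a b)
        Q3? z a b = GE? (x ++ List.tabulate a) ×-dec (GE? (List.tabulate b ++ y) ×-dec
          FinP.all? (λ l → Edge? (z l ∷ T a b (toℕ l)) ×-dec Edge? (z l ∷ T a b (suc (toℕ l)))))

        T-cong : ∀ {a a′ b b′} → (∀ l → a l ≡ a′ l) → (∀ l → b l ≡ b′ l) → ∀ i → T a b i ≡ T a′ b′ i
        T-cong ea eb i = ListP.tabulate-cong (λ l → cong₂ (λ u v → if toℕ l <ᵇ i then u else v) (eb l) (ea l))

        Q3-cong : ∀ {z z′ a a′ b b′} → (∀ l → z l ≡ z′ l) → (∀ l → a l ≡ a′ l) → (∀ l → b l ≡ b′ l) → Q3 z a b → Q3 z′ a′ b′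
        Q3-cong ez ea eb (g₁ , g₂ , es) =
          subst (λ w → GE (x ++ w)) (ListP.tabulate-cong ea) g₁ ,
          subst (λ w → GE (w ++ y)) (ListP.tabulate-cong eb) g₂ ,
          λ l → subst Edge (cong₂ _∷_ (ez l) (T-cong ea eb (toℕ l))) (proj₁ (es l)) ,
                subst Edge (cong₂ _∷_ (ez l) (T-cong ea eb (suc (toℕ l)))) (proj₂ (es l))

        Qw : Vec V m₀ → Set
        Qw w = Q3 (lookup w ∘ iz) (lookup w ∘ ia) (lookup w ∘ ib)

        Qw? : ∀ w → Dec (Qw w)
        Qw? w = Q3? (lookup w ∘ iz) (lookup w ∘ ia) (lookup w ∘ ib)

        module Density (lx : length x ≡ K) (ly : length y ≡ K) (gx : Good x) (gy : Good y) (uxy : Unique (x ++ y))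
                 (qN : q * (K + K) ≤ N) where
          private
            ux : Unique x
            ux = proj₁ (Unique-++⁻ x uxy)
            uy : Unique y
            uy = proj₁ (proj₂ (Unique-++⁻ x uxy))

          Ωb : List V → Set
          Ωb w = Unique (w ++ y) × GE (w ++ y)

          Ωb? : ∀ w → Dec (Ωb w)
          Ωb? w = Unique? (w ++ y) ×-dec GE? (w ++ y)

          Ωb-step : ∀ w → length w < r → Ωb w → N ≤ q * count vs (λ u → Ωb? (u ∷ w))
          Ωb-step w lt (u , g) = ≤-trans (many-∩ (λ u → HeadE? (u ∷ w ++ y)) (λ u → HeadE? (u ∷ w ++ y)) (w ++ y) (many-head _ u) (many-head _ u)
              (≤-trans (*-monoʳ-≤ q (≤-trans (≤-reflexive (ListP.length-++ w)) (+-mono-≤ (≤-trans (<⇒≤ lt) (m≤m+n r r)) (≤-reflexive ly)))) qN))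
            (*-monoʳ-≤ q (count-mono vs _ _ (λ v → λ { (h , _ , v∉) → ∉⇒All≢ v∉ ∷ u , h , g })))

          -- `a` has to avoid `b` because the degree condition is available for a mixed tuple only
          -- if its entries are distinct. `x` and `b` may still meet here; the events in
          -- `connectors-dense` remove such cases.
          Ωa : List V → List V → Set
          Ωa b w = Unique (x ++ w) × Unique (w ++ b) × GE (x ++ w)

          Ωa? : ∀ b w → Dec (Ωa b w)
          Ωa? b w = Unique? (x ++ w) ×-dec (Unique? (w ++ b) ×-dec GE? (x ++ w))

          Ωa-step : ∀ b → length b ≡ r → ∀ w → length w < r → Ωa b w → N ≤ q * count vs (λ u → Ωa? b (w ∷ʳ u))
          Ωa-step b lb w lt (u₁ , u₂ , g) = ≤-trans (many-∩ L? L? (x ++ w ++ b) (many-last _ u₁) (many-last _ u₁) hB)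
            (*-monoʳ-≤ q (count-mono vs _ _ imp))
            where
            L? : ∀ v → Dec (r ≤ length (x ++ w) → Edge (v ∷ lastR (x ++ w)))
            L? v = (r ≤? length (x ++ w)) →-dec Edge? (v ∷ lastR (x ++ w))
            hB : q * length (x ++ w ++ b) ≤ N
            hB = ≤-trans (*-monoʳ-≤ q (≤-trans (≤-reflexive (trans (ListP.length-++ x) (cong₂ _+_ lx (ListP.length-++ w))))
              (+-monoʳ-≤ K (+-mono-≤ (<⇒≤ lt) (≤-reflexive lb))))) qN
            imp : ∀ v → (r ≤ length (x ++ w) → Edge (v ∷ lastR (x ++ w))) × (r ≤ length (x ++ w) → Edge (v ∷ lastR (x ++ w))) × v ∉ x ++ w ++ b →
              Ωa b (w ∷ʳ v)
            imp v (h , _ , v∉) =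
              subst Unique (ListP.++-assoc x w [ v ]) (Unique-↭ (PermP.∷↭∷ʳ v (x ++ w))
                (∉⇒All≢ (λ m → v∉ (subst (v ∈_) (ListP.++-assoc x w b) (MemP.∈-++⁺ˡ m))) ∷ u₁)) ,
              subst Unique (sym (ListP.++-assoc w [ v ] b)) (Unique-↭ (↭-sym (PermP.shift v w b)) (∉⇒All≢ (λ m → v∉ (MemP.∈-++⁺ʳ x m)) ∷ u₂)) ,
              subst GE (ListP.++-assoc x w [ v ]) (GE-snoc (x ++ w) v g h)

          T-Unique : ∀ (a b : Vec V r) → Unique (toList a ++ toList b) → ∀ i → Unique (T (lookup a) (lookup b) i)
          T-Unique a b u i = UniP.tabulate⁺ inj
            where
            dis = proj₂ (proj₂ (Unique-++⁻ (toList a) u))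
            inj : ∀ {l l′} → (if toℕ l <ᵇ i then lookup b l else lookup a l) ≡ (if toℕ l′ <ᵇ i then lookup b l′ else lookup a l′) → l ≡ l′
            inj {l} {l′} eq with toℕ l <ᵇ i | toℕ l′ <ᵇ i
            ... | true | true = lookup-injective b (proj₁ (proj₂ (Unique-++⁻ (toList a) u))) l l′ eq
            ... | true | false = ⊥-elim (dis (lookup-toList a l′) (subst (_∈ toList b) eq (lookup-toList b l)))
            ... | false | true = ⊥-elim (dis (lookup-toList a l) (subst (_∈ toList b) (sym eq) (lookup-toList b l′)))
            ... | false | false = lookup-injective a (proj₁ (Unique-++⁻ (toList a) u)) l l′ eq

          -- `b` grows leftwards from `y`, then `a` rightwards from `x`. The separators come last:
          -- they depend on both tuples but not on each other, so their numbers of choices simply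
          -- multiply.
          hom-dense : N ^ m₀ ≤ q ^ r * (q ^ r * q ^ r) * count (vecs vs m₀) Qw?
          hom-dense = begin
            N ^ (r + (r + r)) ≡⟨ trans (^-distribˡ-+-* N r (r + r)) (cong (N ^ r *_) (^-distribˡ-+-* N r r)) ⟩
            N ^ r * (N ^ r * N ^ r) ≤⟨ nest (vecs vs r) (λ b → Ωb? (toList b)) _ (N ^ r) (N ^ r * N ^ r) (q ^ r) (q ^ r * q ^ r)
                 (greedy-cons vs Ωb? q r Ωb-step (uy , proj₁ gy)) stepb ⟩
            q ^ r * (q ^ r * q ^ r) * sumL (vecs vs r) (λ b → sumL (vecs vs r) (λ a → G (a Vec.++ b)))
              ≡⟨ cong (q ^ r * (q ^ r * q ^ r) *_) (sym (trans (sumL-vecs-+ vs r (r + r) _) (sumL-vecs-+ vs r r G))) ⟩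
            q ^ r * (q ^ r * q ^ r) * count (vecs vs m₀) Qw? ∎
            where
            open ≤-Reasoning
            G : Vec V (r + r) → ℕ
            G w = sumL (vecs vs r) (λ z → ind (Qw? (z Vec.++ w)))
            stepz : ∀ (a b : Vec V r) → Ωb (toList b) → Ωa (toList b) ([] ++ toList a) → N ^ r ≤ q ^ r * G (a Vec.++ b)
            stepz a b (_ , gb) (_ , uab , ga) = ≤-trans
              (count-vecs-dep vs r q (λ l z → Edge? (z ∷ T α β (toℕ l)) ×-dec Edge? (z ∷ T α β (suc (toℕ l))))
                (λ l → ≤-trans (many-∩ (λ v → Edge? (v ∷ T α β (toℕ l))) (λ v → Edge? (v ∷ T α β (suc (toℕ l)))) []
                    (deg-list (T-Unique a b uab (toℕ l)) (ListP.length-tabulate {n = r} _)) (deg-list (T-Unique a b uab (suc (toℕ l))) (ListP.length-tabulate {n = r} _))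
                    (≤-trans (≤-reflexive (*-zeroʳ q)) z≤n))
                  (*-monoʳ-≤ q (count-mono vs _ _ (λ v → λ { (h , h′ , _) → h , h′ })))))
              (*-monoʳ-≤ (q ^ r) (count-mono (vecs vs r) _ _ imp))
              where
              α = lookup a
              β = lookup b
              imp : ∀ z → (∀ l → Edge (lookup z l ∷ T α β (toℕ l)) × Edge (lookup z l ∷ T α β (suc (toℕ l)))) → Qw (z Vec.++ (a Vec.++ b))
              imp z h = Q3-cong
                (λ l → sym (VecP.lookup-++ˡ z (a Vec.++ b) l))
                (λ l → sym (trans (VecP.lookup-++ʳ z (a Vec.++ b) (l ↑ˡ r)) (VecP.lookup-++ˡ a b l)))
                (λ l → sym (trans (VecP.lookup-++ʳ z (a Vec.++ b) (r ↑ʳ l)) (VecP.lookup-++ʳ a b l)))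
                (subst (λ w → GE (x ++ w)) (sym (tabulate-lookup-toList a)) ga , subst (λ w → GE (w ++ y)) (sym (tabulate-lookup-toList b)) gb , h)
            stepb : ∀ b → Ωb (toList b) → N ^ r * N ^ r ≤ q ^ r * q ^ r * sumL (vecs vs r) (λ a → G (a Vec.++ b))
            stepb b Ωbb = nest (vecs vs r) (λ a → Ωa? (toList b) ([] ++ toList a)) _ (N ^ r) (N ^ r) (q ^ r) (q ^ r)
              (greedy-snoc vs (Ωa? (toList b)) q r (Ωa-step (toList b) (VecP.length-toList b)) r [] ≤-refl
                (subst Unique (sym (ListP.++-identityʳ x)) ux , proj₁ (Unique-++⁻ (toList b) (proj₁ Ωbb)) , subst GE (sym (ListP.++-identityʳ x)) (proj₁ gx)))
              (λ a → stepz a b Ωbb)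

        -- The window with the first j vertices from block l + 1 and the others from
        -- block l is an evaluation of T_l (if j ≤ l) or of T_{l+1} (if j > l).
        module _ (τ : Vec V D) (sel : AllSel (suc r) m₀ Qw τ) where
          private
            cf : (Fin r → Fin (suc r)) → Fin m₀ → Fin (suc r)
            cf h i = [ (λ _ → zero) , (λ i′ → [ h , h ]′ (Fin.splitAt r i′)) ]′ (Fin.splitAt r i)

            cf-iz : ∀ h l → cf h (iz l) ≡ zero
            cf-iz h l rewrite FinP.splitAt-↑ˡ r l (r + r) = refl
            cf-ia : ∀ h l → cf h (ia l) ≡ h l
            cf-ia h l rewrite FinP.splitAt-↑ʳ r (r + r) (l ↑ˡ r) | FinP.splitAt-↑ˡ r l r = refl
            cf-ib : ∀ h l → cf h (ib l) ≡ h l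
            cf-ib h l rewrite FinP.splitAt-↑ʳ r (r + r) (r ↑ʳ l) | FinP.splitAt-↑ʳ r r l = refl

            α β : Fin r → Fin (suc r) → V
            α l i = lookup τ (combine (ia l) i)
            β l i = lookup τ (combine (ib l) i)

            pick : ∀ h → Q3 (λ l → lookup τ (sepP l)) (λ l → α l (h l)) (λ l → β l (h l))
            pick h = Q3-cong
              (λ l → trans (VecP.lookup∘tabulate f (iz l)) (cong (λ c → lookup τ (combine (iz l) c)) (cf-iz h l)))
              (λ l → trans (VecP.lookup∘tabulate f (ia l)) (cong (α l) (cf-ia h l)))
              (λ l → trans (VecP.lookup∘tabulate f (ib l)) (cong (β l) (cf-ib h l)))
              (AllSel-pick (suc r) m₀ {Qw} τ sel (cf h))
              where
              f : Fin m₀ → V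
              f i = lookup τ (combine i (cf h i))

            B : Fin (suc r) → Fin r → V
            B i l = lookup τ (combine (ab (toℕ i) l) i)

            B-if : ∀ i l → B i l ≡ (if toℕ l <ᵇ toℕ i then β l i else α l i)
            B-if i l with toℕ l <ᵇ toℕ i
            ... | true = refl
            ... | false = refl

          blk-eq : ∀ i → map (lookup τ) (blkP i) ≡ List.tabulate (B i)
          blk-eq i = ListP.map-tabulate (λ l → combine (ab (toℕ i) l) i) (lookup τ)

          link : ∀ l → LinkE (List.tabulate (B (Fin.inject₁ l))) (lookup τ (sepP l)) (List.tabulate (B (suc l)))
          link l = LinkE-tabulate (B (Fin.inject₁ l)) (B (suc l)) (lookup τ (sepP l)) edge
            where
            i = Fin.inject₁ l
            edge : ∀ j → j ≤ r → Edge (lookup τ (sepP l) ∷ List.tabulate (λ l′ → if toℕ l′ <ᵇ j then B (suc l) l′ else B i l′))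
            edge j jr with j ≤? toℕ l
            ... | yes jl = subst (λ w → Edge (lookup τ (sepP l) ∷ w)) (ListP.tabulate-cong pt) (proj₁ (proj₂ (proj₂ (pick h)) l))
              where
              h : Fin r → Fin (suc r)
              h l′ = if toℕ l′ <ᵇ j then suc l else i
              pt : ∀ l′ → (if toℕ l′ <ᵇ toℕ l then β l′ (h l′) else α l′ (h l′)) ≡ (if toℕ l′ <ᵇ j then B (suc l) l′ else B i l′)
              pt l′ rewrite B-if (suc l) l′ | B-if i l′ | FinP.toℕ-inject₁ l with toℕ l′ <ᵇ j in eqj
              ... | true rewrite <ᵇ-mono (toℕ l′) eqj jl | <ᵇ-mono (toℕ l′) eqj (m≤n⇒m≤1+n jl) = refl
              ... | false = refl
            ... | no jl = subst (λ w → Edge (lookup τ (sepP l) ∷ w)) (ListP.tabulate-cong pt) (proj₂ (proj₂ (proj₂ (pick h)) l))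
              where
              h : Fin r → Fin (suc r)
              h l′ = if toℕ l′ <ᵇ j then suc l else i
              pt : ∀ l′ → (if toℕ l′ <ᵇ suc (toℕ l) then β l′ (h l′) else α l′ (h l′)) ≡ (if toℕ l′ <ᵇ j then B (suc l) l′ else B i l′)
              pt l′ rewrite B-if (suc l) l′ | B-if i l′ | FinP.toℕ-inject₁ l with toℕ l′ <ᵇ j in eqj
              ... | true = refl
              ... | false with toℕ l′ <ᵇ suc (toℕ l) in eqs
              ...   | true = contradiction (trans (sym eqj) (<ᵇ-mono (toℕ l′) eqs (≰⇒> jl))) (λ ())
              ...   | false with toℕ l′ <ᵇ toℕ l in eql
              ...     | true = contradiction (trans (sym eqs) (<ᵇ-mono (toℕ l′) eql (n≤1+n (toℕ l)))) (λ ())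
              ...     | false = refl

          private
            first : GE (x ++ map (lookup τ) (blkP zero))
            first = subst (λ w → GE (x ++ w)) (trans (ListP.tabulate-cong (λ l → refl)) (sym (blk-eq zero))) (proj₁ (pick (λ _ → zero)))

            last : GE (map (lookup τ) (blkP (Fin.fromℕ r)) ++ y)
            last = subst (λ w → GE (w ++ y)) (trans (ListP.tabulate-cong pt) (sym (blk-eq (Fin.fromℕ r)))) (proj₁ (proj₂ (pick (λ _ → Fin.fromℕ r))))
              where
              pt : ∀ l → β l (Fin.fromℕ r) ≡ B (Fin.fromℕ r) l
              pt l rewrite B-if (Fin.fromℕ r) l | FinP.toℕ-fromℕ r | <ᵇ-mono (toℕ l) {suc (toℕ l)} {r} (<ᵇ-refl (toℕ l)) (FinP.toℕ<n l) = refl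

            lenB : ∀ i → length (map (lookup τ) (blkP i)) ≡ r
            lenB i = trans (ListP.length-map (lookup τ) (blkP i)) (ListP.length-tabulate (λ l → combine (ab (toℕ i) l) i))

            conn-eq : conn τ ≡ walkOf r (map (lookup τ) ∘ blkP) (lookup τ ∘ sepP)
            conn-eq = map-walkOf (lookup τ) r blkP sepP

            middle : GE (conn τ)
            middle = subst GE (sym conn-eq) (walkOf-GE r (map (lookup τ) ∘ blkP) (lookup τ ∘ sepP) lenB
              (λ l → subst₂ (λ b b′ → LinkE b (lookup τ (sepP l)) b′) (sym (blk-eq (Fin.inject₁ l))) (sym (blk-eq (suc l))) (link l)))

          conn-GE : GE (x ++ conn τ ++ y)
          conn-GE with walkOf-head r (map (lookup τ) ∘ blkP) (lookup τ ∘ sepP) | walkOf-last r (map (lookup τ) ∘ blkP) (lookup τ ∘ sepP)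
          ... | rest , eqh | rest′ , eql = GE-glue x (conn τ) y (≤-trans (m≤m+n r (r * suc r)) (≤-reflexive (sym (length-conn τ)))) xc cy
            where
            xc : GE (x ++ conn τ)
            xc = subst (λ w → GE (x ++ w)) (sym (trans conn-eq eqh)) (GE-glue x _ rest (≤-reflexive (sym (lenB zero))) first (subst GE (trans conn-eq eqh) middle))
            cy : GE (conn τ ++ y)
            cy = subst GE (sym (trans (cong (_++ y) (trans conn-eq eql)) (ListP.++-assoc rest′ _ y)))
              (GE-glue rest′ _ y (≤-reflexive (sym (lenB (Fin.fromℕ r)))) (subst GE (trans conn-eq eql) middle) last)

        ConstOK-consts : ∀ {D} (τ : Vec V D) y → GC y → ConstOK τ (map inj₁ y)
        ConstOK-consts τ [] g = tt
        ConstOK-consts τ (v ∷ y) (h , g) =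
          (λ j j<r b R eq → subst (λ l → NoConflict l j) (sym (evs-consts τ (v ∷ y))) (subst (NoConflict (v ∷ y)) (FinP.toℕ-fromℕ< j<r) (h (fromℕ< j<r))))
          , ConstOK-consts τ y g

        drop-mid : {A B : Set} (m : ℕ) (X : List A) (ps : List B) {Z R : List (A ⊎ B)} {b : A} → length X ≤ m → m < length X + length ps →
          drop m (map inj₁ X ++ map inj₂ ps ++ Z) ≢ inj₁ b ∷ R
        drop-mid zero [] (p ∷ ps) le lt ()
        drop-mid (suc m) [] (p ∷ ps) le lt eq = drop-mid m [] ps z≤n (s≤s⁻¹ lt) eq
        drop-mid (suc m) (x ∷ X) ps le lt eq = drop-mid m X ps (s≤s⁻¹ le) (s≤s⁻¹ lt) eq

        -- The extremes of two overlapping windows are at most `2r` positions apart, whereas at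
        -- least `2r` free vertices separate `x` from `y`. So both extremes lie in `x` or both in
        -- `y`, which are good by themselves.
        ConstOK-path : ∀ {D} (τ : Vec V D) x ps y → r + r ≤ length ps → GC x → GC y → ConstOK τ (map inj₁ x ++ map inj₂ ps ++ map inj₁ y)
        ConstOK-path τ [] ps y h gx gy = ConstOK-vars τ ps (map inj₁ y) (ConstOK-consts τ y gy)
        ConstOK-path τ (v ∷ x) ps y h (hx , gx) gy = head , ConstOK-path τ x ps y h gx gy
          where
          rest = map inj₂ ps ++ map inj₁ y
          head : ∀ j → j < r → ∀ b R → drop (k + j) (map inj₁ (v ∷ x) ++ rest) ≡ inj₁ b ∷ R → NoConflict (evs τ (map inj₁ (v ∷ x) ++ rest)) j
          head j j<r b R eq with k + j <? length (v ∷ x)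
          ... | yes lt = subst (λ l → NoConflict l j) (sym (trans (ListP.map-++ (ev τ) (map inj₁ (v ∷ x)) rest) (cong (_++ evs τ rest) (evs-consts τ (v ∷ x)))))
              (NoConflict-ext (v ∷ x) (evs τ rest) j (≤-trans (≤-reflexive (+-suc k j)) lt)
                (subst (NoConflict (v ∷ x)) (FinP.toℕ-fromℕ< j<r) (hx (fromℕ< j<r))))
          ... | no ¬lt = contradiction eq (drop-mid (k + j) (v ∷ x) ps (≮⇒≥ ¬lt)
              (s≤s (≤-trans (≤-trans (≤-reflexive (sym (+-suc r j))) (≤-trans (+-monoʳ-≤ r j<r) h)) (m≤n+m (length ps) (length x)))))

        module _ (B : List V) (lx : length x ≡ K) (ly : length y ≡ K) (gx : Good x) (gy : Good y) (uxy : Unique (x ++ y))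
                 (θ≤C : connConst r q ≤ C) (qN : q * (K + K) ≤ N) (0<N : 0 < N)
                 (θB : connConst r q * suc (K + K + length B) ≤ N) where
          private
            B′ = (x ++ y) ++ B
            θ = connConst r q
            β₁ = connDensity r q
            θB′ : θ * suc (length B′) ≤ N
            θB′ = ≤-trans (≤-reflexive (cong (λ m → θ * suc m) (trans (ListP.length-++ (x ++ y)) (cong (_+ length B) (trans (ListP.length-++ x) (cong₂ _+_ lx ly)))))) θB
            open Events D θ θ≤C B′ θB′
            W : List (Term D)
            W = map inj₁ x ++ map inj₂ connP ++ map inj₁ y
            es : List Ev
            es = coordEvents ++ colEvents W

            |W| : length W ≡ K + ((r + r * suc r) + K)
            |W| = trans (ListP.length-++ (map inj₁ x)) (cong₂ _+_ (trans (ListP.length-map inj₁ x) lx)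
              (trans (ListP.length-++ (map inj₂ connP)) (cong₂ _+_ (trans (ListP.length-map inj₂ connP) length-connP) (trans (ListP.length-map inj₁ y) ly))))

            few : 2 * β₁ * length es ≤ θ
            few = *-monoʳ-≤ (2 * β₁) (≤-trans (≤-reflexive (ListP.length-++ coordEvents))
              (+-mono-≤ length-coordEvents (≤-trans (length-colEvents W) (≤-reflexive (cong (_* r) |W|)))))

            evsW : ∀ τ → evs τ W ≡ x ++ conn τ ++ y
            evsW τ = trans (ListP.map-++ (ev τ) (map inj₁ x) _) (cong₂ _++_ (evs-consts τ x)
              (trans (ListP.map-++ (ev τ) (map inj₂ connP) _) (cong₂ _++_ (evs-vars τ connP) (evs-consts τ y))))

            inj₁-∈ : ∀ a → inj₁ a ∈ W → a ∈ x ++ y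
            inj₁-∈ a m with MemP.∈-++⁻ (map inj₁ x) m
            ... | inj₁ mx with MemP.∈-map⁻ inj₁ mx
            ...   | _ , m′ , refl = MemP.∈-++⁺ˡ m′
            inj₁-∈ a m | inj₂ m₂ with MemP.∈-++⁻ (map inj₂ connP) m₂
            ...   | inj₁ mp with MemP.∈-map⁻ inj₂ mp
            ...     | _ , _ , ()
            inj₁-∈ a m | inj₂ m₂ | inj₂ my with MemP.∈-map⁻ inj₁ my
            ...     | _ , m′ , refl = MemP.∈-++⁺ʳ x m′

            Unique-W : Unique W
            Unique-W = Unique-↭ (PermP.++⁺ˡ (map inj₁ x) (PermP.++-comm (map inj₁ y) (map inj₂ connP)))
              (subst Unique (trans (cong (_++ map inj₂ connP) (ListP.map-++ inj₁ x y)) (ListP.++-assoc (map inj₁ x) (map inj₁ y) (map inj₂ connP)))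
                (UniP.++⁺ (UniP.map⁺ (λ { refl → refl }) uxy) (UniP.map⁺ (λ { refl → refl }) Unique-connP)
                  (λ { (m₁ , m₂) → case MemP.∈-map⁻ inj₁ m₁ , MemP.∈-map⁻ inj₂ m₂ of λ { ((_ , _ , refl) , (_ , _ , ())) } })))

          connectors-dense : 0 < θ → N ^ D ≤ 2 * connDensity r q * count (vecs vs D) (λ τ → Connects? τ ×-dec Fresh? B (toList τ))
          connectors-dense 0<θ = ≤-trans
            (clean vs 0<N (AllSel? (suc r) m₀ Qw?) es β₁ 0<θ few (blow-up (suc r) vs 0<N m₀ _ Qw? (Density.hom-dense lx ly gx gy uxy qN)))
            (*-monoʳ-≤ (2 * β₁) (count-mono (vecs vs D) _ _ final))
            where
            final : ∀ τ → AllSel (suc r) m₀ Qw τ × None vs 0<N es τ → Connects τ × Fresh B (toList τ)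
            final τ (sel , none) = ((ge , subst GC (evsW τ) gc) , subst Unique (evsW τ) uW) , Avoids⇒Fresh τ B (λ p m → proj₁ av p (MemP.∈-++⁺ʳ (x ++ y) m)) (proj₂ av)
              where
              av : Avoids τ
              av = none-Avoids τ (AllP.++⁻ˡ coordEvents none)
              uW : Unique (evs τ W)
              uW = evs-Unique W av Unique-W (λ a m → MemP.∈-++⁺ˡ (inj₁-∈ a m))
              ge : GE (x ++ conn τ ++ y)
              ge = conn-GE τ sel
              gc : GC (evs τ W)
              gc = none-GC τ W (AllP.++⁻ʳ coordEvents none) uW (subst GE (sym (evsW τ)) ge)
                (ConstOK-path τ x connP y (≤-trans (+-monoʳ-≤ r (≤-trans (≤-reflexive (sym (*-identityʳ r))) (*-monoʳ-≤ r (s≤s z≤n)))) (≤-reflexive (sym length-connP))) (proj₂ gx) (proj₂ gy))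

    -- Selection

    -- Bernoulli's inequality for `(1 + 1/a) ^ j`, cleared of denominators.
    bernoulli : ∀ a j → a ^ j * (a + j) ≤ a * suc a ^ j
    bernoulli a zero = ≤-reflexive (trans (*-identityˡ (a + 0)) (trans (+-identityʳ a) (sym (*-identityʳ a))))
    bernoulli a (suc j) = begin
      a * a ^ j * (a + suc j) ≡⟨ r₁ a (a ^ j) j ⟩
      a ^ j * (a * a + a * j + a) ≤⟨ *-monoʳ-≤ (a ^ j) (≤-trans (m≤m+n _ j) (≤-reflexive (r₂ a j))) ⟩
      a ^ j * ((a + j) * suc a) ≡⟨ sym (*-assoc (a ^ j) (a + j) (suc a)) ⟩
      a ^ j * (a + j) * suc a ≤⟨ *-monoˡ-≤ (suc a) (bernoulli a j) ⟩
      a * suc a ^ j * suc a ≡⟨ r₃ a (suc a ^ j) ⟩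
      a * (suc a * suc a ^ j) ∎
      where
      open ≤-Reasoning
      r₁ : ∀ a p j → a * p * (a + (1 + j)) ≡ p * (a * a + a * j + a)
      r₁ = solve-∀
      r₂ : ∀ a j → a * a + a * j + a + j ≡ (a + j) * (1 + a)
      r₂ = solve-∀
      r₃ : ∀ a p → a * p * (1 + a) ≡ a * ((1 + a) * p)
      r₃ = solve-∀

    double-power : ∀ a → 0 < a → 2 * a ^ a ≤ suc a ^ a
    double-power a@(suc _) _ = *-cancelˡ-≤ a (≤-trans (≤-reflexive (r₁ a (a ^ a))) (bernoulli a a))
      where
      r₁ : ∀ a p → a * (2 * p) ≡ p * (a + a)
      r₁ = solve-∀

    -- Two doublings of `(1 + 1/a) ^ a`. In `select` the factor `4` is earned once per `4 * β`
    -- rounds and outweighs the factor `2` lost to each hit of a requirement.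
    quadruple-power : ∀ a m → 0 < a → 2 * a ≤ m → 4 * a ^ m ≤ suc a ^ m
    quadruple-power a m 0<a h = begin
      4 * a ^ m ≡⟨ cong (λ e → 4 * a ^ e) (sym (m+[n∸m]≡n h)) ⟩
      4 * a ^ (2 * a + (m ∸ 2 * a)) ≡⟨ cong (4 *_) (trans (^-distribˡ-+-* a (2 * a) _) (cong (_* a ^ (m ∸ 2 * a)) (trans (cong (a ^_) (cong (a +_) (+-identityʳ a))) (^-distribˡ-+-* a a a)))) ⟩
      4 * (a ^ a * a ^ a * a ^ (m ∸ 2 * a)) ≡⟨ r₁ (a ^ a) (a ^ (m ∸ 2 * a)) ⟩
      2 * a ^ a * (2 * a ^ a) * a ^ (m ∸ 2 * a)
        ≤⟨ *-mono-≤ (*-mono-≤ (double-power a 0<a) (double-power a 0<a)) (^-monoˡ-≤ (m ∸ 2 * a) (n≤1+n a)) ⟩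
      suc a ^ a * suc a ^ a * suc a ^ (m ∸ 2 * a)
        ≡⟨ sym (trans (^-distribˡ-+-* (suc a) (2 * a) _) (cong (_* suc a ^ (m ∸ 2 * a)) (trans (cong (suc a ^_) (cong (a +_) (+-identityʳ a))) (^-distribˡ-+-* (suc a) a a)))) ⟩
      suc a ^ (2 * a + (m ∸ 2 * a)) ≡⟨ cong (suc a ^_) (m+[n∸m]≡n h) ⟩
      suc a ^ m ∎
      where
      open ≤-Reasoning
      r₁ : ∀ p t → 4 * (p * p * t) ≡ 2 * p * (2 * p) * t
      r₁ = solve-∀

    sumL-∃≤ : {A : Set} (xs : List A) {f g : A → ℕ} → 0 < length xs → sumL xs f ≤ sumL xs g → ∃ λ x → x ∈ xs × f x ≤ g x
    sumL-∃≤ xs {f} {g} pos le with sumL-∃ xs {f} {λ x → 1 + g x}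
      (≤-trans (+-mono-≤ pos le) (≤-reflexive (trans (cong (_+ sumL xs g) (length-as-sum xs)) (sym (sumL-+ xs (λ _ → 1) g)))))
    ... | x , m , lt = x , m , s≤s⁻¹ lt

    toLists : ∀ {D} → List (Vec V D) → List V
    toLists F = concat (map toList F)

    length-toLists : ∀ {D} (F : List (Vec V D)) → length (toLists F) ≡ length F * D
    length-toLists [] = refl
    length-toLists (τ ∷ F) = trans (ListP.length-++ (toList τ)) (cong₂ _+_ (VecP.length-toList τ) (length-toLists F))

    -- Derandomised selection.  A requirement i hit c times in the first j rounds
    -- has weight 2^(j - c); each round takes the tuple satisfying requirements of
    -- largest total weight, which slows the growth of the total weight from 2^j
    -- to (2 - 1/β)^j, and this forces every single c to be linear in j.
    module Selection (d D β b : ℕ) {Rq : Vec V d → Set} (Rq? : ∀ i → Dec (Rq i))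
        {Sat : Vec V d → Vec V D → Set} (Sat? : ∀ i τ → Dec (Sat i τ)) (B₀ : List V) (0<β : 0 < β) (0<N : 0 < N)
        (dense : ∀ i → Rq i → ∀ B → length B ≤ b → N ^ D ≤ β * count (vecs vs D) (λ τ → Sat? i τ ×-dec Fresh? (B₀ ++ B) (toList τ))) where

      private
        -- `γ = 2β - 1`, so `γ / β` is the growth factor `2 - 1/β` of the total weight.
        γ : ℕ
        γ = pred β + β
        sucγ : suc γ ≡ 2 * β
        sucγ = trans (cong (_+ β) (suc-pred β ⦃ >-nonZero 0<β ⦄)) (cong (β +_) (sym (+-identityʳ β)))

        total : (Vec V d → ℕ) → ℕ
        total w = sumL (vecs vs d) (λ i → ind (Rq? i) * w i)

        gain : (Vec V d → ℕ) → Vec V D → ℕ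
        gain w τ = sumL (vecs vs d) (λ i → ind (Rq? i) * w i * ind (Sat? i τ))

      record State (j : ℕ) : Set where
        field
          F : List (Vec V D)
          w : Vec V d → ℕ
          |F| : length F ≤ j
          fresh : Fresh B₀ (toLists F)
          some : All (λ τ → ∃ λ i → Sat i τ) F
          weight : ∀ i → w i * 2 ^ count F (Sat? i) ≡ 2 ^ j
          small : β ^ j * total w ≤ N ^ d * γ ^ j

      open State

      start : State 0
      start = record { F = [] ; w = λ _ → 1 ; |F| = z≤n ; fresh = [] , [] ; some = [] ; weight = λ i → refl
        ; small = ≤-trans (≤-reflexive (+-identityʳ _)) (≤-trans (sumL-mono (vecs vs d) (λ i → ≤-trans (≤-reflexive (*-identityʳ _)) (ind≤1 (Rq? i))))
            (≤-reflexive (trans (sym (length-as-sum (vecs vs d))) (trans (length-vecs vs d) (sym (*-identityʳ _)))))) }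

      private
        -- The density hypothesis, applied with the vertices used so far as `B`, says that a random
        -- tuple satisfies each single requirement, and is fresh, with probability at least `1 / β`.
        -- Hence some tuple captures at least a `β`-th part of the total weight.
        pickτ : ∀ {j} (S : State j) → j * D ≤ b → ∃ λ τ →
          total (w S) ≤ β * sumL (vecs vs d) (λ i → ind (Rq? i) * w S i * ind (Sat? i τ ×-dec Fresh? (B₀ ++ toLists (F S)) (toList τ)))
        pickτ {j} S jb = proj₁ found , proj₂ (proj₂ found)
          where
          g : Vec V D → ℕ
          g τ = sumL (vecs vs d) (λ i → ind (Rq? i) * w S i * ind (Sat? i τ ×-dec Fresh? (B₀ ++ toLists (F S)) (toList τ)))
          open ≤-Reasoning
          term : ∀ i → N ^ D * (ind (Rq? i) * w S i) ≤ β * sumL (vecs vs D) (λ τ → ind (Rq? i) * w S i * ind (Sat? i τ ×-dec Fresh? (B₀ ++ toLists (F S)) (toList τ)))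
          term i = begin
            N ^ D * (ind (Rq? i) * w S i) ≡⟨ r₁ (N ^ D) (ind (Rq? i)) (w S i) ⟩
            w S i * (N ^ D * ind (Rq? i)) ≤⟨ *-monoʳ-≤ (w S i) (scale (Rq? i)) ⟩
            w S i * (ind (Rq? i) * (β * cnt)) ≡⟨ r₂ (w S i) (ind (Rq? i)) β cnt ⟩
            β * (ind (Rq? i) * w S i * cnt) ≡⟨ cong (β *_) (sym (sumL-* (vecs vs D) (ind (Rq? i) * w S i) _)) ⟩
            β * sumL (vecs vs D) (λ τ → ind (Rq? i) * w S i * ind (Sat? i τ ×-dec Fresh? (B₀ ++ toLists (F S)) (toList τ))) ∎
            where
            cnt = count (vecs vs D) (λ τ → Sat? i τ ×-dec Fresh? (B₀ ++ toLists (F S)) (toList τ))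
            r₁ : ∀ a b c → a * (b * c) ≡ c * (a * b)
            r₁ = solve-∀
            r₂ : ∀ a b c d → a * (b * (c * d)) ≡ c * (b * a * d)
            r₂ = solve-∀
            scale : (dec : Dec (Rq i)) → N ^ D * ind dec ≤ ind dec * (β * cnt)
            scale (no _) = ≤-reflexive (*-zeroʳ (N ^ D))
            scale (yes ri) = ≤-trans (≤-reflexive (*-identityʳ _)) (≤-trans
              (dense i ri (toLists (F S)) (≤-trans (≤-reflexive (length-toLists (F S))) (≤-trans (*-monoˡ-≤ D (|F| S)) jb))) (≤-reflexive (sym (+-identityʳ _))))
          le : sumL (vecs vs D) (λ _ → total (w S)) ≤ sumL (vecs vs D) (λ τ → β * g τ)
          le = begin
            sumL (vecs vs D) (λ _ → total (w S)) ≡⟨ trans (sumL-const (vecs vs D) _) (cong (_* total (w S)) (length-vecs vs D)) ⟩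
            N ^ D * total (w S) ≡⟨ sym (sumL-* (vecs vs d) (N ^ D) _) ⟩
            sumL (vecs vs d) (λ i → N ^ D * (ind (Rq? i) * w S i)) ≤⟨ sumL-mono (vecs vs d) term ⟩
            sumL (vecs vs d) (λ i → β * sumL (vecs vs D) (λ τ → ind (Rq? i) * w S i * ind (Sat? i τ ×-dec Fresh? (B₀ ++ toLists (F S)) (toList τ))))
              ≡⟨ trans (sumL-* (vecs vs d) β _) (cong (β *_) (sumL-swap (vecs vs d) (vecs vs D) _)) ⟩
            β * sumL (vecs vs D) g ≡⟨ sym (sumL-* (vecs vs D) β g) ⟩
            sumL (vecs vs D) (λ τ → β * g τ) ∎
          found : ∃ λ τ → τ ∈ vecs vs D × total (w S) ≤ β * g τ
          found = sumL-∃≤ (vecs vs D) {λ _ → total (w S)} {λ τ → β * g τ}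
            (subst (0 <_) (sym (length-vecs vs D)) (m^n>0 N ⦃ >-nonZero 0<N ⦄ D)) le

        -- A round doubles every weight and takes back the weight `G` of the requirements just hit;
        -- `G` being at least a `β`-th part of the total, the total grows by at most `2 - 1/β`.
        grow : ∀ {j} (S : State j) (w′ : Vec V d → ℕ) (G : ℕ) → total w′ + G ≡ 2 * total (w S) → total (w S) ≤ β * G →
          β ^ suc j * total w′ ≤ N ^ d * γ ^ suc j
        grow {j} S w′ G eq le = begin
          β * β ^ j * total w′ ≡⟨ r₁ β (β ^ j) (total w′) ⟩
          β ^ j * (β * total w′) ≤⟨ *-monoʳ-≤ (β ^ j) one ⟩
          β ^ j * (γ * total (w S)) ≡⟨ r₂ (β ^ j) γ (total (w S)) ⟩
          γ * (β ^ j * total (w S)) ≤⟨ *-monoʳ-≤ γ (small S) ⟩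
          γ * (N ^ d * γ ^ j) ≡⟨ r₂ γ (N ^ d) (γ ^ j) ⟩
          N ^ d * (γ * γ ^ j) ∎
          where
          open ≤-Reasoning
          r₁ : ∀ a b c → a * b * c ≡ b * (a * c)
          r₁ = solve-∀
          r₂ : ∀ a b c → a * (b * c) ≡ b * (a * c)
          r₂ = solve-∀
          one : β * total w′ ≤ γ * total (w S)
          one = +-cancelʳ-≤ (total (w S)) _ _ (begin
            β * total w′ + total (w S) ≤⟨ +-monoʳ-≤ (β * total w′) le ⟩
            β * total w′ + β * G ≡⟨ sym (*-distribˡ-+ β (total w′) G) ⟩
            β * (total w′ + G) ≡⟨ cong (β *_) eq ⟩
            β * (2 * total (w S)) ≡⟨ r₃ β (total (w S)) ⟩
            2 * β * total (w S) ≡⟨ cong (_* total (w S)) (sym sucγ) ⟩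
            total (w S) + γ * total (w S) ≡⟨ +-comm (total (w S)) _ ⟩
            γ * total (w S) + total (w S) ∎)
            where
            r₃ : ∀ a b → a * (2 * b) ≡ 2 * a * b
            r₃ = solve-∀

      private
        -- Weights are positive, so total weight zero means that there is no requirement at all. The
        -- round then leaves the family unchanged, since `some` allows no tuple that satisfies
        -- nothing.
        idle : ∀ {j} (S : State j) → total (w S) ≡ 0 → State (suc j)
        idle S z = record { F = F S ; w = λ i → 2 * w S i ; |F| = m≤n⇒m≤1+n (|F| S) ; fresh = fresh S ; some = some S
          ; weight = λ i → trans (*-assoc 2 (w S i) _) (cong (2 *_) (weight S i))
          ; small = grow S _ 0 (trans (+-identityʳ _) (trans (sumL-cong (vecs vs d) (λ i → r₁ (ind (Rq? i)) (w S i))) (sumL-* (vecs vs d) 2 _)))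
              (≤-trans (≤-reflexive z) z≤n) }
          where
          r₁ : ∀ a b → a * (2 * b) ≡ 2 * (a * b)
          r₁ = solve-∀

        add : ∀ {j} (S : State j) (τ : Vec V D) (i₀ : Vec V d) → Sat i₀ τ → Fresh (B₀ ++ toLists (F S)) (toList τ) →
          total (w S) ≤ β * gain (w S) τ → State (suc j)
        add {j} S τ i₀ sat (uτ , av) le = record { F = τ ∷ F S ; w = w′ ; |F| = s≤s (|F| S)
          ; fresh = UniP.++⁺ uτ (proj₁ (fresh S)) (λ { (m₁ , m₂) → All.lookup av m₁ (MemP.∈-++⁺ʳ B₀ m₂) })
                  , AllP.++⁺ (All.map (λ v∉ m → v∉ (MemP.∈-++⁺ˡ m)) av) (proj₂ (fresh S))
          ; some = (i₀ , sat) ∷ some S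
          ; weight = λ i → wt i (Sat? i τ)
          ; small = grow S w′ (gain (w S) τ) (trans (sym (sumL-+ (vecs vs d) _ _)) (trans (sumL-cong (vecs vs d) pt) (sumL-* (vecs vs d) 2 _))) le }
          where
          w′ : Vec V d → ℕ
          w′ i = choose (Sat? i τ) (w S i) (2 * w S i)
          wt : ∀ i (dec : Dec (Sat i τ)) → choose dec (w S i) (2 * w S i) * 2 ^ (ind dec + count (F S) (Sat? i)) ≡ 2 ^ suc j
          wt i (yes _) = trans (r₁ (w S i) (2 ^ count (F S) (Sat? i))) (cong (2 *_) (weight S i))
            where
            r₁ : ∀ a b → a * (2 * b) ≡ 2 * (a * b)
            r₁ = solve-∀
          wt i (no _) = trans (*-assoc 2 (w S i) _) (cong (2 *_) (weight S i))
          pt : ∀ i → ind (Rq? i) * w′ i + ind (Rq? i) * w S i * ind (Sat? i τ) ≡ 2 * (ind (Rq? i) * w S i)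
          pt i = go (ind (Rq? i)) (w S i) (Sat? i τ)
            where
            go : ∀ {P : Set} a b (dec : Dec P) → a * choose dec b (2 * b) + a * b * ind dec ≡ 2 * (a * b)
            go a b (yes _) = r₁ a b
              where
              r₁ : ∀ a b → a * b + a * b * 1 ≡ 2 * (a * b)
              r₁ = solve-∀
            go a b (no _) = r₁ a b
              where
              r₁ : ∀ a b → a * (2 * b) + a * b * 0 ≡ 2 * (a * b)
              r₁ = solve-∀

      step : ∀ {j} → State j → j * D ≤ b → State (suc j)
      step {j} S jb with total (w S) ≟ 0
      ... | yes z = idle S z
      ... | no nz = add S τ i₀ (proj₁ ok) (proj₂ ok)
          (≤-trans le (*-monoʳ-≤ β (sumL-mono (vecs vs d) (λ i → *-monoʳ-≤ (ind (Rq? i) * w S i) (ind-mono (both i) (Sat? i τ) proj₁)))))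
        where
        τ = proj₁ (pickτ S jb)
        le = proj₂ (pickτ S jb)
        both : ∀ i → Dec (Sat i τ × Fresh (B₀ ++ toLists (F S)) (toList τ))
        both i = Sat? i τ ×-dec Fresh? (B₀ ++ toLists (F S)) (toList τ)
        found : ∃ λ i → i ∈ vecs vs d × 0 < ind (Rq? i) * w S i * ind (both i)
        found = sumL-∃ (vecs vs d) {λ _ → 0} {λ i → ind (Rq? i) * w S i * ind (both i)}
            (subst (_< sumL (vecs vs d) (λ i → ind (Rq? i) * w S i * ind (both i))) (sym (trans (sumL-const (vecs vs d) 0) (*-zeroʳ (length (vecs vs d)))))
              (n≢0⇒n>0 (λ g0 → nz (n≤0⇒n≡0 (≤-trans le (≤-reflexive (trans (cong (β *_) g0) (*-zeroʳ β))))))))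
        i₀ = proj₁ found
        ok : Sat i₀ τ × Fresh (B₀ ++ toLists (F S)) (toList τ)
        ok = ind-pos (both i₀) (n≢0⇒n>0 (λ z → <⇒≢ (proj₂ (proj₂ found)) (sym (trans (cong (ind (Rq? i₀) * w S i₀ *_) z) (*-zeroʳ (ind (Rq? i₀) * w S i₀))))))

      run : ∀ j → j * D ≤ b → State j
      run zero h = start
      run (suc j) h = step (run j h′) h′
        where h′ = ≤-trans (m≤n+m (j * D) D) h

      -- A requirement hit fewer than `s` times in `m = 4βs` rounds would keep a weight of at least
      -- `2^(m-s)`, while the total weight is at most `N^d (2 - 1/β)^m`. As `(2β / (2β - 1))^(4β)`
      -- is at least 4, this gives `2^s ≤ N^d`, against the hypothesis.
      select : ∀ s → s * (4 * β) * D ≤ b → N ^ d < 2 ^ s →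
        Σ (List (Vec V D)) λ F → length F ≤ s * (4 * β) × Fresh B₀ (toLists F) × All (λ τ → ∃ λ i → Sat i τ) F ×
          (∀ i → Rq i → s ≤ count F (Sat? i))
      select s hb pow = F S , |F| S , fresh S , some S , many
        where
        m = s * (4 * β)
        S = run m hb
        0<γ : 0 < γ
        0<γ = ≤-trans 0<β (m≤n+m β (pred β))
        many : ∀ i → Rq i → s ≤ count (F S) (Sat? i)
        many i ri with s ≤? count (F S) (Sat? i)
        ... | yes le = le
        ... | no ¬le = contradiction pow (≤⇒≯ (*-cancelʳ-≤ (2 ^ s) (N ^ d) (2 ^ s) ⦃ m^n≢0 2 s ⦄ (*-cancelʳ-≤ _ _ (γ ^ m) ⦃ m^n≢0 γ m ⦃ >-nonZero 0<γ ⦄ ⦄ (begin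
            2 ^ s * 2 ^ s * γ ^ m ≡⟨ cong (_* γ ^ m) (sym (^-distribʳ-* s 2 2)) ⟩
            4 ^ s * γ ^ m ≡⟨ cong (4 ^ s *_) (γm) ⟩
            4 ^ s * (γ ^ (4 * β)) ^ s ≡⟨ sym (^-distribʳ-* s 4 (γ ^ (4 * β))) ⟩
            (4 * γ ^ (4 * β)) ^ s ≤⟨ ^-monoˡ-≤ s (quadruple-power γ (4 * β) 0<γ (≤-trans (≤-trans (*-monoʳ-≤ 2 (n≤1+n γ)) (≤-reflexive (cong (2 *_) sucγ))) (≤-reflexive (sym (*-assoc 2 2 β))))) ⟩
            (suc γ ^ (4 * β)) ^ s ≡⟨ trans (^-*-assoc (suc γ) (4 * β) s) (cong (suc γ ^_) (*-comm (4 * β) s)) ⟩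
            suc γ ^ m ≡⟨ cong (_^ m) sucγ ⟩
            (2 * β) ^ m ≡⟨ ^-distribʳ-* m 2 β ⟩
            2 ^ m * β ^ m ≡⟨ cong (_* β ^ m) (sym (weight S i)) ⟩
            w S i * 2 ^ c * β ^ m ≤⟨ *-monoˡ-≤ (β ^ m) (*-mono-≤ wi≤ (^-monoʳ-≤ 2 (<⇒≤ (≰⇒> ¬le)))) ⟩
            total (w S) * 2 ^ s * β ^ m ≡⟨ r₁ (total (w S)) (2 ^ s) (β ^ m) ⟩
            β ^ m * total (w S) * 2 ^ s ≤⟨ *-monoˡ-≤ (2 ^ s) (small S) ⟩
            N ^ d * γ ^ m * 2 ^ s ≡⟨ r₂ (N ^ d) (γ ^ m) (2 ^ s) ⟩
            N ^ d * 2 ^ s * γ ^ m ∎))))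
          where
          open ≤-Reasoning
          c = count (F S) (Sat? i)
          r₁ : ∀ a b c → a * b * c ≡ c * a * b
          r₁ = solve-∀
          r₂ : ∀ a b c → a * b * c ≡ a * c * b
          r₂ = solve-∀
          γm : γ ^ m ≡ (γ ^ (4 * β)) ^ s
          γm = sym (trans (^-*-assoc γ (4 * β) s) (cong (γ ^_) (*-comm (4 * β) s)))
          wi≤ : w S i ≤ total (w S)
          wi≤ = ≤-trans (≤-reflexive (sym (trans (cong (_* w S i) (ind-yes (Rq? i) ri)) (+-identityʳ _))))
            (≤-sumL (λ i → ind (Rq? i) * w S i) (∈-vecs vs i (λ p → MemP.∈-allFin (lookup i p))))

    -- Linking and absorbing

    lastK : List V → List V
    lastK l = drop (length l ∸ K) l

    initK : List V → List V
    initK l = take (length l ∸ K) l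

    init-last : ∀ l → initK l ++ lastK l ≡ l
    init-last l = ListP.take++drop≡id (length l ∸ K) l

    length-lastK : ∀ l → K ≤ length l → length (lastK l) ≡ K
    length-lastK l h = trans (ListP.length-drop (length l ∸ K) l) (m∸[m∸n]≡n h)

    length-takeK : ∀ (l : List V) → K ≤ length l → length (take K l) ≡ K
    length-takeK l h = trans (ListP.length-take K l) (m≤n⇒m⊓n≡m h)

    good-join : ∀ c T P → K ≤ length c → K ≤ length P → Good c → Good P → Good (lastK c ++ T ++ take K P) → Good (c ++ T ++ P)
    good-join c T P kc kp gc gp g = subst Good eq₂
      (Good-glue (c ++ T) (take K P) (drop K P) (≤-reflexive (sym (length-takeK P kp)))
        (subst Good eq₁ (Good-glue (initK c) (lastK c) (T ++ take K P) (≤-reflexive (sym (length-lastK c kc))) (subst Good (sym (init-last c)) gc) g))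
        (subst Good (sym (ListP.take++drop≡id K P)) gp))
      where
      eq₁ : initK c ++ lastK c ++ T ++ take K P ≡ (c ++ T) ++ take K P
      eq₁ = trans (sym (ListP.++-assoc (initK c) (lastK c) _)) (trans (cong (_++ T ++ take K P) (init-last c)) (sym (ListP.++-assoc c T _)))
      eq₂ : (c ++ T) ++ take K P ++ drop K P ≡ c ++ T ++ P
      eq₂ = trans (cong ((c ++ T) ++_) (ListP.take++drop≡id K P)) (ListP.++-assoc c T P)

    Lc : ℕ
    Lc = r + r * suc r

    -- Hides where connectors come from: `global-oracle` takes them from all vertices outside a set,
    -- `family-oracle` from the reservoir selected beforehand. Linking is the same in both cases.
    Oracle : (V → Set) → ℕ → Set
    Oracle Pool b = ∀ x y → length x ≡ K → length y ≡ K → Good x → Good y → Unique (x ++ y) → ∀ B → length B ≤ b →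
      ∃ λ T → length T ≡ Lc × Good (x ++ T ++ y) × Unique T × All Pool T × All (_∉ B) T

    module _ {Pool : V → Set} {b : ℕ} (oracle : Oracle Pool b) where

      -- `used` collects the pool vertices already on the path. The rest of the path lies outside
      -- the pool, so only this list has to be forbidden for the next connector; its length depends
      -- on the number of links and not on the length of the path. `counts` records that absorbers
      -- survive as blocks.
      record Linked (cur : List V) (Ps : List (List V)) (used : List V) : Set₁ where
        field
          bs : List (List V)
          used′ : List V
          good : Good (cur ++ concat bs)
          unique : Unique (cur ++ concat bs)
          counts : {Q : List V → Set} (Q? : ∀ l → Dec (Q l)) → count Ps Q? ≤ count bs Q?
          within : ∀ {v} → v ∈ concat bs → v ∈ concat Ps ⊎ Pool v
          covers : ∀ {v} → v ∈ concat Ps → v ∈ concat bs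
          track : ∀ {v} → v ∈ cur ++ concat bs → Pool v → v ∈ used′
          |used′| : length used′ ≡ length used + length Ps * Lc
          |bs| : length (concat bs) ≡ length (concat Ps) + length Ps * Lc

      link : ∀ Ps cur used → Good cur → K ≤ length cur → All (λ P → Good P × K ≤ length P) Ps → Unique (cur ++ concat Ps) →
        (∀ {v} → v ∈ cur → Pool v → v ∈ used) → (∀ {v} → v ∈ concat Ps → ¬ Pool v) → length used + length Ps * Lc ≤ b →
        Linked cur Ps used
      link [] cur used gc kc [] u tr np hb = record { bs = [] ; used′ = used ; good = subst Good (sym (ListP.++-identityʳ cur)) gc ; unique = u
        ; counts = λ Q? → z≤n ; within = λ () ; covers = λ () ; track = λ m → tr (subst (_ ∈_) (ListP.++-identityʳ cur) m)
        ; |used′| = sym (+-identityʳ _) ; |bs| = refl }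
      link (P ∷ Ps) cur used gc kc ((gP , kP) ∷ gPs) u tr np hb = extend
          (oracle (lastK cur) (take K P) (length-lastK cur kc) (length-takeK P kP)
            (Good-suffix (initK cur) (lastK cur) (subst Good (sym (init-last cur)) gc)) (Good-prefix (take K P) (drop K P) (subst Good (sym (ListP.take++drop≡id K P)) gP))
            uxy used (≤-trans (m≤m+n _ _) hb))
        where
        r₁ : ∀ a b c d → a + (b + (c + d)) ≡ (b + c) + (a + d)
        r₁ = solve-∀
        dis : ∀ {v} → v ∈ cur → v ∈ P ++ concat Ps → ⊥
        dis = proj₂ (proj₂ (Unique-++⁻ cur u))
        uPPs : Unique (P ++ concat Ps)
        uPPs = proj₁ (proj₂ (Unique-++⁻ cur u))
        uc = proj₁ (Unique-++⁻ cur u)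
        uP = proj₁ (Unique-++⁻ P (proj₁ (proj₂ (Unique-++⁻ cur u))))
        ∈-lastK : ∀ {v} → v ∈ lastK cur → v ∈ cur
        ∈-lastK m = subst (_ ∈_) (init-last cur) (MemP.∈-++⁺ʳ (initK cur) m)
        ∈-takeK : ∀ {v} → v ∈ take K P → v ∈ P
        ∈-takeK m = subst (_ ∈_) (ListP.take++drop≡id K P) (MemP.∈-++⁺ˡ m)
        uxy : Unique (lastK cur ++ take K P)
        uxy = UniP.++⁺ (UniP.drop⁺ (length cur ∸ K) uc) (UniP.take⁺ K uP) (λ { (m₁ , m₂) → dis (∈-lastK m₁) (MemP.∈-++⁺ˡ (∈-takeK m₂)) })
        extend : (∃ λ T → length T ≡ Lc × Good (lastK cur ++ T ++ take K P) × Unique T × All Pool T × All (_∉ used) T) → Linked cur (P ∷ Ps) used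
        extend (T , lT , gT , uT , poolT , avT) = record { bs = T ∷ P ∷ L.bs ; used′ = L.used′ ; good = subst Good eq L.good ; unique = subst Unique eq L.unique
          ; counts = λ Q? → ≤-trans (+-monoʳ-≤ (ind (Q? P)) (L.counts Q?)) (m≤n+m _ (ind (Q? T)))
          ; within = within′ ; covers = covers′
          ; track = λ m → L.track (subst (_ ∈_) (sym eq) m)
          ; |used′| = trans L.|used′| (trans (cong (_+ length Ps * Lc) (trans (ListP.length-++ used) (cong (length used +_) lT))) (+-assoc (length used) Lc _))
          ; |bs| = trans (ListP.length-++ T) (trans (cong₂ _+_ lT (trans (ListP.length-++ P) (cong (length P +_) L.|bs|)))
              (trans (r₁ Lc (length P) (length (concat Ps)) (length Ps * Lc)) (cong (_+ (Lc + length Ps * Lc)) (sym (ListP.length-++ P))))) }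
          where
          cur′ = cur ++ T ++ P
          eq₀ : cur′ ++ concat Ps ≡ cur ++ T ++ P ++ concat Ps
          eq₀ = trans (ListP.++-assoc cur (T ++ P) _) (cong (cur ++_) (ListP.++-assoc T P _))
          uTP : Unique (T ++ P ++ concat Ps)
          uTP = UniP.++⁺ uT uPPs (λ { (m₁ , m₂) → np m₂ (All.lookup poolT m₁) })
          u′ : Unique (cur′ ++ concat Ps)
          u′ = subst Unique (sym eq₀) (UniP.++⁺ (proj₁ (Unique-++⁻ cur u)) uTP dd)
            where
            dd : ∀ {v} → v ∈ cur × v ∈ T ++ P ++ concat Ps → ⊥
            dd (m₁ , m₂) with MemP.∈-++⁻ T m₂
            ... | inj₁ mT = All.lookup avT mT (tr m₁ (All.lookup poolT mT))
            ... | inj₂ mP = dis m₁ mP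
          tr′ : ∀ {v} → v ∈ cur′ → Pool v → v ∈ used ++ T
          tr′ m pv with MemP.∈-++⁻ cur m
          ... | inj₁ mc = MemP.∈-++⁺ˡ (tr mc pv)
          ... | inj₂ m′ with MemP.∈-++⁻ T m′
          ... | inj₁ mT = MemP.∈-++⁺ʳ used mT
          ... | inj₂ mP = contradiction pv (np (MemP.∈-++⁺ˡ mP))
          L′ : Linked cur′ Ps (used ++ T)
          L′ = link Ps cur′ (used ++ T) (good-join cur T P kc kP gc gP gT) (≤-trans kc (length-≤-++ cur _)) gPs u′ tr′ (np ∘ MemP.∈-++⁺ʳ P)
            (≤-trans (≤-reflexive (trans (cong (_+ length Ps * Lc) (trans (ListP.length-++ used) (cong (length used +_) lT))) (+-assoc (length used) Lc _))) hb)
          module L = Linked L′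
          eq : cur′ ++ concat L.bs ≡ cur ++ T ++ P ++ concat L.bs
          eq = trans (ListP.++-assoc cur (T ++ P) _) (cong (cur ++_) (ListP.++-assoc T P _))
          within′ : ∀ {v} → v ∈ T ++ P ++ concat L.bs → v ∈ P ++ concat Ps ⊎ Pool v
          within′ m with MemP.∈-++⁻ T m
          ... | inj₁ mT = inj₂ (All.lookup poolT mT)
          ... | inj₂ m′ with MemP.∈-++⁻ P m′
          ... | inj₁ mP = inj₁ (MemP.∈-++⁺ˡ mP)
          ... | inj₂ mb with L.within mb
          ... | inj₁ mm = inj₁ (MemP.∈-++⁺ʳ P mm)
          ... | inj₂ pv = inj₂ pv
          covers′ : ∀ {v} → v ∈ P ++ concat Ps → v ∈ T ++ P ++ concat L.bs
          covers′ m with MemP.∈-++⁻ P m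
          ... | inj₁ mP = MemP.∈-++⁺ʳ T (MemP.∈-++⁺ˡ mP)
          ... | inj₂ mps = MemP.∈-++⁺ʳ T (MemP.∈-++⁺ʳ P (L.covers mps))

      -- Length at least `2K` makes the first and the last `K` vertices disjoint, so that they
      -- qualify as ends of a connector.
      close : ∀ c used → Good c → K + K ≤ length c → Unique c → (∀ {v} → v ∈ c → Pool v → v ∈ used) → length used ≤ b →
        ∃ λ T → length T ≡ Lc × Good (c ++ T ++ take K c) × Unique (c ++ T) × All Pool T
      close c used gc kc u tr hb = finish
          (oracle (lastK c) (take K c) (length-lastK c kc′) (length-takeK c kc′)
            (Good-suffix (initK c) (lastK c) (subst Good (sym (init-last c)) gc)) (Good-prefix (take K c) (drop K c) (subst Good (sym (ListP.take++drop≡id K c)) gc))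
            uxy used hb)
        where
        kc′ = ≤-trans (m≤m+n K K) kc
        m = length c ∸ K
        Km : K ≤ m
        Km = ≤-trans (≤-reflexive (sym (m+n∸n≡m K K))) (∸-monoˡ-≤ K kc)
        sub : ∀ {v} → v ∈ take K c → v ∈ initK c
        sub {v} mem = subst (v ∈_) (ListP.take++drop≡id K (take m c)) (MemP.∈-++⁺ˡ (subst (v ∈_) (sym (trans (ListP.take-take K m c) (cong (λ e → take e c) (m≤n⇒m⊓n≡m Km)))) mem))
        uil : Unique (initK c ++ lastK c)
        uil = subst Unique (sym (init-last c)) u
        uxy : Unique (lastK c ++ take K c)
        uxy = UniP.++⁺ (UniP.drop⁺ m u) (UniP.take⁺ K u) (λ { (m₁ , m₂) → proj₂ (proj₂ (Unique-++⁻ (initK c) uil)) (sub m₂) m₁ })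
        finish : (∃ λ T → length T ≡ Lc × Good (lastK c ++ T ++ take K c) × Unique T × All Pool T × All (_∉ used) T) →
          ∃ λ T → length T ≡ Lc × Good (c ++ T ++ take K c) × Unique (c ++ T) × All Pool T
        finish (T , lT , gT , uT , poolT , avT) = T , lT
          , subst Good (trans (sym (ListP.++-assoc (initK c) (lastK c) _)) (cong (_++ T ++ take K c) (init-last c)))
              (Good-glue (initK c) (lastK c) (T ++ take K c) (≤-reflexive (sym (length-lastK c (≤-trans (m≤m+n K K) kc)))) (subst Good (sym (init-last c)) gc) gT)
          , UniP.++⁺ u uT (λ { (m₁ , m₂) → All.lookup avT m₂ (tr m₁ (All.lookup poolT m₂)) }) , poolT

    module _ (X Y : List V) where

      -- Both junctions are glued along a half of the absorber. Only the block `b` changes, so every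
      -- other vertex loses at most one of its absorbers; a linear supply therefore lasts for
      -- linearly many absorptions.
      absorb-one : ∀ v bs → Good (X ++ concat bs ++ Y) → 0 < count bs (Absorbs? v) →
        ∃ λ bs′ → Good (X ++ concat bs′ ++ Y) × concat bs′ ↭ v ∷ concat bs × (∀ w → count bs (Absorbs? w) ≤ suc (count bs′ (Absorbs? w)))
      absorb-one v bs g pos with count-∃ bs (Absorbs? v) pos
      ... | b , b∈ , (lb , gb , gi) with MemP.∈-∃++ b∈
      ... | as , cs , refl = as ++ insertAbs v b ∷ cs , good′ , perm , cnt
        where
        P₁ = take K b
        P₂ = drop K b
        lP₁ : length P₁ ≡ K
        lP₁ = length-takeK b (≤-trans (m≤m+n K K) (≤-reflexive (sym lb)))
        lP₂ : length P₂ ≡ K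
        lP₂ = trans (ListP.length-drop K b) (trans (cong (_∸ K) lb) (m+n∸n≡m K K))
        A = X ++ concat as
        R = concat cs ++ Y
        concat-mid : ∀ (m : List V) → X ++ concat (as ++ m ∷ cs) ++ Y ≡ A ++ m ++ R
        concat-mid m = trans (cong (λ l → X ++ l ++ Y) (sym (ListP.concat-++ as (m ∷ cs))))
          (trans (cong (X ++_) (trans (ListP.++-assoc (concat as) _ Y) (cong (concat as ++_) (ListP.++-assoc m (concat cs) Y)))) (sym (ListP.++-assoc X (concat as) _)))
        g₁ : Good (A ++ P₁ ++ P₂ ++ R)
        g₁ = subst Good (trans (concat-mid b) (cong (A ++_) (trans (cong (_++ R) (sym (ListP.take++drop≡id K b))) (ListP.++-assoc P₁ P₂ R)))) g
        gA : Good (A ++ P₁)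
        gA = Good-prefix (A ++ P₁) (P₂ ++ R) (subst Good (sym (ListP.++-assoc A P₁ _)) g₁)
        gR : Good (P₂ ++ R)
        gR = Good-suffix P₁ (P₂ ++ R) (Good-suffix A _ g₁)
        g₂ : Good (A ++ P₁ ++ v ∷ P₂)
        g₂ = Good-glue A P₁ (v ∷ P₂) (≤-reflexive (sym lP₁)) gA gi
        g₃ : Good ((A ++ P₁ ∷ʳ v) ++ P₂ ++ R)
        g₃ = Good-glue (A ++ P₁ ∷ʳ v) P₂ R (≤-reflexive (sym lP₂))
          (subst Good (sym (trans (ListP.++-assoc A (P₁ ∷ʳ v) P₂) (cong (A ++_) (ListP.++-assoc P₁ [ v ] P₂)))) g₂) gR
        good′ : Good (X ++ concat (as ++ insertAbs v b ∷ cs) ++ Y)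
        good′ = subst Good (sym (trans (concat-mid (insertAbs v b)) (sym (trans (ListP.++-assoc A (P₁ ∷ʳ v) _)
          (cong (A ++_) (trans (ListP.++-assoc P₁ [ v ] _) (sym (ListP.++-assoc P₁ (v ∷ P₂) R)))))))) g₃
        perm : concat (as ++ insertAbs v b ∷ cs) ↭ v ∷ concat (as ++ b ∷ cs)
        perm = ↭-trans (Perm.↭-reflexive (sym (ListP.concat-++ as (insertAbs v b ∷ cs))))
          (↭-trans (PermP.++⁺ˡ (concat as) (PermP.++⁺ʳ (concat cs) (↭-trans (PermP.shift v P₁ P₂) (prep v (Perm.↭-reflexive (ListP.take++drop≡id K b))))))
          (↭-trans (PermP.shift v (concat as) (b ++ concat cs)) (prep v (Perm.↭-reflexive (ListP.concat-++ as (b ∷ cs))))))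
        cnt : ∀ w → count (as ++ b ∷ cs) (Absorbs? w) ≤ suc (count (as ++ insertAbs v b ∷ cs) (Absorbs? w))
        cnt w = begin
          count (as ++ b ∷ cs) (Absorbs? w) ≡⟨ sumL-++ as (b ∷ cs) _ ⟩
          count as (Absorbs? w) + (ind (Absorbs? w b) + count cs (Absorbs? w)) ≤⟨ +-monoʳ-≤ (count as (Absorbs? w)) (+-monoˡ-≤ _ (ind≤1 (Absorbs? w b))) ⟩
          count as (Absorbs? w) + suc (count cs (Absorbs? w)) ≡⟨ +-suc _ _ ⟩
          suc (count as (Absorbs? w) + count cs (Absorbs? w)) ≤⟨ s≤s (+-monoʳ-≤ (count as (Absorbs? w)) (m≤n+m _ (ind (Absorbs? w (insertAbs v b))))) ⟩
          suc (count as (Absorbs? w) + (ind (Absorbs? w (insertAbs v b)) + count cs (Absorbs? w))) ≡⟨ cong suc (sym (sumL-++ as (insertAbs v b ∷ cs) _)) ⟩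
          suc (count (as ++ insertAbs v b ∷ cs) (Absorbs? w)) ∎
          where open ≤-Reasoning

      absorb-all : ∀ W bs → Good (X ++ concat bs ++ Y) → (∀ w → w ∈ W → length W ≤ count bs (Absorbs? w)) →
        ∃ λ bs′ → Good (X ++ concat bs′ ++ Y) × concat bs′ ↭ W ++ concat bs
      absorb-all [] bs g h = bs , g , ↭-refl
      absorb-all (v ∷ W) bs g h with absorb-one v bs g (≤-trans (s≤s z≤n) (h v (here refl)))
      ... | bs₁ , g₁ , p₁ , c₁ with absorb-all W bs₁ g₁ (λ w m → s≤s⁻¹ (≤-trans (h w (there m)) (c₁ w)))
      ... | bs₂ , g₂ , p₂ = bs₂ , g₂ , ↭-trans p₂ (↭-trans (PermP.++⁺ˡ W p₁) (PermP.shift v W (concat bs)))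

    count-mem : (L : List (List V)) → Unique (concat L) → ∀ v → count L (v ∈?_) ≤ 1
    count-mem [] u v = z≤n
    count-mem (l ∷ L) u v with v ∈? l
    ... | no _ = count-mem L (proj₁ (proj₂ (Unique-++⁻ l u))) v
    ... | yes m = s≤s (≤-reflexive (zero′ L (λ m′ → proj₂ (proj₂ (Unique-++⁻ l u)) m m′)))
      where
      zero′ : ∀ L → v ∉ concat L → count L (v ∈?_) ≡ 0
      zero′ [] h = refl
      zero′ (l ∷ L) h with v ∈? l
      ... | yes m = contradiction (MemP.∈-++⁺ˡ m) h
      ... | no _ = zero′ L (h ∘ MemP.∈-++⁺ʳ l)

    Hits : List V → List V → Set
    Hits B l = Any (_∈ B) l

    Hits? : ∀ B l → Dec (Hits B l)
    Hits? B l = Any.any? (_∈? B) l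

    hits-bound : ∀ B (L : List (List V)) → Unique (concat L) → count L (Hits? B) ≤ length B
    hits-bound B L u = begin
      count L (Hits? B) ≤⟨ sumL-mono L (λ l → pt l (Hits? B l)) ⟩
      sumL L (λ l → sumL B (λ v → ind (v ∈? l))) ≡⟨ sumL-swap L B _ ⟩
      sumL B (λ v → count L (v ∈?_)) ≤⟨ sumL-mono B (count-mem L u) ⟩
      sumL B (λ _ → 1) ≡⟨ sym (length-as-sum B) ⟩
      length B ∎
      where
      open ≤-Reasoning
      pt : ∀ l (h : Dec (Hits B l)) → ind h ≤ sumL B (λ v → ind (v ∈? l))
      pt l (no _) = z≤n
      pt l (yes h) with find h
      ... | v , v∈l , v∈B = ≤-trans (≤-reflexive (sym (ind-yes (v ∈? l) v∈l))) (≤-sumL (λ v → ind (v ∈? l)) v∈B)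

    open Connector public using (conn; connP; Connects; Connects?; length-conn; connectors-dense)

    conn-⊆ : ∀ τ {v} → v ∈ conn τ → v ∈ toList τ
    conn-⊆ τ {v} m with MemP.∈-map⁻ (lookup τ) m
    ... | p , _ , refl = subst (lookup τ p ∈_) (map-lookup-allFin τ) (MemP.∈-map⁺ (lookup τ) (MemP.∈-allFin p))

    Connects-Unique : ∀ x y τ → Connects x y τ → Unique (conn τ)
    Connects-Unique x y τ (_ , u) = proj₁ (Unique-++⁻ (conn τ) (proj₁ (proj₂ (Unique-++⁻ x u))))

    0<connConst : 0 < connDensity r q → 0 < connConst r q
    0<connConst h = *-mono-≤ (*-mono-≤ (s≤s {n = 1} z≤n) h) (≤-trans 1≤r (≤-trans (≤-trans (≤-reflexive (sym (+-identityʳ r))) (*-monoˡ-≤ r 1≤K)) (m≤n+m _ _)))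
      where
      1≤r : 1 ≤ r
      1≤r = ≤-trans (s≤s z≤n) 2≤r
      1≤K : 1 ≤ (r + r) + ((r + r * suc r) + (r + r))
      1≤K = ≤-trans 1≤r (≤-trans (m≤m+n r r) (m≤m+n (r + r) _))

    global-oracle : ∀ Z b → connConst r q ≤ C → q * (K + K) ≤ N → 0 < N → 0 < connDensity r q → connConst r q * suc (K + K + (length Z + b)) ≤ N →
      Oracle (_∉ Z) b
    global-oracle Z b θC qN 0<N 0<β θN x y lx ly gx gy uxy B hB = finish (count-∃ (vecs vs Connector.D) P? (n≢0⇒n>0 nonzero))
      where
      P? : ∀ τ → Dec (Connects x y τ × Fresh (Z ++ B) (toList τ))
      P? τ = Connects? x y τ ×-dec Fresh? (Z ++ B) (toList τ)
      nonzero : count (vecs vs Connector.D) P? ≢ 0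
      nonzero z = <⇒≱ (m^n>0 N ⦃ >-nonZero 0<N ⦄ Connector.D)
          (≤-trans (connectors-dense x y (Z ++ B) lx ly gx gy uxy θC qN 0<N
              (≤-trans (*-monoʳ-≤ (connConst r q) (s≤s (+-monoʳ-≤ (K + K) (≤-trans (≤-reflexive (ListP.length-++ Z)) (+-monoʳ-≤ (length Z) hB))))) θN) (0<connConst 0<β))
            (≤-reflexive (trans (cong (2 * connDensity r q *_) z) (*-zeroʳ (2 * connDensity r q)))))
      finish : (∃ λ τ → τ ∈ vecs vs Connector.D × Connects x y τ × Fresh (Z ++ B) (toList τ)) →
        ∃ λ T → length T ≡ Lc × Good (x ++ T ++ y) × Unique T × All (_∉ Z) T × All (_∉ B) T
      finish (τ , _ , c@(g , u) , _ , fr) = conn τ , length-conn τ , g , Connects-Unique x y τ c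
        , All.tabulate (λ m z → All.lookup fr (conn-⊆ τ m) (MemP.∈-++⁺ˡ z)) , All.tabulate (λ m b → All.lookup fr (conn-⊆ τ m) (MemP.∈-++⁺ʳ Z b))

    -- The members of the family are disjoint, so the at most `b` vertices of `B` spoil at most `b`
    -- of them, fewer than the `s` members that join `x` to `y`.
    family-oracle : ∀ (F : List (Vec V Connector.D)) s b → b < s → Unique (toLists F) →
      (∀ x y → length x ≡ K → length y ≡ K → Good x → Good y → Unique (x ++ y) → s ≤ count F (Connects? x y)) → Oracle (_∈ toLists F) b
    family-oracle F s b b<s uF hF x y lx ly gx gy uxy B hB = finish (count-∃ F P? pos)
      where
      P? : ∀ τ → Dec (Connects x y τ × ¬ Hits B (toList τ))
      P? τ = Connects? x y τ ×-dec ¬? (Hits? B (toList τ))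
      open ≤-Reasoning
      split : ∀ {P Q : Set} (p : Dec P) (q : Dec Q) → ind p ≤ ind (p ×-dec ¬? q) + ind q
      split (no _) q = z≤n
      split (yes _) (yes _) = ≤-refl
      split (yes _) (no _) = ≤-refl
      c = count F P?
      pos : 0 < c
      pos = +-cancelʳ-< b 0 c (begin-strict
        b <⟨ b<s ⟩
        s ≤⟨ hF x y lx ly gx gy uxy ⟩
        count F (Connects? x y) ≤⟨ sumL-mono F (λ τ → split (Connects? x y τ) (Hits? B (toList τ))) ⟩
        sumL F (λ τ → ind (Connects? x y τ ×-dec ¬? (Hits? B (toList τ))) + ind (Hits? B (toList τ))) ≡⟨ sumL-+ F _ _ ⟩
        c + sumL F (λ τ → ind (Hits? B (toList τ))) ≡⟨ cong (c +_) (sym (sumL-map toList F (λ l → ind (Hits? B l)))) ⟩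
        c + count (map toList F) (Hits? B) ≤⟨ +-monoʳ-≤ c (≤-trans (hits-bound B (map toList F) uF) hB) ⟩
        c + b ∎)
      finish : (∃ λ τ → τ ∈ F × Connects x y τ × ¬ Hits B (toList τ)) →
        ∃ λ T → length T ≡ Lc × Good (x ++ T ++ y) × Unique T × All (_∈ toLists F) T × All (_∉ B) T
      finish (τ , τ∈ , c@(g , u) , nh) = conn τ , length-conn τ , g , Connects-Unique x y τ c
        , All.tabulate (λ m → MemP.∈-concat⁺′ (conn-⊆ τ m) (MemP.∈-map⁺ toList τ∈))
        , All.tabulate (λ m b → nh (Any.map (λ { refl → b }) (conn-⊆ τ m)))

    -- Tiling

    sumL-⊆ : (l : List V) → Unique l → (f : V → ℕ) → sumL l f ≤ sumL vs f
    sumL-⊆ l u f = begin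
      sumL l f ≤⟨ sumL-mono l (λ v → ≤-trans (≤-reflexive (sym (trans (cong (f v *_) (ind-yes (v FinP.≟ v) refl)) (*-identityʳ _))))
          (≤-sumL (λ w → f w * ind (v FinP.≟ w)) (MemP.∈-allFin v))) ⟩
      sumL l (λ v → sumL vs (λ w → f w * ind (v FinP.≟ w))) ≡⟨ sumL-swap l vs _ ⟩
      sumL vs (λ w → sumL l (λ v → f w * ind (v FinP.≟ w))) ≤⟨ sumL-mono vs (λ w → ≤-trans (≤-reflexive (sumL-* l (f w) _)) (≤-trans (*-monoʳ-≤ (f w) (once l u w)) (≤-reflexive (*-identityʳ _)))) ⟩
      sumL vs f ∎
      where
      open ≤-Reasoning
      none : ∀ l w → w ∉ l → sumL l (λ v → ind (v FinP.≟ w)) ≡ 0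
      none [] w h = refl
      none (v ∷ l) w h with v FinP.≟ w
      ... | yes refl = contradiction (here refl) h
      ... | no _ = none l w (h ∘ there)
      once : ∀ l → Unique l → ∀ w → sumL l (λ v → ind (v FinP.≟ w)) ≤ 1
      once [] u w = z≤n
      once (v ∷ l) (v# ∷ u) w with v FinP.≟ w
      ... | yes refl = s≤s (≤-reflexive (none l v (λ m → All.lookup v# m refl)))
      ... | no _ = once l u w

    cover-count : (l : List V) → (∀ v → v ∈ l) → {P : V → Set} (P? : ∀ v → Dec (P v)) → count vs P? ≤ count l P?
    cover-count l cov {P} P? = subst₂ _≤_ (count-filter vs P?) (count-filter l P?)
      (rel-length _≡_ (filter P? vs) (filter P? l) (UniP.filter⁺ P? (UniP.allFin⁺ n))
        (λ v m → v , MemP.∈-filter⁺ P? (cov v) (proj₂ (MemP.∈-filter⁻ P? {xs = vs} m)) , refl) (λ { refl refl → refl }))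

    chunks : ℕ → ℕ → List V → List (List V)
    chunks M zero l = []
    chunks M (suc p) l = take M l ∷ chunks M p (drop M l)

    take-+ : {A : Set} (a b : ℕ) (l : List A) → take (a + b) l ≡ take a l ++ take b (drop a l)
    take-+ zero b l = refl
    take-+ (suc a) zero [] = refl
    take-+ (suc a) (suc b) [] = refl
    take-+ (suc a) b (x ∷ l) = cong (x ∷_) (take-+ a b l)

    concat-chunks : ∀ M p l → concat (chunks M p l) ≡ take (p * M) l
    concat-chunks M zero l = refl
    concat-chunks M (suc p) l = trans (cong (take M l ++_) (concat-chunks M p (drop M l))) (sym (take-+ M (p * M) l))

    chunks-length : ∀ M p l → p * M ≤ length l → All (λ c → length c ≡ M) (chunks M p l)
    chunks-length M zero l h = []
    chunks-length M (suc p) l h = trans (ListP.length-take M l) (m≤n⇒m⊓n≡m (≤-trans (m≤m+n M (p * M)) h))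
      ∷ chunks-length M p (drop M l) (≤-trans (≤-trans (≤-reflexive (sym (m+n∸m≡n M (p * M)))) (∸-monoˡ-≤ M h)) (≤-reflexive (sym (ListP.length-drop M l))))

    length-concat-const : ∀ M (L : List (List V)) → All (λ c → length c ≡ M) L → length (concat L) ≡ length L * M
    length-concat-const M [] [] = refl
    length-concat-const M (c ∷ L) (lc ∷ a) = trans (ListP.length-++ c) (cong₂ _+_ lc (length-concat-const M L a))

    fromListN : ∀ h (l : List V) → h ≤ length l → Σ (Vec V h) λ σ → toList σ ≡ take h l
    fromListN zero l _ = [] , refl
    fromListN (suc h) (x ∷ l) (s≤s le) = let σ , eq = fromListN h l le in x ∷ σ , cong (x ∷_) eq

    -- Two tuples from the groups that fit many blocks

    module Compatible (h : ℕ) where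

      OK1 : List V → Vec V h → Set
      OK1 u σ = (∀ p → Edge (lookup σ p ∷ u)) × Unique (toList σ)

      -- Equal colors within `σ`, or within `σ′`, do no harm: on the path two entries of the same
      -- tuple never flank the same block.
      OK : List V → Vec V h → Vec V h → Set
      OK u σ σ′ = OK1 u σ × OK1 u σ′ × (∀ p p′ → col (lookup σ p ∷ u) ≢ col (lookup σ′ p′ ∷ u))

      OK1? : ∀ u σ → Dec (OK1 u σ)
      OK1? u σ = FinP.all? (λ p → Edge? (lookup σ p ∷ u)) ×-dec Unique? (toList σ)

      OK? : ∀ u σ σ′ → Dec (OK u σ σ′)
      OK? u σ σ′ = OK1? u σ ×-dec (OK1? u σ′ ×-dec FinP.all? (λ p → FinP.all? (λ p′ → ¬? (col (lookup σ p ∷ u) ≟ col (lookup σ′ p′ ∷ u)))))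

      module _ (gs : List (List V)) (gsM : All (λ Q → length Q ≡ h + h) gs) (ugs : Unique (concat gs)) (1≤h : 1 ≤ h) where
        private
          S₀ = concat gs
          κ = tileKappa q h

        -- Tuples inside single groups only. Since groups have constant size there are linearly many
        -- of them, so that `popular-pair` can fix two at the loss of a constant factor.
        X : List (Vec V h)
        X = concatMap (λ Q → vecs Q h) gs

        sumX : (f : Vec V h → ℕ) → sumL X f ≡ sumL gs (λ Q → sumL (vecs Q h) f)
        sumX = sumL-concatMap (λ Q → vecs Q h) gs

        length-X : length X ≡ length gs * (h + h) ^ h
        length-X = trans (length-as-sum X) (trans (sumX _) (go gs gsM))
          where
          go : ∀ gs → All (λ Q → length Q ≡ h + h) gs → sumL gs (λ Q → sumL (vecs Q h) (λ _ → 1)) ≡ length gs * (h + h) ^ h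
          go [] [] = refl
          go (Q ∷ gs) (lQ ∷ a) = cong₂ _+_ (trans (sym (length-as-sum (vecs Q h))) (trans (length-vecs Q h) (cong (_^ h) lQ))) (go gs a)

        length-gs : length gs * (h + h) ≤ N
        length-gs = ≤-trans (≤-reflexive (sym (length-concat-const (h + h) gs gsM))) (Unique⇒length≤ ugs)

        length-X-≤ : length X ≤ N * (h + h) ^ h
        length-X-≤ = ≤-trans (≤-reflexive length-X) (*-monoˡ-≤ ((h + h) ^ h) (≤-trans (≤-trans (≤-reflexive (sym (*-identityʳ (length gs)))) (*-monoʳ-≤ (length gs) (≤-trans 1≤h (m≤m+n h h)))) length-gs))

        module _ (rest : List V) (cov : ∀ v → v ∈ S₀ ++ rest) (small : 2 * q * length rest ≤ N) (2κ≤C : 2 * κ ≤ C)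
                 (u : List V) (uu : Unique u) (lu : length u ≡ r) where
          private
            P? : ∀ v → Dec (Edge (v ∷ u))
            P? v = Edge? (v ∷ u)

            good? : ∀ Q → Dec (h ≤ count Q P?)
            good? Q = h ≤? count Q P?

            G : ℕ
            G = count gs good?

            same? : ∀ s s′ → Dec (Edge (s ∷ u) × (Edge (s′ ∷ u) × col (s′ ∷ u) ≡ col (s ∷ u)))
            same? s s′ = P? s ×-dec (P? s′ ×-dec (col (s′ ∷ u) ≟ col (s ∷ u)))

            conf : List V → List V → ℕ
            conf Q Q′ = sumL Q (λ s → sumL Q′ (λ s′ → ind (same? s s′)))

            pairs : List V → List V → ℕ
            pairs Q Q′ = sumL (vecs Q h) (λ σ → sumL (vecs Q′ h) (λ σ′ → ind (OK? u σ σ′)))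

            per-group : ∀ Q → length Q ≡ h + h → count Q P? ≤ h + h * ind (good? Q)
            per-group Q lQ with good? Q
            ... | yes _ = ≤-trans (count≤length Q P?) (≤-reflexive (trans lQ (cong (h +_) (sym (*-identityʳ h)))))
            ... | no ¬g = ≤-trans (<⇒≤ (≰⇒> ¬g)) (m≤m+n h (h * 0))

            -- A group that is not good holds less than half of its size in neighbours. Halves of
            -- all groups account for at most `N / 2`, and `rest` for at most `N / (2q)`; of the
            -- degree surplus `N / q` at least `N / (2q)` remains, and each good group can supply
            -- only `h` of it.
            G-big : N ≤ 2 * q * h * G
            G-big = +-cancelˡ-≤ (q * N) _ _ (+-cancelʳ-≤ N _ _ (begin
              q * N + N + N ≡⟨ r₁ q N ⟩
              (q + 2) * N ≤⟨ deg-list uu lu ⟩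
              2 * q * count vs P? ≤⟨ *-monoʳ-≤ (2 * q) (cover-count (S₀ ++ rest) cov P?) ⟩
              2 * q * count (S₀ ++ rest) P? ≡⟨ cong (2 * q *_) (sumL-++ S₀ rest _) ⟩
              2 * q * (count S₀ P? + count rest P?) ≤⟨ *-monoʳ-≤ (2 * q) (+-mono-≤ inS₀ (count≤length rest P?)) ⟩
              2 * q * ((length gs * h + h * G) + length rest) ≡⟨ r₂ q (length gs) h G (length rest) ⟩
              q * (length gs * (h + h)) + 2 * q * h * G + 2 * q * length rest ≤⟨ +-mono-≤ (+-monoˡ-≤ (2 * q * h * G) (*-monoʳ-≤ q length-gs)) small ⟩
              q * N + 2 * q * h * G + N ∎))
              where
              open ≤-Reasoning
              r₁ : ∀ q N → q * N + N + N ≡ (q + 2) * N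
              r₁ = solve-∀
              r₂ : ∀ q g h G z → 2 * q * ((g * h + h * G) + z) ≡ q * (g * (h + h)) + 2 * q * h * G + 2 * q * z
              r₂ = solve-∀
              go : ∀ gs → All (λ Q → length Q ≡ h + h) gs → sumL gs (λ Q → count Q P?) ≤ length gs * h + h * count gs good?
              go [] [] = z≤n
              go (Q ∷ gs) (lQ ∷ a) = ≤-trans (+-mono-≤ (per-group Q lQ) (go gs a)) (≤-reflexive (r₃ h (ind (good? Q)) (length gs * h) (count gs good?)))
                where
                r₃ : ∀ h i a c → h + h * i + (a + h * c) ≡ h + a + h * (i + c)
                r₃ = solve-∀
              inS₀ : count S₀ P? ≤ length gs * h + h * G
              inS₀ = ≤-trans (≤-reflexive (sumL-concat gs _)) (go gs gsM)

            canon : ∀ Q → Q ∈ gs → h ≤ count Q P? → Σ (Vec V h) λ σ → σ ∈ vecs Q h × (∀ p → lookup σ p ∈ Q) × OK1 u σ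
            canon Q Q∈ le = σ , ∈-vecs Q σ (λ p → proj₁ (mem p)) , (λ p → proj₁ (mem p)) , (λ p → proj₂ (mem p)) , subst Unique (sym eq) (UniP.take⁺ h (UniP.filter⁺ P? uQ))
              where
              lF : h ≤ length (filter P? Q)
              lF = ≤-trans le (≤-reflexive (sym (count-filter Q P?)))
              σ = proj₁ (fromListN h (filter P? Q) lF)
              eq : toList σ ≡ take h (filter P? Q)
              eq = proj₂ (fromListN h (filter P? Q) lF)
              mem : ∀ p → lookup σ p ∈ Q × Edge (lookup σ p ∷ u)
              mem p = MemP.∈-filter⁻ P? {xs = Q} (subst (lookup σ p ∈_) (ListP.take++drop≡id h (filter P? Q)) (MemP.∈-++⁺ˡ (subst (lookup σ p ∈_) eq (lookup-toList σ p))))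
              uQ : Unique Q
              uQ with MemP.∈-∃++ Q∈
              ... | as , bs , refl = proj₁ (Unique-++⁻ Q (proj₁ (proj₂ (Unique-++⁻ (concat as) (subst Unique (sym (ListP.concat-++ as (Q ∷ bs))) ugs)))))

            -- The canonical halves of two good groups either have no color in common, and then they
            -- form a compatible pair, or they exhibit a coincidence counted by `conf`. The case
            -- `Q = Q′` needs no exception: a shared vertex is a coincidence.
            pair-or-conf : ∀ Q Q′ → Q ∈ gs → Q′ ∈ gs → ind (good? Q) * ind (good? Q′) ≤ pairs Q Q′ + conf Q Q′
            pair-or-conf Q Q′ Q∈ Q′∈ with good? Q | good? Q′
            ... | no _ | _ = z≤n
            ... | yes _ | no _ = z≤n
            ... | yes g | yes g′ = decide (FinP.any? (λ p → FinP.any? (λ p′ → col (lookup σ p ∷ u) ≟ col (lookup σ′ p′ ∷ u))))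
              where
              c = canon Q Q∈ g
              c′ = canon Q′ Q′∈ g′
              σ = proj₁ c
              σ′ = proj₁ c′
              ok = proj₂ (proj₂ (proj₂ c))
              ok′ = proj₂ (proj₂ (proj₂ c′))
              decide : Dec (∃ λ p → ∃ λ p′ → col (lookup σ p ∷ u) ≡ col (lookup σ′ p′ ∷ u)) → 1 ≤ pairs Q Q′ + conf Q Q′
              decide (no ¬e) = ≤-trans (≤-trans (≤-reflexive (sym (ind-yes (OK? u σ σ′) (ok , ok′ , λ p p′ e → ¬e (p , p′ , e)))))
                (≤-trans (≤-sumL (λ σ′ → ind (OK? u σ σ′)) (proj₁ (proj₂ c′))) (≤-sumL (λ σ → sumL (vecs Q′ h) (λ σ′ → ind (OK? u σ σ′))) (proj₁ (proj₂ c))))) (m≤m+n _ _)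
              decide (yes (p , p′ , e)) = ≤-trans (≤-trans (≤-reflexive (sym (ind-yes (same? s s′) (proj₁ ok p , proj₁ ok′ p′ , sym e))))
                (≤-trans (≤-sumL (λ s′ → ind (same? s s′)) (proj₁ (proj₂ (proj₂ c′)) p′)) (≤-sumL (λ s → sumL Q′ (λ s′ → ind (same? s s′))) (proj₁ (proj₂ (proj₂ c)) p)))) (m≤n+m _ _)
                where
                s = lookup σ p
                s′ = lookup σ′ p′

            I Y : ℕ
            I = sumL X (λ σ → sumL X (λ σ′ → ind (OK? u σ σ′)))
            Y = sumL gs (λ Q → sumL gs (λ Q′ → conf Q Q′))

            I-eq : I ≡ sumL gs (λ Q → sumL gs (λ Q′ → pairs Q Q′))
            I-eq = trans (sumX _) (sumL-cong gs (λ Q → trans (sumL-cong (vecs Q h) (λ σ → sumX _)) (sumL-swap (vecs Q h) gs _)))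

            GG : G * G ≤ I + Y
            GG = begin
              G * G ≡⟨ sym (sumL-*ʳ gs G _) ⟩
              sumL gs (λ Q → ind (good? Q) * G) ≡⟨ sumL-cong gs (λ Q → sym (sumL-* gs (ind (good? Q)) _)) ⟩
              sumL gs (λ Q → sumL gs (λ Q′ → ind (good? Q) * ind (good? Q′)))
                ≤⟨ sumL-mono∈ gs (λ Q Q∈ → sumL-mono∈ gs (λ Q′ Q′∈ → pair-or-conf Q Q′ Q∈ Q′∈)) ⟩
              sumL gs (λ Q → sumL gs (λ Q′ → pairs Q Q′ + conf Q Q′)) ≡⟨ sumL-cong gs (λ Q → sumL-+ gs (pairs Q) (conf Q)) ⟩
              sumL gs (λ Q → sumL gs (pairs Q) + sumL gs (conf Q)) ≡⟨ sumL-+ gs _ _ ⟩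
              sumL gs (λ Q → sumL gs (pairs Q)) + Y ≡⟨ cong (_+ Y) (sym I-eq) ⟩
              I + Y ∎
              where open ≤-Reasoning

            -- For fixed `s` the color to be met is fixed, so `col-list` leaves at most `N / C`
            -- vertices `s′`. The groups being disjoint, both sums may be extended to all vertices.
            Y-small : C * Y ≤ N * N
            Y-small = begin
              C * Y ≡⟨ cong (C *_) (trans (sumL-cong gs (λ Q → sumL-swap gs Q _)) (trans (sym (sumL-concat gs _)) (sumL-cong S₀ (λ s → sym (sumL-concat gs _))))) ⟩
              C * sumL S₀ (λ s → sumL S₀ (λ s′ → ind (same? s s′))) ≤⟨ *-monoʳ-≤ C (≤-trans (sumL-mono S₀ (λ s → sumL-⊆ S₀ ugs _)) (sumL-⊆ S₀ ugs _)) ⟩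
              C * sumL vs (λ s → sumL vs (λ s′ → ind (same? s s′))) ≡⟨ sym (sumL-* vs C _) ⟩
              sumL vs (λ s → C * sumL vs (λ s′ → ind (same? s s′)))
                ≤⟨ sumL-mono vs (λ s → ≤-trans (*-monoʳ-≤ C (count-mono vs (same? s) _ (λ s′ → proj₂))) (col-list (col (s ∷ u)) uu lu)) ⟩
              sumL vs (λ _ → N) ≡⟨ sumL-const vs N ⟩
              N * N ∎
              where open ≤-Reasoning

          -- There are at least `N * N / κ` pairs of good groups, and since `2 * κ ≤ C` the
          -- coincidences use up at most half of that number.
          compatible-pairs : N * N ≤ 2 * κ * sumL X (λ σ → sumL X (λ σ′ → ind (OK? u σ σ′)))
          compatible-pairs = +-cancelʳ-≤ (N * N) _ _ (begin
            N * N + N * N ≡⟨ cong (N * N +_) (sym (+-identityʳ _)) ⟩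
            2 * (N * N) ≤⟨ *-monoʳ-≤ 2 (*-mono-≤ G-big G-big) ⟩
            2 * ((2 * q * h * G) * (2 * q * h * G)) ≡⟨ r₁ (2 * q * h) G ⟩
            2 * κ * (G * G) ≤⟨ *-monoʳ-≤ (2 * κ) GG ⟩
            2 * κ * (I + Y) ≡⟨ *-distribˡ-+ (2 * κ) I Y ⟩
            2 * κ * I + 2 * κ * Y ≤⟨ +-monoʳ-≤ (2 * κ * I) (≤-trans (*-monoˡ-≤ Y 2κ≤C) Y-small) ⟩
            2 * κ * I + N * N ∎)
            where
            open ≤-Reasoning
            r₁ : ∀ a G → 2 * ((a * G) * (a * G)) ≡ 2 * (a * a) * (G * G)
            r₁ = solve-∀

        module _ (rest : List V) (cov : ∀ v → v ∈ S₀ ++ rest) (small : 2 * q * length rest ≤ N) (2κ≤C : 2 * κ ≤ C) (0<N : 0 < N)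
                 (U : List V) (uU : Unique U) (e : ℕ) (eU : N ≤ e * length U) (erN : 2 * e * r ≤ N) where
          private
            ΩU : List V → Set
            ΩU w = Unique w × All (_∈ U) w

            ΩU? : ∀ w → Dec (ΩU w)
            ΩU? w = Unique? w ×-dec All.all? (_∈? U) w

            U-step : ∀ w → length w < r → ΩU w → N ≤ 2 * e * count vs (λ v → ΩU? (v ∷ w))
            U-step w lt (uw , aw) = +-cancelʳ-≤ N _ _ (begin
              N + N ≡⟨ cong (N +_) (sym (+-identityʳ N)) ⟩
              2 * N ≤⟨ *-monoʳ-≤ 2 eU ⟩
              2 * (e * length U) ≡⟨ sym (*-assoc 2 e _) ⟩
              2 * e * length U ≤⟨ *-monoʳ-≤ (2 * e) avail ⟩
              2 * e * (c + length w) ≡⟨ *-distribˡ-+ (2 * e) c _ ⟩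
              2 * e * c + 2 * e * length w ≤⟨ +-monoʳ-≤ (2 * e * c) (≤-trans (*-monoʳ-≤ (2 * e) (<⇒≤ lt)) erN) ⟩
              2 * e * c + N ∎)
              where
              open ≤-Reasoning
              c = count vs (λ v → ΩU? (v ∷ w))
              avail : length U ≤ c + length w
              avail = begin
                length U ≡⟨ length-as-sum U ⟩
                sumL U (λ _ → 1) ≤⟨ sumL-mono∈ U (λ v v∈ → pt v v∈ (v ∈? w)) ⟩
                sumL U (λ v → ind (ΩU? (v ∷ w)) + ind (v ∈? w)) ≤⟨ sumL-⊆ U uU _ ⟩
                sumL vs (λ v → ind (ΩU? (v ∷ w)) + ind (v ∈? w)) ≡⟨ sumL-+ vs _ _ ⟩
                c + count vs (_∈? w) ≤⟨ +-monoʳ-≤ c (count-∈ w) ⟩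
                c + length w ∎
                where
                pt : ∀ v → v ∈ U → (d : Dec (v ∈ w)) → 1 ≤ ind (ΩU? (v ∷ w)) + ind d
                pt v v∈ (yes _) = m≤n+m 1 _
                pt v v∈ (no v∉) = ≤-trans (≤-reflexive (sym (ind-yes (ΩU? (v ∷ w)) (∉⇒All≢ v∉ ∷ uw , v∈ ∷ aw)))) (m≤m+n _ _)

          Base : Vec V h → Vec V h → Vec V r → Set
          Base σ σ′ u = (Unique (toList u) × All (_∈ U) (toList u)) × OK (toList u) σ σ′

          Base? : ∀ σ σ′ u → Dec (Base σ σ′ u)
          Base? σ σ′ u = ΩU? (toList u) ×-dec OK? (toList u) σ σ′

          private
            cnt : Vec V h → Vec V h → ℕ
            cnt σ σ′ = count (vecs vs r) (Base? σ σ′)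
            c₁ : ℕ
            c₁ = (2 * e) ^ r * (2 * κ)
            Mh : ℕ
            Mh = (h + h) ^ h

            total : N ^ r * (N * N) ≤ c₁ * sumL X (λ σ → sumL X (cnt σ))
            total = begin
              N ^ r * (N * N) ≤⟨ nest (vecs vs r) (λ u → ΩU? (toList u)) (λ u → sumL X (λ σ → sumL X (λ σ′ → ind (Base? σ σ′ u)))) (N ^ r) (N * N) ((2 * e) ^ r) (2 * κ)
                   (greedy-cons vs ΩU? (2 * e) r U-step ([] , []))
                   (λ u Ωu → ≤-trans (compatible-pairs rest cov small 2κ≤C (toList u) (proj₁ Ωu) (VecP.length-toList u))
                      (*-monoʳ-≤ (2 * κ) (sumL-mono X (λ σ → sumL-mono X (λ σ′ → ind-mono (OK? (toList u) σ σ′) (Base? σ σ′ u) (Ωu ,_)))))) ⟩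
              c₁ * sumL (vecs vs r) (λ u → sumL X (λ σ → sumL X (λ σ′ → ind (Base? σ σ′ u))))
                ≡⟨ cong (c₁ *_) (trans (sumL-swap (vecs vs r) X _) (sumL-cong X (λ σ → sumL-swap (vecs vs r) X _))) ⟩
              c₁ * sumL X (λ σ → sumL X (cnt σ)) ∎
              where open ≤-Reasoning

            X-pos : 0 < length X
            X-pos = n≢0⇒n>0 λ z → <⇒≱ (*-mono-≤ (m^n>0 N ⦃ >-nonZero 0<N ⦄ r) (*-mono-≤ 0<N 0<N))
              (≤-trans total (≤-reflexive (trans (cong (c₁ *_) (empty X z)) (*-zeroʳ c₁))))
              where
              empty : ∀ {A : Set} (xs : List A) {f : A → ℕ} → length xs ≡ 0 → sumL xs f ≡ 0
              empty [] z = refl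

            averaged : sumL X (λ _ → sumL X (λ _ → N ^ r)) ≤ sumL X (λ σ → sumL X (λ σ′ → c₁ * (Mh * Mh) * cnt σ σ′))
            averaged = begin
              sumL X (λ _ → sumL X (λ _ → N ^ r)) ≡⟨ trans (sumL-const X _) (cong (length X *_) (sumL-const X _)) ⟩
              length X * (length X * N ^ r) ≤⟨ *-mono-≤ length-X-≤ (*-monoˡ-≤ (N ^ r) length-X-≤) ⟩
              N * Mh * (N * Mh * N ^ r) ≡⟨ r₁ N Mh (N ^ r) ⟩
              Mh * Mh * (N ^ r * (N * N)) ≤⟨ *-monoʳ-≤ (Mh * Mh) total ⟩
              Mh * Mh * (c₁ * sumL X (λ σ → sumL X (cnt σ))) ≡⟨ r₂ (Mh * Mh) c₁ _ ⟩
              c₁ * (Mh * Mh) * sumL X (λ σ → sumL X (cnt σ)) ≡⟨ sym (trans (sumL-cong X (λ σ → sumL-* X (c₁ * (Mh * Mh)) (cnt σ))) (sumL-* X (c₁ * (Mh * Mh)) _)) ⟩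
              sumL X (λ σ → sumL X (λ σ′ → c₁ * (Mh * Mh) * cnt σ σ′)) ∎
              where
              open ≤-Reasoning
              r₁ : ∀ n m p → n * m * (n * m * p) ≡ m * m * (p * (n * n))
              r₁ = solve-∀
              r₂ : ∀ a b c → a * (b * c) ≡ b * a * c
              r₂ = solve-∀

          -- Double counting of triples `(u, σ, σ′)`: most of the freedom is in `u`, because there
          -- are only about `N * N` pairs of tuples, so some pair is compatible with a positive
          -- share of all `u`.
          popular-pair : ∃ λ σ → ∃ λ σ′ → σ ∈ X × σ′ ∈ X × N ^ r ≤ c₁ * (Mh * Mh) * count (vecs vs r) (Base? σ σ′)
          popular-pair =
            let σ , σ∈ , le = sumL-∃≤ X X-pos averaged
                σ′ , σ′∈ , le′ = sumL-∃≤ X X-pos le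
            in σ , σ′ , σ∈ , σ′∈ , le′

    -- Weaving a long path from two tuples

    alt : {A : Set} (h : ℕ) → (Fin h → A) → (Fin h → A) → Fin (double h) → A
    alt (suc h) f g zero = f zero
    alt (suc h) f g (suc zero) = g zero
    alt (suc h) f g (suc (suc j)) = alt h (f ∘ suc) (g ∘ suc) j

    alt-case : {A : Set} (h : ℕ) (f g : Fin h → A) (j : Fin (double h)) → (∃ λ p → alt h f g j ≡ f p) ⊎ (∃ λ p → alt h f g j ≡ g p)
    alt-case (suc h) f g zero = inj₁ (zero , refl)
    alt-case (suc h) f g (suc zero) = inj₂ (zero , refl)
    alt-case (suc h) f g (suc (suc j)) with alt-case h (f ∘ suc) (g ∘ suc) j
    ... | inj₁ (p , e) = inj₁ (suc p , e)
    ... | inj₂ (p , e) = inj₂ (suc p , e)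

    alt-adj : {A : Set} (R : A → A → Set) (h : ℕ) (f g : Fin h → A) → (∀ p p′ → R (f p) (g p′)) → (∀ p p′ → R (g p) (f p′)) →
      ∀ (l l′ : Fin (double h)) → toℕ l′ ≡ suc (toℕ l) → R (alt h f g l) (alt h f g l′)
    alt-adj R (suc h) f g fg gf zero (suc zero) eq = fg zero zero
    alt-adj R (suc (suc h)) f g fg gf (suc zero) (suc (suc zero)) eq = gf zero (suc zero)
    alt-adj R (suc h) f g fg gf (suc (suc l)) (suc (suc l′)) eq =
      alt-adj R h (f ∘ suc) (g ∘ suc) (λ p p′ → fg (suc p) (suc p′)) (λ p p′ → gf (suc p) (suc p′)) l l′ (suc-injective (suc-injective eq))

    alt-injective : {A : Set} (h : ℕ) (f g : Fin h → A) → (∀ p p′ → f p ≡ f p′ → p ≡ p′) → (∀ p p′ → g p ≡ g p′ → p ≡ p′) → (∀ p p′ → f p ≢ g p′) →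
      ∀ l l′ → alt h f g l ≡ alt h f g l′ → l ≡ l′
    alt-injective (suc h) f g fi gi fg zero zero eq = refl
    alt-injective (suc h) f g fi gi fg zero (suc zero) eq = contradiction eq (fg zero zero)
    alt-injective (suc h) f g fi gi fg zero (suc (suc l)) eq with alt-case h (f ∘ suc) (g ∘ suc) l
    ... | inj₁ (p , e) = case fi zero (suc p) (trans eq e) of λ ()
    ... | inj₂ (p , e) = contradiction (trans eq e) (fg zero (suc p))
    alt-injective (suc h) f g fi gi fg (suc zero) zero eq = contradiction (sym eq) (fg zero zero)
    alt-injective (suc h) f g fi gi fg (suc zero) (suc zero) eq = refl
    alt-injective (suc h) f g fi gi fg (suc zero) (suc (suc l)) eq with alt-case h (f ∘ suc) (g ∘ suc) l
    ... | inj₁ (p , e) = contradiction (sym (trans eq e)) (fg (suc p) zero)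
    ... | inj₂ (p , e) = case gi zero (suc p) (trans eq e) of λ ()
    alt-injective (suc h) f g fi gi fg (suc (suc l)) zero eq with alt-case h (f ∘ suc) (g ∘ suc) l
    ... | inj₁ (p , e) = case fi zero (suc p) (trans (sym eq) e) of λ ()
    ... | inj₂ (p , e) = contradiction (trans (sym eq) e) (fg zero (suc p))
    alt-injective (suc h) f g fi gi fg (suc (suc l)) (suc zero) eq with alt-case h (f ∘ suc) (g ∘ suc) l
    ... | inj₁ (p , e) = contradiction (sym (trans (sym eq) e)) (fg (suc p) zero)
    ... | inj₂ (p , e) = case gi zero (suc p) (trans (sym eq) e) of λ ()
    alt-injective (suc h) f g fi gi fg (suc (suc l)) (suc (suc l′)) eq =
      cong (λ i → suc (suc i)) (alt-injective h (f ∘ suc) (g ∘ suc) (λ p p′ e → FinP.suc-injective (fi (suc p) (suc p′) e))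
        (λ p p′ e → FinP.suc-injective (gi (suc p) (suc p′) e)) (λ p p′ → fg (suc p) (suc p′)) l l′ eq)

    toList-tabulate : ∀ {A : Set} {m} (f : Fin m → A) → toList (Vec.tabulate f) ≡ List.tabulate f
    toList-tabulate {m = zero} f = refl
    toList-tabulate {m = suc m} f = cong (f zero ∷_) (toList-tabulate (f ∘ suc))

    drop-past : {A : Set} (X : List A) (m : ℕ) (Y : List A) → drop (length X + m) (X ++ Y) ≡ drop m Y
    drop-past [] m Y = refl
    drop-past (x ∷ X) m Y = drop-past X m Y

    no-const-in : {A B : Set} (m : ℕ) (ps : List B) {Z R : List (A ⊎ B)} {b : A} → m < length ps → drop m (map inj₂ ps ++ Z) ≢ inj₁ b ∷ R
    no-const-in zero (p ∷ ps) lt ()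
    no-const-in (suc m) (p ∷ ps) lt eq = no-const-in m ps (s≤s⁻¹ lt) eq

    -- Separators stand at multiples of `k = r + 1`, while the extremes of two overlapping windows
    -- are at most `2r` positions apart. So both can be constants only for consecutive separators,
    -- at `j = 0`, where the two windows share a whole block; this is the case covered by the
    -- hypothesis on colors.
    ConstOK-walk : ∀ {D} (τ : Vec V D) (m : ℕ) (bl : Fin (suc m) → List (Fin D)) (s : Fin m → V) → (∀ i → length (bl i) ≡ r) →
      (∀ l l′ → toℕ l′ ≡ suc (toℕ l) → col (s l ∷ map (lookup τ) (bl (suc l))) ≢ col (s l′ ∷ map (lookup τ) (bl (suc l)))) →
      ConstOK τ (walkOf m (map inj₂ ∘ bl) (inj₁ ∘ s))
    ConstOK-walk τ zero bl s len nc = subst (ConstOK τ) (ListP.++-identityʳ (map inj₂ (bl zero))) (ConstOK-vars τ (bl zero) [] tt)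
    ConstOK-walk {D} τ (suc m) bl s len nc = ConstOK-vars τ (bl zero) _
      (head m bl s len nc , ConstOK-walk τ m (bl ∘ suc) (s ∘ suc) (len ∘ suc) (λ l l′ e → nc (suc l) (suc l′) (cong suc e)))
      where
      head : ∀ m (bl : Fin (suc (suc m)) → List (Fin D)) (s : Fin (suc m) → V) → (∀ i → length (bl i) ≡ r) →
        (∀ l l′ → toℕ l′ ≡ suc (toℕ l) → col (s l ∷ map (lookup τ) (bl (suc l))) ≢ col (s l′ ∷ map (lookup τ) (bl (suc l)))) →
        ∀ j → j < r → ∀ b R → drop (r + j) (walkOf m (λ i → map inj₂ (bl (suc i))) (λ l → inj₁ (s (suc l)))) ≡ inj₁ b ∷ R →
        NoConflict (evs τ (inj₁ (s zero) ∷ walkOf m (λ i → map inj₂ (bl (suc i))) (λ l → inj₁ (s (suc l))))) j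
      head zero bl s len nc j j<r b R eq = contradiction eq (no-const (r + j) (bl (suc zero)))
      head (suc m) bl s len nc j j<r b R eq = go j j<r (trans (sym dropped) eq)
        where
        B = bl (suc zero)
        rest : List (Term D)
        rest = walkOf m (λ i → map inj₂ (bl (suc (suc i)))) (λ l → inj₁ (s (suc (suc l))))
        lenB : length (map inj₂ B) ≡ r
        lenB = trans (ListP.length-map inj₂ B) (len (suc zero))
        dropped : ∀ {j} → drop (r + j) (map inj₂ B ++ inj₁ (s (suc zero)) ∷ rest) ≡ drop j (inj₁ (s (suc zero)) ∷ rest)
        dropped {j} = trans (cong (λ a → drop (a + j) (map inj₂ B ++ inj₁ (s (suc zero)) ∷ rest)) (sym lenB)) (drop-past (map inj₂ B) j _)
        B̂ = map (lookup τ) B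
        lenB̂ : length B̂ ≡ r
        lenB̂ = trans (ListP.length-map (lookup τ) B) (len (suc zero))
        whole : evs τ (map inj₂ B ++ inj₁ (s (suc zero)) ∷ rest) ≡ B̂ ++ s (suc zero) ∷ evs τ rest
        whole = trans (ListP.map-++ (ev τ) (map inj₂ B) _) (cong (_++ s (suc zero) ∷ evs τ rest) (evs-vars τ B))
        take-r : ∀ (Y : List V) → take r (B̂ ++ Y) ≡ B̂
        take-r Y = trans (take-++-≤ r B̂ Y (≤-reflexive (sym lenB̂))) (ListP.take-all r B̂ (≤-reflexive lenB̂))
        take-k : ∀ x (Y : List V) → take k (B̂ ++ x ∷ Y) ≡ B̂ ∷ʳ x
        take-k x Y = trans (cong (λ a → take a (B̂ ++ x ∷ Y)) (trans (cong suc (sym lenB̂)) (sym (+-comm (length B̂) 1)))) (take-mid B̂ 1 (x ∷ Y))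
        go : ∀ j → j < r → drop j (inj₁ (s (suc zero)) ∷ rest) ≡ inj₁ b ∷ R →
          NoConflict (evs τ (inj₁ (s zero) ∷ map inj₂ B ++ inj₁ (s (suc zero)) ∷ rest)) j
        go zero j<r eq _ eqc = nc zero (suc zero) refl (trans (sym (cong (λ l → col (s zero ∷ l)) (trans (cong (take r) whole) (take-r _))))
          (trans eqc (trans (cong col (trans (cong (take k) whole) (take-k (s (suc zero)) (evs τ rest)))) (cong φ (set-↭ (↭-sym (PermP.∷↭∷ʳ (s (suc zero)) B̂)))))))
        go (suc j) j<r eq = contradiction (trans (cong (drop j) (proj₂ hd)) eq)
            (no-const-in j (bl (suc (suc zero))) (≤-trans (≤-trans (n≤1+n _) j<r) (≤-reflexive (sym (len (suc (suc zero)))))))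
          where
          hd : ∃ λ rst → map inj₂ (bl (suc (suc zero))) ++ rst ≡ rest
          hd = let a , e = walkOf-head m (λ i → map inj₂ (bl (suc (suc i)))) (λ l → inj₁ (s (suc (suc l)))) in a , sym e

    module TilePath (h : ℕ) (σ σ′ : Vec V h) {Base : Vec V r → Set} (Base? : ∀ u → Dec (Base u)) (U : List V)
        (inU : ∀ u → Base u → All (_∈ U) (toList u))
        (ok : ∀ u → Base u → Compatible.OK h (toList u) σ σ′)
        (β : ℕ) (dense : N ^ r ≤ β * count (vecs vs r) Base?) (0<N : 0 < N) where

      M D θ β₁ : ℕ
      M = double h
      D = r * suc M
      β₁ = blowConst (suc M) r β
      θ = 2 * β₁ * (D + D * D + (r + M * suc r) * r)

      cd : Fin (suc M) → Fin r → Fin D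
      cd i l = combine l i

      blP : Fin (suc M) → List (Fin D)
      blP i = List.tabulate (cd i)

      -- Consecutive separators share a block, so only their choice from different
      -- tuples σ and σ′ can keep the two windows around that block apart in color.
      sep : Fin M → V
      sep = alt h (lookup σ) (lookup σ′)

      W : List (Term D)
      W = walkOf M (map inj₂ ∘ blP) (inj₁ ∘ sep)

      W-length : length W ≡ r + M * suc r
      W-length = length-walkOf r M (map inj₂ ∘ blP) (inj₁ ∘ sep) (λ i → trans (ListP.length-map inj₂ (blP i)) (ListP.length-tabulate (cd i)))

      B : List V
      B = toList σ ++ toList σ′

      sep∈ : ∀ l → sep l ∈ B
      sep∈ l with alt-case h (lookup σ) (lookup σ′) l
      ... | inj₁ (p , e) = subst (_∈ B) (sym e) (MemP.∈-++⁺ˡ (lookup-toList σ p))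
      ... | inj₂ (p , e) = subst (_∈ B) (sym e) (MemP.∈-++⁺ʳ (toList σ) (lookup-toList σ′ p))

      module _ (τ : Vec V D) (sel : AllSel (suc M) r Base τ) where

        pick : (c : Fin r → Fin (suc M)) → Base (Vec.tabulate (λ l → lookup τ (cd (c l) l)))
        pick = AllSel-pick (suc M) r {Base} τ sel

        okAt : (c : Fin r → Fin (suc M)) → Compatible.OK h (List.tabulate (λ l → lookup τ (cd (c l) l))) σ σ′
        okAt c = subst (λ u → Compatible.OK h u σ σ′) (toList-tabulate (λ l → lookup τ (cd (c l) l))) (ok _ (pick c))

        edgeAt : ∀ c j → Edge (sep j ∷ List.tabulate (λ l → lookup τ (cd (c l) l)))
        edgeAt c j with alt-case h (lookup σ) (lookup σ′) j
        ... | inj₁ (p , e) = subst (λ s → Edge (s ∷ List.tabulate (λ l → lookup τ (cd (c l) l)))) (sym e) (proj₁ (proj₁ (okAt c)) p)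
        ... | inj₂ (p , e) = subst (λ s → Edge (s ∷ List.tabulate (λ l → lookup τ (cd (c l) l)))) (sym e) (proj₁ (proj₁ (proj₂ (okAt c))) p)

        bl̂ : Fin (suc M) → List V
        bl̂ i = map (lookup τ) (blP i)

        bl̂-eq : ∀ i → bl̂ i ≡ List.tabulate (λ l → lookup τ (cd i l))
        bl̂-eq i = ListP.map-tabulate (cd i) (lookup τ)

        evsW : evs τ W ≡ walkOf M (evs τ ∘ map inj₂ ∘ blP) sep
        evsW = map-walkOf (ev τ) M (map inj₂ ∘ blP) (inj₁ ∘ sep)

        -- A window mixes two consecutive blocks, that is, it uses one copy of each variable. By
        -- `AllSel` every such mixture satisfies `Base`, hence forms an edge with every separator.
        path-GE : GE (evs τ W)
        path-GE = subst GE (sym evsW) (walkOf-GE M (evs τ ∘ map inj₂ ∘ blP) sep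
          (λ i → trans (ListP.length-map (ev τ) (map inj₂ (blP i))) (trans (ListP.length-map inj₂ (blP i)) (ListP.length-tabulate (cd i))))
          (λ l → subst₂ (λ b b′ → LinkE b (sep l) b′) (sym (trans (evs-vars τ (blP (Fin.inject₁ l))) (bl̂-eq (Fin.inject₁ l)))) (sym (trans (evs-vars τ (blP (suc l))) (bl̂-eq (suc l))))
            (LinkE-tabulate (lookup τ ∘ cd (Fin.inject₁ l)) (lookup τ ∘ cd (suc l)) (sep l) (edge l))))
          where
          edge : ∀ l j → j ≤ r → Edge (sep l ∷ List.tabulate (λ l′ → if toℕ l′ <ᵇ j then lookup τ (cd (suc l) l′) else lookup τ (cd (Fin.inject₁ l) l′)))
          edge l j _ = subst (λ w → Edge (sep l ∷ w)) (ListP.tabulate-cong pt) (edgeAt (λ l′ → if toℕ l′ <ᵇ j then suc l else Fin.inject₁ l) l)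
            where
            pt : ∀ l′ → lookup τ (cd (if toℕ l′ <ᵇ j then suc l else Fin.inject₁ l) l′) ≡ (if toℕ l′ <ᵇ j then lookup τ (cd (suc l) l′) else lookup τ (cd (Fin.inject₁ l) l′))
            pt l′ with toℕ l′ <ᵇ j
            ... | true = refl
            ... | false = refl

        path-ConstOK : ConstOK τ W
        path-ConstOK = ConstOK-walk τ M blP sep (λ i → ListP.length-tabulate (cd i))
          (λ l l′ e → subst (λ b → col (sep l ∷ b) ≢ col (sep l′ ∷ b)) (sym (bl̂-eq (suc l)))
            (alt-adj (λ s s′ → col (s ∷ T (suc l)) ≢ col (s′ ∷ T (suc l))) h (lookup σ) (lookup σ′)
              (λ p p′ → diff (suc l) p p′) (λ p p′ e → diff (suc l) p′ p (sym e)) l l′ e))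
          where
          T : Fin (suc M) → List V
          T i = List.tabulate (λ l → lookup τ (cd i l))
          diff : ∀ i p p′ → col (lookup σ p ∷ T i) ≢ col (lookup σ′ p′ ∷ T i)
          diff i = proj₂ (proj₂ (okAt (λ _ → i)))

        -- A common vertex would give the same window twice, hence equal colors, which `OK` forbids.
        disjoint : ∀ p p′ → lookup σ p ≢ lookup σ′ p′
        disjoint p p′ e = proj₂ (proj₂ (okAt (λ _ → zero))) p p′ (cong (λ s → col (s ∷ List.tabulate (λ l → lookup τ (cd zero l)))) e)

        Unique-W : Unique W
        Unique-W = Unique-walkOf M (map inj₂ ∘ blP) (inj₁ ∘ sep)
          (λ i → UniP.map⁺ (λ { refl → refl }) (UniP.tabulate⁺ {f = cd i} (λ {l} {l′} e → FinP.combine-injectiveˡ l i l′ i e)))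
          dis (λ i l m → case MemP.∈-map⁻ inj₂ {xs = blP i} m of λ { (_ , _ , ()) })
          (λ l l′ e → alt-injective h (lookup σ) (lookup σ′) (lookup-injective σ (proj₂ (proj₁ (okAt (λ _ → zero)))))
            (lookup-injective σ′ (proj₂ (proj₁ (proj₂ (okAt (λ _ → zero)))))) disjoint l l′ (inj₁-inj e))
          where
          inj₁-inj : ∀ {a b : V} → _≡_ {A = Term D} (inj₁ a) (inj₁ b) → a ≡ b
          inj₁-inj refl = refl
          dis : ∀ i i′ {x} → x ∈ map inj₂ (blP i) → x ∈ map inj₂ (blP i′) → i ≡ i′
          dis i i′ {x} m m′ = go (member i m) (member i′ m′)
            where
            member : ∀ i {x} → x ∈ map inj₂ (blP i) → ∃ λ (l : Fin r) → x ≡ inj₂ (cd i l)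
            member i m =
              let p , p∈ , e = MemP.∈-map⁻ inj₂ {xs = blP i} m
                  l , e′ = MemP.∈-tabulate⁻ {n = r} {f = cd i} p∈
              in l , trans e (cong inj₂ e′)
            inj₂-inj : ∀ {a b : Fin D} → _≡_ {A = Term D} (inj₂ a) (inj₂ b) → a ≡ b
            inj₂-inj refl = refl
            go : (∃ λ (l : Fin r) → x ≡ inj₂ (cd i l)) → (∃ λ (l : Fin r) → x ≡ inj₂ (cd i′ l)) → i ≡ i′
            go (l , e) (l′ , e′) = FinP.combine-injectiveʳ l i l′ i′ (inj₂-inj (trans (sym e) e′))

        path-within : ∀ {v} → v ∈ evs τ W → v ∈ U ⊎ v ∈ B
        path-within {v} m with ∈-walkOf M (evs τ ∘ map inj₂ ∘ blP) sep (subst (v ∈_) evsW m)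
        ... | inj₂ (l , refl) = inj₂ (sep∈ l)
        ... | inj₁ (i , v∈) = inj₁ (All.lookup (inU _ (pick (λ _ → i))) (subst (v ∈_) (trans (evs-vars τ (blP i)) (trans (bl̂-eq i) (sym (toList-tabulate (λ l → lookup τ (cd i l)))))) v∈))

      module _ (θ≤C : θ ≤ C) (0<θ : 0 < θ) (θB : θ * suc (h + h) ≤ N) where
        private
          |B| : length B ≡ h + h
          |B| = trans (ListP.length-++ (toList σ)) (cong₂ _+_ (VecP.length-toList σ) (VecP.length-toList σ′))
          open Events D θ θ≤C B (≤-trans (≤-reflexive (cong (λ m → θ * suc m) |B|)) θB)
          es : List Ev
          es = coordEvents ++ colEvents W
          few : 2 * β₁ * length es ≤ θ
          few = *-monoʳ-≤ (2 * β₁) (≤-trans (≤-reflexive (ListP.length-++ coordEvents))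
            (+-mono-≤ length-coordEvents (≤-trans (length-colEvents W) (≤-reflexive (cong (_* r) W-length)))))
          P? : ∀ τ → Dec (AllSel (suc M) r Base τ × None vs 0<N es τ)
          P? τ = AllSel? (suc M) r Base? τ ×-dec None? vs 0<N es τ
          exists : ∃ λ τ → τ ∈ vecs vs D × AllSel (suc M) r Base τ × None vs 0<N es τ
          exists = count-∃ (vecs vs D) P? (n≢0⇒n>0 λ z → <⇒≱ (m^n>0 N ⦃ >-nonZero 0<N ⦄ D)
            (≤-trans (clean vs 0<N (AllSel? (suc M) r Base?) es β₁ 0<θ few (blow-up (suc M) vs 0<N r β Base? dense))
              (≤-reflexive (trans (cong (2 * β₁ *_) z) (*-zeroʳ (2 * β₁))))))

        long-path : ∃ λ p → length p ≡ r + M * suc r × Good p × Unique p × (∀ {v} → v ∈ p → v ∈ U ⊎ v ∈ B)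
        long-path = finish exists
          where
          finish : (∃ λ τ → τ ∈ vecs vs D × AllSel (suc M) r Base τ × None vs 0<N es τ) →
            ∃ λ p → length p ≡ r + M * suc r × Good p × Unique p × (∀ {v} → v ∈ p → v ∈ U ⊎ v ∈ B)
          finish (τ , _ , sel , none) = evs τ W , trans (ListP.length-map (ev τ) W) W-length
            , (path-GE τ sel , none-GC τ W (AllP.++⁻ʳ coordEvents none) uW (path-GE τ sel) (path-ConstOK τ sel)) , uW , path-within τ sel
            where
            consts : ∀ a → inj₁ a ∈ W → a ∈ B
            consts a m with ∈-walkOf M (map inj₂ ∘ blP) (inj₁ ∘ sep) m
            ... | inj₁ (i , m′) = case MemP.∈-map⁻ inj₂ {xs = blP i} m′ of λ { (_ , _ , ()) }
            ... | inj₂ (l , refl) = sep∈ l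
            uW : Unique (evs τ W)
            uW = evs-Unique W (none-Avoids τ (AllP.++⁻ˡ coordEvents none)) (Unique-W τ sel) consts

    -- Augmenting a tiling

    ∈-toList⁻ : ∀ {m} (u : Vec V m) {v} → v ∈ toList u → ∃ λ p → lookup u p ≡ v
    ∈-toList⁻ (x ∷ u) (here refl) = zero , refl
    ∈-toList⁻ (x ∷ u) (there m) = let p , e = ∈-toList⁻ u m in suc p , e

    ∈-concat-filter : {P : List V → Set} (P? : ∀ l → Dec (P l)) (L : List (List V)) {v : V} → v ∈ concat (filter P? L) → ∃ λ l → l ∈ L × P l × v ∈ l
    ∈-concat-filter P? L m with MemP.∈-concat⁻′ (filter P? L) m
    ... | l , v∈ , l∈ = l , proj₁ (MemP.∈-filter⁻ P? {xs = L} l∈) , proj₂ (MemP.∈-filter⁻ P? {xs = L} l∈) , v∈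

    Unique-concat-filter : {P : List V → Set} (P? : ∀ l → Dec (P l)) (L : List (List V)) → Unique (concat L) → Unique (concat (filter P? L))
    Unique-concat-filter P? [] u = []
    Unique-concat-filter P? (l ∷ L) u with P? l
    ... | no _ = Unique-concat-filter P? L (proj₁ (proj₂ (Unique-++⁻ l u)))
    ... | yes _ = UniP.++⁺ (proj₁ (Unique-++⁻ l u)) (Unique-concat-filter P? L (proj₁ (proj₂ (Unique-++⁻ l u))))
        (λ { (m₁ , m₂) → let l′ , l′∈ , _ , v∈ = ∈-concat-filter P? L m₂ in proj₂ (proj₂ (Unique-++⁻ l u)) m₁ (MemP.∈-concat⁺′ v∈ l′∈) })

    hits-own : ∀ (L : List (List V)) Q → Unique (concat L) → Q ∈ L → count L (Hits? Q) ≤ 1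
    hits-own (l ∷ L) Q u (here refl) = ≤-trans (+-monoʳ-≤ (ind (Hits? Q l)) (≤-reflexive (zero′ L (λ v∈ m → proj₂ (proj₂ (Unique-++⁻ l u)) m v∈)))) (≤-trans (≤-reflexive (+-identityʳ _)) (ind≤1 (Hits? Q l)))
      where
      zero′ : ∀ L → (∀ {v} → v ∈ concat L → v ∉ Q) → count L (Hits? Q) ≡ 0
      zero′ [] h = refl
      zero′ (l ∷ L) h with Hits? Q l
      ... | yes a = let v , v∈l , v∈Q = find a in contradiction v∈Q (h (MemP.∈-++⁺ˡ v∈l))
      ... | no _ = zero′ L (h ∘ MemP.∈-++⁺ʳ l)
    hits-own (l ∷ L) Q u (there Q∈) with Hits? Q l
    ... | no _ = hits-own L Q (proj₁ (proj₂ (Unique-++⁻ l u))) Q∈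
    ... | yes a = let v , v∈l , v∈Q = find a in ⊥-elim (proj₂ (proj₂ (Unique-++⁻ l u)) v∈l (MemP.∈-concat⁺′ v∈Q Q∈))

    Good-chunks : ∀ M p l → Good l → All Good (chunks M p l)
    Good-chunks M zero l g = []
    Good-chunks M (suc p) l g = Good-prefix (take M l) (drop M l) g′ ∷ Good-chunks M p (drop M l) (Good-suffix (take M l) (drop M l) g′)
      where g′ = subst Good (sym (ListP.take++drop≡id M l)) g

    module Tiling (h e : ℕ) (1≤h : 1 ≤ h) (Z : List V) (0<N : 0 < N) (Z-small : 2 * q * (length Z + double h) ≤ N) (erN : 2 * e * r ≤ N)
        (2κ≤C : 2 * tileKappa q h ≤ C) (θ≤C : tileConst r q h e ≤ C) (0<θ : 0 < tileConst r q h e) (θN : tileConst r q h e * suc (h + h) ≤ N) where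

      M : ℕ
      M = double h

      IsTiling : List (List V) → Set
      IsTiling ts = Unique (Z ++ concat ts) × All (λ T → length T ≡ M × Good T) ts

      uncovered : List (List V) → List V
      uncovered ts = filter (λ v → ¬? (v ∈? (Z ++ concat ts))) vs

      private
        1≤M : 1 ≤ M
        1≤M = ≤-trans (≤-trans 1≤h (m≤m+n h h)) (≤-reflexive (sym (double≡ h)))

        instance
          M≢0 : NonZero M
          M≢0 = >-nonZero 1≤M

      module _ (ts : List (List V)) (uZ : Unique (Z ++ concat ts)) (tsG : All (λ T → length T ≡ M × Good T) ts) (big : N ≤ e * length (uncovered ts)) where
        private
          U : List V
          U = uncovered ts
          uU : Unique U
          uU = UniP.filter⁺ _ (UniP.allFin⁺ n)
          U∉ : ∀ {v} → v ∈ U → v ∉ Z ++ concat ts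
          U∉ m = proj₂ (MemP.∈-filter⁻ (λ v → ¬? (v ∈? (Z ++ concat ts))) {xs = vs} m)
          p : ℕ
          p = length U / M
          pM≤ : p * M ≤ length U
          pM≤ = m/n*n≤m (length U) M
          -- The uncovered vertices are cut into groups as well: a path using them then
          -- costs no tile at all, which spares a separate case.
          gs : List (List V)
          gs = ts ++ chunks M p U
          cgs : concat gs ≡ concat ts ++ take (p * M) U
          cgs = trans (sym (ListP.concat-++ ts (chunks M p U))) (cong (concat ts ++_) (concat-chunks M p U))
          rest : List V
          rest = Z ++ drop (p * M) U
          take⊆ : ∀ {v} m → v ∈ take m U → v ∈ U
          take⊆ m v∈ = subst (_ ∈_) (ListP.take++drop≡id m U) (MemP.∈-++⁺ˡ v∈)
          uts : Unique (concat ts)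
          uts = proj₁ (proj₂ (Unique-++⁻ Z uZ))
          ugs : Unique (concat gs)
          ugs = subst Unique (sym cgs) (UniP.++⁺ uts (UniP.take⁺ (p * M) uU) (λ { (m₁ , m₂) → U∉ (take⊆ (p * M) m₂) (MemP.∈-++⁺ʳ Z m₁) }))
          gsM : All (λ Q → length Q ≡ h + h) gs
          gsM = All.map (λ e → trans e (double≡ h)) (AllP.++⁺ (All.map proj₁ tsG) (chunks-length M p U pM≤))
          cov : ∀ v → v ∈ concat gs ++ rest
          cov v with v ∈? (Z ++ concat ts)
          ... | yes m = [ (λ mZ → MemP.∈-++⁺ʳ (concat gs) (MemP.∈-++⁺ˡ mZ)) , (λ mt → MemP.∈-++⁺ˡ (subst (v ∈_) (sym cgs) (MemP.∈-++⁺ˡ mt))) ]′ (MemP.∈-++⁻ Z m)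
          ... | no ¬m = [ (λ mt → MemP.∈-++⁺ˡ (subst (v ∈_) (sym cgs) (MemP.∈-++⁺ʳ (concat ts) mt))) , (λ md → MemP.∈-++⁺ʳ (concat gs) (MemP.∈-++⁺ʳ Z md)) ]′
              (MemP.∈-++⁻ (take (p * M) U) (subst (v ∈_) (sym (ListP.take++drop≡id (p * M) U)) (MemP.∈-filter⁺ (λ v → ¬? (v ∈? (Z ++ concat ts))) (MemP.∈-allFin v) ¬m)))
          small : 2 * q * length rest ≤ N
          small = ≤-trans (*-monoʳ-≤ (2 * q) (≤-trans (≤-reflexive (ListP.length-++ Z)) (+-monoʳ-≤ (length Z) (≤-trans (≤-reflexive (ListP.length-drop (p * M) U)) left)))) Z-small
            where
            left : length U ∸ p * M ≤ M
            left = ≤-trans (∸-monoˡ-≤ (p * M) (≤-reflexive (m≡m%n+[m/n]*n (length U) M))) (≤-trans (≤-reflexive (m+n∸n≡m (length U % M) (p * M))) (<⇒≤ (m%n<n (length U) M)))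

          module Cm = Compatible h
          pp : ∃ λ σ → ∃ λ σ′ → σ ∈ Cm.X gs gsM ugs 1≤h × σ′ ∈ Cm.X gs gsM ugs 1≤h ×
            N ^ r ≤ tileBeta r q h e * count (vecs vs r) (Cm.Base? gs gsM ugs 1≤h rest cov small 2κ≤C 0<N U uU e big erN σ σ′)
          pp = Cm.popular-pair gs gsM ugs 1≤h rest cov small 2κ≤C 0<N U uU e big erN

          group-of : ∀ σ → σ ∈ Cm.X gs gsM ugs 1≤h → ∃ λ Q → Q ∈ gs × (∀ {v} → v ∈ toList σ → v ∈ Q)
          group-of σ σ∈ = let Q , Q∈ , σ∈Q = find (MemP.∈-concatMap⁻ (λ Q → vecs Q h) {xs = gs} σ∈)
            in Q , Q∈ , λ m → let p , e = ∈-toList⁻ σ m in subst (_∈ Q) e (vecs-∈ Q σ σ∈Q p)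

          module _ (σ σ′ : Vec V h) (σ∈ : σ ∈ Cm.X gs gsM ugs 1≤h) (σ′∈ : σ′ ∈ Cm.X gs gsM ugs 1≤h)
                   (np : List V) (lnp : length np ≡ r + M * suc r) (gnp : Good np) (unp : Unique np)
                   (within : ∀ {v} → v ∈ np → v ∈ U ⊎ v ∈ toList σ ++ toList σ′) where

            Q Q′ : List V
            Q = proj₁ (group-of σ σ∈)
            Q′ = proj₁ (group-of σ′ σ′∈)

            gs∉Z : ∀ {v} → v ∈ concat gs → v ∉ Z
            gs∉Z {v} m mZ = [ (λ mt → proj₂ (proj₂ (Unique-++⁻ Z uZ)) mZ mt) , (λ mU → U∉ (take⊆ (p * M) mU) (MemP.∈-++⁺ˡ mZ)) ]′ (MemP.∈-++⁻ (concat ts) (subst (v ∈_) cgs m))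

            np-where : ∀ {v} → v ∈ np → v ∈ U ⊎ (v ∈ Q ⊎ v ∈ Q′)
            np-where m with within m
            ... | inj₁ mU = inj₁ mU
            ... | inj₂ mB with MemP.∈-++⁻ (toList σ) mB
            ... | inj₁ ms = inj₂ (inj₁ (proj₂ (proj₂ (group-of σ σ∈)) ms))
            ... | inj₂ ms = inj₂ (inj₂ (proj₂ (proj₂ (group-of σ′ σ′∈)) ms))

            np∉Z : ∀ {v} → v ∈ np → v ∉ Z
            np∉Z m mZ with np-where m
            ... | inj₁ mU = U∉ mU (MemP.∈-++⁺ˡ mZ)
            ... | inj₂ (inj₁ mQ) = gs∉Z (MemP.∈-concat⁺′ mQ (proj₁ (proj₂ (group-of σ σ∈)))) mZ
            ... | inj₂ (inj₂ mQ) = gs∉Z (MemP.∈-concat⁺′ mQ (proj₁ (proj₂ (group-of σ′ σ′∈)))) mZ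

            keep? : ∀ T → Dec (¬ Hits np T)
            keep? T = ¬? (Hits? np T)

            ts′ : List (List V)
            ts′ = filter keep? ts ++ chunks M 3 np

            -- Here `k ≥ 3` pays off: the path has at least `M * k` vertices and yields three tiles
            -- in place of the at most two that it destroys.
            3M≤ : 3 * M ≤ length np
            3M≤ = ≤-trans (≤-trans (*-monoˡ-≤ M (s≤s 2≤r)) (≤-reflexive (*-comm (suc r) M))) (≤-trans (m≤n+m (M * suc r) r) (≤-reflexive (sym lnp)))

            take-np : ∀ {v} → v ∈ take (3 * M) np → v ∈ np
            take-np m = subst (_ ∈_) (ListP.take++drop≡id (3 * M) np) (MemP.∈-++⁺ˡ m)

            unique′ : Unique (Z ++ concat ts′)
            unique′ = subst (λ l → Unique (Z ++ l)) (trans (cong (concat (filter keep? ts) ++_) (sym (concat-chunks M 3 np))) (ListP.concat-++ (filter keep? ts) (chunks M 3 np)))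
              (UniP.++⁺ (proj₁ (Unique-++⁻ Z uZ))
                (UniP.++⁺ (Unique-concat-filter keep? ts uts) (UniP.take⁺ (3 * M) unp)
                  (λ { (m₁ , m₂) → let T , _ , nh , v∈ = ∈-concat-filter keep? ts m₁ in nh (Any.map (λ { refl → take-np m₂ }) v∈) }))
                disZ)
              where
              disZ : ∀ {v} → v ∈ Z × v ∈ concat (filter keep? ts) ++ take (3 * M) np → ⊥
              disZ (mZ , m) with MemP.∈-++⁻ (concat (filter keep? ts)) m
              ... | inj₁ m₁ = let T , T∈ , _ , v∈ = ∈-concat-filter keep? ts m₁ in proj₂ (proj₂ (Unique-++⁻ Z uZ)) mZ (MemP.∈-concat⁺′ v∈ T∈)
              ... | inj₂ m₂ = np∉Z (take-np m₂) mZ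

            good′ : All (λ T → length T ≡ M × Good T) ts′
            good′ = AllP.++⁺ (AllP.filter⁺ keep? tsG) (All.zipWith id (chunks-length M 3 np 3M≤ , Good-chunks M 3 np gnp))

            -- Tiles contain no uncovered vertex, so the path can meet a tile only through `σ` or
            -- `σ′`; each of these lies in one group, and groups are disjoint.
            hit≤2 : count ts (Hits? np) ≤ 2
            hit≤2 = begin
              count ts (Hits? np) ≤⟨ sumL-mono∈ ts (λ T T∈ → ind-⊎ (Hits? np T) (Hits? Q T) (Hits? Q′ T) (split T T∈)) ⟩
              sumL ts (λ T → ind (Hits? Q T) + ind (Hits? Q′ T)) ≡⟨ sumL-+ ts _ _ ⟩
              count ts (Hits? Q) + count ts (Hits? Q′) ≤⟨ +-mono-≤ (one Q (proj₁ (proj₂ (group-of σ σ∈)))) (one Q′ (proj₁ (proj₂ (group-of σ′ σ′∈)))) ⟩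
              2 ∎
              where
              open ≤-Reasoning
              one : ∀ Q → Q ∈ gs → count ts (Hits? Q) ≤ 1
              one Q Q∈ = ≤-trans (≤-trans (m≤m+n _ _) (≤-reflexive (sym (sumL-++ ts (chunks M p U) _)))) (hits-own gs Q ugs Q∈)
              split : ∀ T → T ∈ ts → Hits np T → Hits Q T ⊎ Hits Q′ T
              split T T∈ hit = let v , v∈T , v∈np = find hit in decide v∈T (np-where v∈np)
                where
                decide : ∀ {v} → v ∈ T → v ∈ U ⊎ (v ∈ Q ⊎ v ∈ Q′) → Hits Q T ⊎ Hits Q′ T
                decide v∈T (inj₁ mU) = contradiction (MemP.∈-++⁺ʳ Z (MemP.∈-concat⁺′ v∈T T∈)) (U∉ mU)
                decide v∈T (inj₂ (inj₁ mQ)) = inj₁ (Any.map (λ { refl → mQ }) v∈T)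
                decide v∈T (inj₂ (inj₂ mQ)) = inj₂ (Any.map (λ { refl → mQ }) v∈T)

            more : length ts < length ts′
            more = begin-strict
              length ts ≡⟨ length-as-sum ts ⟩
              sumL ts (λ _ → 1) ≤⟨ sumL-mono ts (λ T → pt (Hits? np T)) ⟩
              sumL ts (λ T → ind (keep? T) + ind (Hits? np T)) ≡⟨ sumL-+ ts _ _ ⟩
              count ts keep? + count ts (Hits? np) ≤⟨ +-monoʳ-≤ (count ts keep?) hit≤2 ⟩
              count ts keep? + 2 <⟨ +-monoʳ-< (count ts keep?) ≤-refl ⟩
              count ts keep? + 3 ≡⟨ cong (_+ 3) (sym (count-filter ts keep?)) ⟩
              length (filter keep? ts) + 3 ≡⟨ sym (ListP.length-++ (filter keep? ts)) ⟩
              length ts′ ∎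
              where
              open ≤-Reasoning
              pt : ∀ {P : Set} (d : Dec P) → 1 ≤ ind (¬? d) + ind d
              pt (yes _) = ≤-refl
              pt (no _) = ≤-refl

        augment : ∃ λ ts′ → IsTiling ts′ × length ts < length ts′
        augment = finish pp
          where
          finish : (∃ λ σ → ∃ λ σ′ → σ ∈ Cm.X gs gsM ugs 1≤h × σ′ ∈ Cm.X gs gsM ugs 1≤h ×
            N ^ r ≤ tileBeta r q h e * count (vecs vs r) (Cm.Base? gs gsM ugs 1≤h rest cov small 2κ≤C 0<N U uU e big erN σ σ′)) →
            ∃ λ ts′ → IsTiling ts′ × length ts < length ts′
          finish (σ , σ′ , σ∈ , σ′∈ , dense) = done
            (TilePath.long-path h σ σ′ (Cm.Base? gs gsM ugs 1≤h rest cov small 2κ≤C 0<N U uU e big erN σ σ′) U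
              (λ u b → proj₂ (proj₁ b)) (λ u b → proj₂ b) (tileBeta r q h e) dense 0<N θ≤C 0<θ θN)
            where
            done : (∃ λ np → length np ≡ r + M * suc r × Good np × Unique np × (∀ {v} → v ∈ np → v ∈ U ⊎ v ∈ toList σ ++ toList σ′)) →
              ∃ λ ts′ → IsTiling ts′ × length ts < length ts′
            done (np , lnp , gnp , unp , within) = ts′ σ σ′ σ∈ σ′∈ np lnp gnp unp within
              , (unique′ σ σ′ σ∈ σ′∈ np lnp gnp unp within , good′ σ σ′ σ∈ σ′∈ np lnp gnp unp within) , more σ σ′ σ∈ σ′∈ np lnp gnp unp within

      tiles≤ : ∀ ts → IsTiling ts → length ts * M ≤ N
      tiles≤ ts (u , a) = ≤-trans (≤-reflexive (sym (length-concat-const M ts (All.map proj₁ a)))) (Unique⇒length≤ (proj₁ (proj₂ (Unique-++⁻ Z u))))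

      -- Every augmentation raises the number of tiles, which never exceeds `N`, so `suc N` rounds
      -- of fuel cannot run out.
      almost-tiling : Unique Z → ∃ λ ts → IsTiling ts × e * length (uncovered ts) < N
      almost-tiling uZ = go (suc N) [] (subst Unique (sym (ListP.++-identityʳ Z)) uZ , []) ≤-refl
        where
        go : ∀ fuel ts → IsTiling ts → N < length ts + fuel → ∃ λ ts → IsTiling ts × e * length (uncovered ts) < N
        go zero ts t lt = contradiction (≤-trans (≤-trans (≤-reflexive (sym (*-identityʳ _))) (*-monoʳ-≤ (length ts) 1≤M)) (tiles≤ ts t))
          (<⇒≱ (subst (N <_) (+-identityʳ (length ts)) lt))
        go (suc fuel) ts t lt with N ≤? e * length (uncovered ts)
        ... | no ¬big = ts , t , ≰⇒> ¬big
        ... | yes big = let ts′ , t′ , more = augment ts (proj₁ t) (proj₂ t) big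
                        in go fuel ts′ t′ (≤-trans lt (≤-trans (≤-reflexive (+-suc (length ts) fuel)) (+-monoˡ-≤ fuel more)))

    -- From a cyclic sequence to a permutation

    GC-window : ∀ l a d → GC l → 1 ≤ d → d ≤ r → a + (k + d) ≤ length l → col (take k (drop a l)) ≢ col (take k (drop (a + d) l))
    GC-window (v ∷ l) zero (suc d) (h , g) _ dr len = subst (NoConflict (v ∷ l)) (FinP.toℕ-fromℕ< dr) (h (fromℕ< dr)) len
    GC-window (v ∷ l) (suc a) d (h , g) 1≤d dr len = GC-window l a d g 1≤d dr (s≤s⁻¹ len)

    drop-lookup : (l : List V) (j : Fin (length l)) → drop (toℕ j) l ≡ List.lookup l j ∷ drop (suc (toℕ j)) l
    drop-lookup (x ∷ l) zero = refl
    drop-lookup (x ∷ l) (suc j) = drop-lookup l j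

    lookup-inj-list : (l : List V) → Unique l → ∀ i j → List.lookup l i ≡ List.lookup l j → i ≡ j
    lookup-inj-list (x ∷ l) (x# ∷ u) zero zero eq = refl
    lookup-inj-list (x ∷ l) (x# ∷ u) zero (suc j) eq = contradiction eq (All.lookup x# (MemP.∈-lookup {xs = l} j))
    lookup-inj-list (x ∷ l) (x# ∷ u) (suc i) zero eq = contradiction (sym eq) (All.lookup x# (MemP.∈-lookup {xs = l} i))
    lookup-inj-list (x ∷ l) (x# ∷ u) (suc i) (suc j) eq = cong suc (lookup-inj-list l u i j eq)

    next-cases : (i : Fin n) → toℕ (next i) ≡ suc (toℕ i) ⊎ (toℕ (next i) ≡ 0 × suc (toℕ i) ≡ n)
    next-cases = go
      where
      go : ∀ {n} (i : Fin n) → toℕ (next i) ≡ suc (toℕ i) ⊎ (toℕ (next i) ≡ 0 × suc (toℕ i) ≡ n)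
      go {suc m} i with suc (toℕ i) <? suc m
      ... | yes p = inj₁ (FinP.toℕ-fromℕ< p)
      ... | no ¬p = inj₂ (refl , ≤-antisym (FinP.toℕ<n i) (≮⇒≥ ¬p))

    shift-cases : ∀ s (i : Fin n) → s ≤ n → toℕ (shift s i) ≡ toℕ i + s ⊎ toℕ (shift s i) + n ≡ toℕ i + s
    shift-cases zero i h = inj₁ (sym (+-identityʳ _))
    shift-cases (suc s) i h with next-cases i | shift-cases s (next i) (≤-trans (n≤1+n s) h)
    ... | inj₁ e | inj₁ e′ = inj₁ (trans e′ (trans (cong (_+ s) e) (sym (+-suc (toℕ i) s))))
    ... | inj₁ e | inj₂ e′ = inj₂ (trans e′ (trans (cong (_+ s) e) (sym (+-suc (toℕ i) s))))
    ... | inj₂ (e₀ , en) | inj₁ e′ = inj₂ (trans (cong₂ _+_ (trans e′ (cong (_+ s) e₀)) (sym en)) (trans (+-suc s (toℕ i)) (trans (cong suc (+-comm s (toℕ i))) (sym (+-suc (toℕ i) s)))))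
    ... | inj₂ (e₀ , en) | inj₂ e′ = contradiction (≤-trans (m≤n+m n _) (≤-reflexive (trans e′ (cong (_+ s) e₀)))) (<⇒≱ h)

    module Cycle (cyc : List V) (uc : Unique cyc) (cov : ∀ v → v ∈ cyc) (good : Good (cyc ++ take K cyc)) (Kn : K + k ≤ n) where
      open import Data.Fin.Permutation using (Permutation′; permutation; _⟨$⟩ʳ_)

      len : length cyc ≡ n
      len = ≤-antisym (≤-trans (Unique⇒length≤ uc) (≤-reflexive length-allFin))
        (≤-trans (≤-reflexive (sym length-allFin)) (rel-length _≡_ vs cyc (UniP.allFin⁺ n) (λ v _ → v , cov v , refl) (λ { refl refl → refl })))

      at : Fin n → V
      at i = List.lookup cyc (Fin.cast (sym len) i)

      pos : V → Fin n
      pos v = Fin.cast len (Any.index (cov v))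

      at-pos : ∀ v → at (pos v) ≡ v
      at-pos v = trans (cong (List.lookup cyc) (FinP.toℕ-injective (trans (FinP.toℕ-cast (sym len) (pos v)) (FinP.toℕ-cast len (Any.index (cov v)))))) (sym (lookup-index (cov v)))
        where open import Data.List.Relation.Unary.Any.Properties using (lookup-index)

      at-injective : ∀ i j → at i ≡ at j → i ≡ j
      at-injective i j e = FinP.toℕ-injective (trans (sym (FinP.toℕ-cast (sym len) i)) (trans (cong toℕ (lookup-inj-list cyc uc _ _ e)) (FinP.toℕ-cast (sym len) j)))

      σ : Permutation′ n
      σ = permutation at pos at-pos (λ i → at-injective _ _ (at-pos (at i)))

      cc : List V
      cc = cyc ++ cyc

      l : List V
      l = cyc ++ take K cyc

      orbit : ℕ → Fin n → List V
      orbit m i = List.applyUpTo (λ j → at (shift j i)) m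

      drop-cc : ∀ i → drop (toℕ i) cc ≡ at i ∷ drop (suc (toℕ i)) cc
      drop-cc i = subst (λ a → drop a cc ≡ at i ∷ drop (suc a) cc) (FinP.toℕ-cast (sym len) i)
        (trans (drop-++-≤ (toℕ i′) cyc cyc (<⇒≤ (FinP.toℕ<n i′))) (trans (cong (_++ cyc) (drop-lookup cyc i′)) (cong (at i ∷_) (sym (drop-++-≤ (suc (toℕ i′)) cyc cyc (FinP.toℕ<n i′))))))
        where i′ = Fin.cast (sym len) i

      -- The doubled sequence `cc` lets a window run past the end without reduction modulo `n`.
      -- Where `next` wraps around, dropping `n` entries of `cc` leaves `cyc`, which agrees with
      -- `cc` as far as the window reaches.
      orbit-window : ∀ m i → m ≤ n → orbit m i ≡ take m (drop (toℕ i) cc)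
      orbit-window zero i h = refl
      orbit-window (suc m) i h = trans (cong (at i ∷_) (trans (orbit-window m (next i) (<⇒≤ h)) (step (next-cases i)))) (cong (take (suc m)) (sym (drop-cc i)))
        where
        step : toℕ (next i) ≡ suc (toℕ i) ⊎ (toℕ (next i) ≡ 0 × suc (toℕ i) ≡ n) → take m (drop (toℕ (next i)) cc) ≡ take m (drop (suc (toℕ i)) cc)
        step (inj₁ e) = cong (λ a → take m (drop a cc)) e
        step (inj₂ (e₀ , en)) = trans (cong (λ a → take m (drop a cc)) e₀) (trans (take-++-≤ m cyc cyc (≤-trans (<⇒≤ h) (≤-reflexive (sym len))))
          (cong (take m) (sym (trans (cong (λ a → drop a cc) (trans en (trans (sym len) (sym (+-identityʳ _))))) (drop-past cyc 0 cyc)))))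

      length-l : length l ≡ n + K
      length-l = trans (ListP.length-++ cyc) (cong₂ _+_ len (length-takeK cyc (≤-trans (m≤m+n K k) (≤-trans Kn (≤-reflexive (sym len))))))

      cc≡ : cc ≡ l ++ drop K cyc
      cc≡ = trans (cong (cyc ++_) (sym (ListP.take++drop≡id K cyc))) (sym (ListP.++-assoc cyc (take K cyc) (drop K cyc)))

      win : ℕ → List V
      win a = take k (drop a l)

      window-orbit : ∀ i → window k σ i ≡ set (orbit k i)
      window-orbit i = trans (fold (upTo k)) (cong set (ListP.map-applyUpTo id (λ j → at (shift j i)) k))
        where
        fold : ∀ js → List.foldr (λ j acc → ⁅ σ ⟨$⟩ʳ shift j i ⁆ ∪ acc) Sub.⊥ js ≡ set (map (λ j → at (shift j i)) js)
        fold [] = refl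
        fold (j ∷ js) = cong (⁅ at (shift j i) ⁆ ∪_) (fold js)

      window-fits : ∀ (i : Fin n) → k + toℕ i ≤ length l
      window-fits i = ≤-trans (≤-reflexive (trans (sym (+-suc r (toℕ i))) (+-comm r (suc (toℕ i))))) (≤-trans (+-mono-≤ (FinP.toℕ<n i) (m≤m+n r r)) (≤-reflexive (sym length-l)))

      window≡ : ∀ i → window k σ i ≡ set (win (toℕ i))
      window≡ i = trans (window-orbit i) (cong set (trans (orbit-window k i (≤-trans (m≤n+m k K) Kn))
        (trans (cong (λ z → take k (drop (toℕ i) z)) cc≡) (window-++ l (drop K cyc) (toℕ i) (window-fits i)))))

      ∈-window : ∀ i {v} → v Sub.∈ window k σ i → ∃ λ s → s ≤ r × v ≡ at (shift s i)
      ∈-window i {v} m =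
        let s , s< , e = MemP.∈-applyUpTo⁻ (λ j → at (shift j i)) (∈-set⁻ (orbit k i) (subst (v Sub.∈_) (window-orbit i) m)) in s , s≤s⁻¹ s< , e

      edges : ∀ i → H (window k σ i) ≡ true
      edges i = trans (cong H (window≡ i)) (GE-window {0} l (toℕ i) (proj₁ good) (window-fits i))

      near : ∀ (i j : Fin n) d → 1 ≤ d → d ≤ r → toℕ j ≡ toℕ i + d → φ (window k σ i) ≢ φ (window k σ j)
      near i j d 1≤d dr e eq = GC-window l (toℕ i) d (proj₂ good) 1≤d dr bnd
        (trans (cong φ (sym (window≡ i))) (trans eq (trans (cong φ (window≡ j)) (cong (col ∘ win) e))))
        where
        bnd : toℕ i + (k + d) ≤ length l
        bnd = begin
          toℕ i + (k + d) ≡⟨ r₁ (toℕ i) r d ⟩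
          suc (toℕ i + d) + r ≡⟨ cong (λ a → suc a + r) (sym e) ⟩
          suc (toℕ j) + r ≤⟨ +-mono-≤ (FinP.toℕ<n j) (m≤m+n r r) ⟩
          n + K ≡⟨ sym length-l ⟩
          length l ∎
          where
          open ≤-Reasoning
          r₁ : ∀ a r d → a + ((1 + r) + d) ≡ (1 + (a + d)) + r
          r₁ = solve-∀

      -- The window at `i` follows the one at `j` across the end of the cycle. As `i < d ≤ r`, it
      -- lies within the first `K` vertices, which `l` repeats at its end, so it can be read again
      -- at position `i + n`, at distance `d` after `j`.
      wrap : ∀ (i j : Fin n) d → 1 ≤ d → d ≤ r → toℕ i + n ≡ toℕ j + d → φ (window k σ i) ≢ φ (window k σ j)
      wrap i j d 1≤d dr e eq = GC-window l (toℕ j) d (proj₂ good) 1≤d dr bnd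
        (trans (cong φ (sym (window≡ j))) (trans (sym eq) (trans (cong φ (window≡ i)) (trans (cong col turn) (cong (col ∘ win) e)))))
        where
        i<d : toℕ i < d
        i<d = +-cancelʳ-< n (toℕ i) d (≤-trans (s≤s (≤-reflexive e)) (≤-trans (+-monoˡ-≤ d (FinP.toℕ<n j)) (≤-reflexive (+-comm n d))))
        ik : k + toℕ i ≤ K
        ik = ≤-trans (≤-reflexive (sym (+-suc r (toℕ i)))) (+-monoʳ-≤ r (≤-trans i<d dr))
        Kc : K ≤ length cyc
        Kc = ≤-trans (m≤m+n K k) (≤-trans Kn (≤-reflexive (sym len)))
        turn : win (toℕ i) ≡ win (toℕ i + n)
        turn = begin
          take k (drop (toℕ i) l) ≡⟨ window-++ cyc (take K cyc) (toℕ i) (≤-trans ik Kc) ⟩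
          take k (drop (toℕ i) cyc) ≡⟨ cong (λ z → take k (drop (toℕ i) z)) (sym (ListP.take++drop≡id K cyc)) ⟩
          take k (drop (toℕ i) (take K cyc ++ drop K cyc)) ≡⟨ window-++ (take K cyc) (drop K cyc) (toℕ i) (≤-trans ik (≤-reflexive (sym (length-takeK cyc Kc)))) ⟩
          take k (drop (toℕ i) (take K cyc)) ≡⟨ cong (take k) (sym (drop-past cyc (toℕ i) (take K cyc))) ⟩
          take k (drop (length cyc + toℕ i) l) ≡⟨ cong (λ a → take k (drop a l)) (trans (cong (_+ toℕ i) len) (+-comm n (toℕ i))) ⟩
          take k (drop (toℕ i + n) l) ∎
          where open ≡-Reasoning
        bnd : toℕ j + (k + d) ≤ length l
        bnd = begin
          toℕ j + (k + d) ≡⟨ r₁ (toℕ j) k d ⟩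
          k + (toℕ j + d) ≡⟨ cong (k +_) (sym e) ⟩
          k + (toℕ i + n) ≡⟨ sym (+-assoc k (toℕ i) n) ⟩
          k + toℕ i + n ≤⟨ +-monoˡ-≤ n ik ⟩
          K + n ≡⟨ trans (+-comm K n) (sym length-l) ⟩
          length l ∎
          where
          open ≤-Reasoning
          r₁ : ∀ a b c → a + (b + c) ≡ b + (a + c)
          r₁ = solve-∀

      private
        r<n : r < n
        r<n = ≤-trans (m≤n+m k K) Kn

        gap : ∀ (i j : Fin n) s t → toℕ i < toℕ j → s ≤ r → toℕ i + s ≡ toℕ j + t → φ (window k σ i) ≢ φ (window k σ j)
        gap i j s t lt sr e = near i j (toℕ j ∸ toℕ i) (m<n⇒0<n∸m lt) (≤-trans (+-cancelˡ-≤ (toℕ i) _ _ (≤-trans (≤-reflexive je) (≤-trans (m≤m+n (toℕ j) t) (≤-reflexive (sym e))))) sr) (sym je)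
          where
          je : toℕ i + (toℕ j ∸ toℕ i) ≡ toℕ j
          je = m+[n∸m]≡n (<⇒≤ lt)

        apart : ∀ (i j : Fin n) s t → toℕ i < toℕ j → s ≤ r → t ≤ r → shift s i ≡ shift t j → φ (window k σ i) ≢ φ (window k σ j)
        apart i j s t lt sr tr e with shift-cases s i (≤-trans sr (<⇒≤ r<n)) | shift-cases t j (≤-trans tr (<⇒≤ r<n))
        ... | inj₁ a | inj₁ b = gap i j s t lt sr (trans (sym a) (trans (cong toℕ e) b))
        ... | inj₂ a | inj₂ b = gap i j s t lt sr (trans (sym a) (trans (cong (λ x → toℕ x + n) e) b))
        -- The smaller start cannot wrap around to a position that the larger one reaches without
        -- wrapping, since a shift is shorter than `n`.
        ... | inj₂ a | inj₁ b = contradiction (begin-strict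
              toℕ i + s <⟨ +-mono-<-≤ lt (≤-trans sr (<⇒≤ r<n)) ⟩
              toℕ j + n ≤⟨ +-monoˡ-≤ n (≤-trans (m≤m+n (toℕ j) t) (≤-reflexive (trans (sym b) (cong toℕ (sym e))))) ⟩
              toℕ (shift s i) + n ≡⟨ a ⟩
              toℕ i + s ∎) (<-irrefl refl)
          where open ≤-Reasoning
        ... | inj₁ a | inj₂ b = wrap i j (toℕ i + n ∸ toℕ j) (m<n⇒0<n∸m jn) (≤-trans (+-cancelˡ-≤ (toℕ j) _ _ le) tr) (sym (m+[n∸m]≡n (<⇒≤ jn)))
          where
          jn : toℕ j < toℕ i + n
          jn = ≤-trans (FinP.toℕ<n j) (m≤n+m n (toℕ i))
          le : toℕ j + (toℕ i + n ∸ toℕ j) ≤ toℕ j + t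
          le = ≤-trans (≤-reflexive (m+[n∸m]≡n (<⇒≤ jn))) (≤-trans (+-monoˡ-≤ n (m≤m+n (toℕ i) s)) (≤-reflexive (trans (cong (_+ n) (trans (sym a) (cong toℕ e))) b)))

      proper : ∀ i j → ¬ (window k σ i ≡ window k σ j) → Nonempty (window k σ i ∩ window k σ j) → ¬ (φ (window k σ i) ≡ φ (window k σ j))
      proper i j ne (v , v∈) = decide (<-cmp (toℕ i) (toℕ j))
        where
        si = ∈-window i (proj₁ (SubP.x∈p∩q⁻ (window k σ i) (window k σ j) v∈))
        sj = ∈-window j (proj₂ (SubP.x∈p∩q⁻ (window k σ i) (window k σ j) v∈))
        meet : shift (proj₁ si) i ≡ shift (proj₁ sj) j
        meet = at-injective _ _ (trans (sym (proj₂ (proj₂ si))) (proj₂ (proj₂ sj)))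
        open import Relation.Binary.Definitions using (Tri)
        decide : Tri (toℕ i < toℕ j) (toℕ i ≡ toℕ j) (toℕ j < toℕ i) → φ (window k σ i) ≢ φ (window k σ j)
        decide (tri< lt _ _) = apart i j (proj₁ si) (proj₁ sj) lt (proj₁ (proj₂ si)) (proj₁ (proj₂ sj)) meet
        decide (tri≈ _ e _) = contradiction (cong (window k σ) (FinP.toℕ-injective e)) ne
        decide (tri> _ _ gt) e = apart j i (proj₁ sj) (proj₁ si) gt (proj₁ (proj₂ sj)) (proj₁ (proj₂ si)) (sym meet) (sym e)

      hamilton : HasProperlyColoredTightHamCycle k n H φ
      hamilton = σ , edges , proper

    -- Assembly

    fromListExact : ∀ m (l : List V) → length l ≡ m → Σ (Vec V m) λ σ → toList σ ≡ l
    fromListExact m l e = let σ , eq = fromListN m l (≤-reflexive (sym e)) in σ , trans eq (ListP.take-all m l (≤-reflexive e))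

    -- `sA` is the number of absorbers for each vertex, `s` the number of reservoir connectors for
    -- each pair of ends. By `h₁₁` the absorbers can take in all uncovered vertices and the whole
    -- reservoir, by `h₁₂` the reservoir can link all tiles, and by `h₁₀` fewer than `s` vertices
    -- stay uncovered. `h₂` and `h₃` are the conditions of the two selections; the other bounds say
    -- that `N` and `C` are large compared with the constants.
    module Assembly (s sA h e : ℕ)
        (C₁ : absorbConst r q ≤ C) (C₂ : connConst r q ≤ C) (C₃ : 2 * tileKappa q h ≤ C) (C₄ : tileConst r q h e ≤ C)
        (h₁ : absorbConst r q * suc (suc (sA * (4 * (2 * q ^ (K + K))) * (K + K))) ≤ N)
        (h₂ : N ^ 1 < 2 ^ sA) (h₃ : N ^ (K + K) < 2 ^ s)
        (h₄ : connConst r q * suc (K + K + (sA * (4 * (2 * q ^ (K + K))) * (K + K + Lc) + s * (4 * (2 * connDensity r q)) * connDim r)) ≤ N)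
        (h₅ : q * (K + K) ≤ N)
        (h₆ : 2 * q * (sA * (4 * (2 * q ^ (K + K))) * (K + K + Lc) + s * (4 * (2 * connDensity r q)) * connDim r + double h) ≤ N)
        (h₇ : 2 * e * r ≤ N) (h₈ : 0 < tileConst r q h e) (h₉ : tileConst r q h e * suc (h + h) ≤ N)
        (h₁₀ : N ≤ e * s) (h₁₁ : s + s * (4 * (2 * connDensity r q)) * connDim r ≤ sA)
        (h₁₂ : N * Lc < s * double h) (h₁₃ : K ≤ double h) (1≤h : 1 ≤ h) (h₁₄ : K + k ≤ n)
        (0<N : 0 < N) (0<βc : 0 < connDensity r q) where

      private
        DA βA EA Dc βc Ec : ℕ
        DA = K + K
        βA = 2 * q ^ DA
        EA = 4 * βA
        Dc = connDim r
        βc = 2 * connDensity r q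
        Ec = 4 * βc

        0<βA : 0 < βA
        0<βA = *-mono-≤ (s≤s {n = 1} z≤n) (m^n>0 q ⦃ >-nonZero (≤-trans (s≤s z≤n) 2≤q) ⦄ DA)

        AbsSat : Vec V 1 → Vec V DA → Set
        AbsSat i τ = Absorbs (lookup i zero) (toList τ)

        AbsSat? : ∀ i τ → Dec (AbsSat i τ)
        AbsSat? i τ = Absorbs? (lookup i zero) (toList τ)

        module SelA = Selection 1 DA βA (sA * EA * DA) {Rq = λ _ → ⊤} (λ _ → yes tt) AbsSat? [] 0<βA 0<N
          (λ i _ B hB → absorbers-dense (lookup i zero) B C₁ (≤-trans (*-monoʳ-≤ (absorbConst r q) (s≤s (s≤s hB))) h₁) 0<N)

        selA = SelA.select sA ≤-refl h₂

        FA : List (Vec V DA)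
        FA = proj₁ selA
        |FA| : length FA ≤ sA * EA
        |FA| = proj₁ (proj₂ selA)
        uFA : Unique (toLists FA)
        uFA = proj₁ (proj₁ (proj₂ (proj₂ selA)))
        someA : All (λ τ → ∃ λ i → AbsSat i τ) FA
        someA = proj₁ (proj₂ (proj₂ (proj₂ selA)))
        manyA : ∀ v → sA ≤ count (map toList FA) (Absorbs? v)
        manyA v = ≤-trans (proj₂ (proj₂ (proj₂ (proj₂ selA))) (v ∷ []) tt) (≤-reflexive (sym (sumL-map toList FA _)))

        AL : List (List V)
        AL = map toList FA

        AL-good : All (λ P → Good P × length P ≡ K + K) AL
        AL-good = AllP.map⁺ (All.map (λ { (i , len , g , _) → g , len }) someA)

        record AbsorbingPath : Set₁ where
          field
            b₀ : List V
            bs : List (List V)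
            |b₀| : length b₀ ≡ K + K
            good : Good (b₀ ++ concat bs)
            unique : Unique (b₀ ++ concat bs)
            absorbing : ∀ v → sA ≤ suc (count bs (Absorbs? v))
            short : length (b₀ ++ concat bs) ≤ sA * EA * (DA + Lc)

        1≤sA : 1 ≤ sA
        1≤sA = n≢0⇒n>0 λ z → <⇒≱ h₂ (≤-trans (≤-reflexive (cong (2 ^_) z)) (≤-trans 0<N (≤-reflexive (sym (*-identityʳ N)))))

        absorbing-path : AbsorbingPath
        absorbing-path = go AL refl AL-good
          where
          go : ∀ L → L ≡ AL → All (λ P → Good P × length P ≡ K + K) L → AbsorbingPath
          go [] eq _ = contradiction (≤-trans 1≤sA (≤-trans (manyA v₀) (≤-reflexive (cong (λ L → count L (Absorbs? v₀)) (sym eq))))) λ ()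
            where
            v₀ : V
            v₀ = proj₁ (nonempty vs 0<N)
              where
              nonempty : ∀ (l : List V) → 0 < length l → ∃ λ v → v ∈ l
              nonempty (v ∷ l) _ = v , here refl
          go (b₀ ∷ L) eq ((gb , lb) ∷ gL) = record
            { b₀ = b₀ ; bs = Lk.bs ; |b₀| = lb ; good = Lk.good ; unique = Lk.unique
            ; absorbing = λ v → ≤-trans (manyA v) (≤-trans (≤-reflexive (cong (λ L → count L (Absorbs? v)) (sym eq))) (+-mono-≤ (ind≤1 (Absorbs? v b₀)) (Lk.counts (Absorbs? v))))
            ; short = ≤-trans (≤-reflexive (trans (ListP.length-++ b₀) (trans (cong (length b₀ +_) Lk.|bs|) (sym (+-assoc (length b₀) _ _)))))
                (≤-trans (+-mono-≤ (≤-trans (≤-reflexive (sym (ListP.length-++ b₀))) lenZ) lenL) (≤-reflexive (sym (*-distribˡ-+ (sA * EA) DA Lc)))) }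
            where
            Z : List V
            Z = toLists FA
            Z≡ : b₀ ++ concat L ≡ Z
            Z≡ = cong concat eq
            lenZ : length (b₀ ++ concat L) ≤ sA * EA * DA
            lenZ = ≤-trans (≤-reflexive (trans (cong length Z≡) (length-toLists FA))) (*-monoˡ-≤ DA |FA|)
            lenL : length L * Lc ≤ sA * EA * Lc
            lenL = *-monoˡ-≤ Lc (≤-trans (n≤1+n _) (≤-trans (≤-reflexive (trans (cong length eq) (ListP.length-map toList FA))) |FA|))
            oracle : Oracle (_∉ Z) (length L * Lc)
            oracle = global-oracle Z (length L * Lc) C₂ h₅ 0<N 0<βc (≤-trans (*-monoʳ-≤ (connConst r q) (s≤s (+-monoʳ-≤ (K + K)
              (≤-trans (+-mono-≤ (≤-trans (≤-reflexive (cong length (sym Z≡))) lenZ) lenL) (≤-trans (≤-reflexive (sym (*-distribˡ-+ (sA * EA) DA Lc))) (m≤m+n _ _)))))) h₄)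
            lk : Linked oracle b₀ L []
            lk = link oracle L b₀ [] gb (≤-trans (m≤m+n K K) (≤-reflexive (sym lb)))
              (All.map (λ { (g , l) → g , ≤-trans (m≤m+n K K) (≤-reflexive (sym l)) }) gL)
              (subst Unique (sym Z≡) uFA) (λ m ∉Z → contradiction (subst (_ ∈_) Z≡ (MemP.∈-++⁺ˡ m)) ∉Z)
              (λ m ∉Z → ∉Z (subst (_ ∈_) Z≡ (MemP.∈-++⁺ʳ b₀ m))) ≤-refl
            module Lk = Linked lk

        open AbsorbingPath absorbing-path

        A : List V
        A = b₀ ++ concat bs

        xOf yOf : Vec V (K + K) → List V
        xOf i = toList (Vec.take K i)
        yOf i = toList (Vec.drop K i)

        -- The ends to be joined are unknown until the tiling exists, so the reservoir has to serve
        -- every disjoint pair of good ends. A pair is coded as one vector of `2K` vertices.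
        Rq : Vec V (K + K) → Set
        Rq i = Good (xOf i) × Good (yOf i) × Unique (xOf i ++ yOf i)

        Rq? : ∀ i → Dec (Rq i)
        Rq? i = Good? (xOf i) ×-dec (Good? (yOf i) ×-dec Unique? (xOf i ++ yOf i))

        ConSat? : ∀ i τ → Dec (Connects (xOf i) (yOf i) τ)
        ConSat? i τ = Connects? (xOf i) (yOf i) τ

        0<βc′ : 0 < βc
        0<βc′ = *-mono-≤ (s≤s {n = 1} z≤n) 0<βc

        dense-R : ∀ i → Rq i → ∀ B → length B ≤ s * Ec * Dc → N ^ Dc ≤ βc * count (vecs vs Dc) (λ τ → ConSat? i τ ×-dec Fresh? (A ++ B) (toList τ))
        dense-R i (gx , gy , u) B hB = connectors-dense (xOf i) (yOf i) (A ++ B) (VecP.length-toList (Vec.take K i)) (VecP.length-toList (Vec.drop K i)) gx gy u C₂ h₅ 0<N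
          (≤-trans (*-monoʳ-≤ (connConst r q) (s≤s (+-monoʳ-≤ (K + K) (≤-trans (≤-reflexive (ListP.length-++ A)) (+-mono-≤ short hB))))) h₄) (0<connConst 0<βc)

        module SelR = Selection (K + K) Dc βc (s * Ec * Dc) Rq? ConSat? A 0<βc′ 0<N dense-R

        selR = SelR.select s ≤-refl h₃

        FR : List (Vec V Dc)
        FR = proj₁ selR
        Rv : List V
        Rv = toLists FR
        |Rv| : length Rv ≤ s * Ec * Dc
        |Rv| = ≤-trans (≤-reflexive (length-toLists FR)) (*-monoˡ-≤ Dc (proj₁ (proj₂ selR)))
        freshR : Fresh A Rv
        freshR = proj₁ (proj₂ (proj₂ selR))
        manyR : ∀ x y → length x ≡ K → length y ≡ K → Good x → Good y → Unique (x ++ y) → s ≤ count FR (Connects? x y)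
        manyR x y lx ly gx gy u = subst₂ (λ x y → s ≤ count FR (Connects? x y)) xe ye
          (proj₂ (proj₂ (proj₂ (proj₂ selR))) i (subst Good (sym xe) gx , subst Good (sym ye) gy , subst₂ (λ x y → Unique (x ++ y)) (sym xe) (sym ye) u))
          where
          vx = fromListExact K x lx
          vy = fromListExact K y ly
          i : Vec V (K + K)
          i = proj₁ vx Vec.++ proj₁ vy
          xe : xOf i ≡ x
          xe = trans (cong toList (proj₁ (take-drop-++ K (proj₁ vx) (proj₁ vy)))) (proj₂ vx)
          ye : yOf i ≡ y
          ye = trans (cong toList (proj₂ (take-drop-++ K (proj₁ vx) (proj₁ vy)))) (proj₂ vy)

        Z : List V
        Z = A ++ Rv
        disAR : ∀ {v} → v ∈ A → v ∈ Rv → ⊥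
        disAR mA mR = All.lookup (proj₂ freshR) mR mA
        uZ : Unique Z
        uZ = UniP.++⁺ unique (proj₁ freshR) (λ { (m₁ , m₂) → disAR m₁ m₂ })
        |Z| : length Z ≤ sA * EA * (DA + Lc) + s * Ec * Dc
        |Z| = ≤-trans (≤-reflexive (ListP.length-++ A)) (+-mono-≤ short |Rv|)

        module Ti = Tiling h e 1≤h Z 0<N (≤-trans (*-monoʳ-≤ (2 * q) (+-monoˡ-≤ (double h) |Z|)) h₆) h₇ C₃ C₄ h₈ h₉

        tiling = Ti.almost-tiling uZ
        ts : List (List V)
        ts = proj₁ tiling
        uts : Unique (Z ++ concat ts)
        uts = proj₁ (proj₁ (proj₂ tiling))
        tsG : All (λ T → length T ≡ double h × Good T) ts
        tsG = proj₂ (proj₁ (proj₂ tiling))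

        U : List V
        U = Ti.uncovered ts
        |U|<s : length U < s
        |U|<s = *-cancelˡ-< e (length U) s (≤-trans (proj₂ (proj₂ tiling)) h₁₀)

        few-tiles : length ts * Lc < s
        few-tiles = *-cancelʳ-< (double h) (length ts * Lc) s (begin-strict
          length ts * Lc * double h ≡⟨ r₁ (length ts) Lc (double h) ⟩
          length ts * double h * Lc ≤⟨ *-monoˡ-≤ Lc (Ti.tiles≤ ts (proj₁ (proj₂ tiling))) ⟩
          N * Lc <⟨ h₁₂ ⟩
          s * double h ∎)
          where
          open ≤-Reasoning
          r₁ : ∀ a b c → a * b * c ≡ a * c * b
          r₁ = solve-∀

        oracleR : Oracle (_∈ Rv) (length ts * Lc)
        oracleR = family-oracle FR s (length ts * Lc) few-tiles (proj₁ freshR) manyR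

        dis-ts : ∀ {v} → v ∈ Z → v ∈ concat ts → ⊥
        dis-ts = proj₂ (proj₂ (Unique-++⁻ Z uts))

        lk : Linked oracleR A ts []
        lk = link oracleR ts A [] good (≤-trans (≤-trans (m≤m+n K K) (≤-reflexive (sym |b₀|))) (length-≤-++ b₀ _))
          (All.map (λ { (len , g) → g , ≤-trans h₁₃ (≤-reflexive (sym len)) }) tsG)
          (UniP.++⁺ unique (proj₁ (proj₂ (Unique-++⁻ Z uts))) (λ { (m₁ , m₂) → dis-ts (MemP.∈-++⁺ˡ m₁) m₂ }))
          (λ mA mR → ⊥-elim (disAR mA mR)) (λ mt mR → dis-ts (MemP.∈-++⁺ʳ A mR) mt) ≤-refl
        module Lk = Linked lk

        c₂ : List V
        c₂ = A ++ concat Lk.bs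

        closed = close oracleR c₂ Lk.used′ Lk.good (≤-trans (≤-trans (≤-reflexive (sym |b₀|)) (length-≤-++ b₀ _)) (length-≤-++ A _)) Lk.unique Lk.track
          (≤-reflexive Lk.|used′|)

        T : List V
        T = proj₁ closed
        goodT : Good (c₂ ++ T ++ take K c₂)
        goodT = proj₁ (proj₂ (proj₂ closed))
        uniqueT : Unique (c₂ ++ T)
        uniqueT = proj₁ (proj₂ (proj₂ (proj₂ closed)))

        left? : ∀ v → Dec (v ∉ c₂ ++ T)
        left? v = ¬? (v ∈? (c₂ ++ T))

        W : List V
        W = filter left? vs

        |W| : suc (length W) ≤ sA
        |W| = begin-strict
          length W ≡⟨ count-filter vs left? ⟩
          count vs left? ≤⟨ sumL-mono vs (λ v → ind-⊎ (left? v) (¬? (v ∈? (Z ++ concat ts))) (v ∈? Rv) (split v)) ⟩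
          sumL vs (λ v → ind (¬? (v ∈? (Z ++ concat ts))) + ind (v ∈? Rv)) ≡⟨ sumL-+ vs _ _ ⟩
          count vs (λ v → ¬? (v ∈? (Z ++ concat ts))) + count vs (_∈? Rv) ≤⟨ +-mono-≤ (≤-reflexive (sym (count-filter vs _))) (≤-trans (count-∈ Rv) |Rv|) ⟩
          length U + s * Ec * Dc <⟨ +-monoˡ-< (s * Ec * Dc) |U|<s ⟩
          s + s * Ec * Dc ≤⟨ h₁₁ ⟩
          sA ∎
          where
          open ≤-Reasoning
          split : ∀ v → v ∉ c₂ ++ T → v ∉ Z ++ concat ts ⊎ v ∈ Rv
          split v v∉ = choice (v ∈? Rv)
            where
            decide : v ∉ Rv → v ∈ Z ⊎ v ∈ concat ts → ⊥
            decide m (inj₁ mZ) = [ (λ mA → v∉ (MemP.∈-++⁺ˡ (MemP.∈-++⁺ˡ mA))) , m ]′ (MemP.∈-++⁻ A mZ)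
            decide m (inj₂ mt) = v∉ (MemP.∈-++⁺ˡ (MemP.∈-++⁺ʳ A (Lk.covers mt)))
            choice : Dec (v ∈ Rv) → v ∉ Z ++ concat ts ⊎ v ∈ Rv
            choice (yes m) = inj₂ m
            choice (no m) = inj₁ λ mm → decide m (MemP.∈-++⁻ Z mm)

        Y : List V
        Y = concat Lk.bs ++ T ++ take K b₀

        Kb₀ : K ≤ length b₀
        Kb₀ = ≤-trans (m≤m+n K K) (≤-reflexive (sym |b₀|))

        goodY : Good (b₀ ++ concat bs ++ Y)
        goodY = subst Good (begin
          c₂ ++ T ++ take K c₂ ≡⟨ cong (λ t → c₂ ++ T ++ t) (trans (cong (take K) (ListP.++-assoc b₀ (concat bs) (concat Lk.bs))) (take-++-≤ K b₀ _ Kb₀)) ⟩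
          (A ++ concat Lk.bs) ++ T ++ take K b₀ ≡⟨ ListP.++-assoc A (concat Lk.bs) _ ⟩
          A ++ Y ≡⟨ ListP.++-assoc b₀ (concat bs) Y ⟩
          b₀ ++ concat bs ++ Y ∎) goodT
          where open ≡-Reasoning

        absorbed = absorb-all b₀ Y W bs goodY (λ w _ → s≤s⁻¹ (≤-trans |W| (absorbing w)))

        bs′ : List (List V)
        bs′ = proj₁ absorbed
        perm : concat bs′ ↭ W ++ concat bs
        perm = proj₂ (proj₂ absorbed)

        cyc : List V
        cyc = b₀ ++ concat bs′ ++ concat Lk.bs ++ T

        cyc↭ : cyc ↭ W ++ (c₂ ++ T)
        cyc↭ = ↭-trans (PermP.++⁺ˡ b₀ (PermP.++⁺ʳ (concat Lk.bs ++ T) perm))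
          (↭-trans (Perm.↭-reflexive (trans (cong (b₀ ++_) (ListP.++-assoc W (concat bs) _)) refl))
          (↭-trans (PermP.shifts b₀ W)
          (PermP.++⁺ˡ W (Perm.↭-reflexive (sym (trans (ListP.++-assoc A (concat Lk.bs) T) (ListP.++-assoc b₀ (concat bs) _)))))))

        uniqueAll : Unique (W ++ (c₂ ++ T))
        uniqueAll = UniP.++⁺ (UniP.filter⁺ left? (UniP.allFin⁺ n)) uniqueT (λ { (m₁ , m₂) → proj₂ (MemP.∈-filter⁻ left? {xs = vs} m₁) m₂ })

        covered : ∀ v → v ∈ cyc
        covered v = choice (v ∈? (c₂ ++ T))
          where
          choice : Dec (v ∈ c₂ ++ T) → v ∈ cyc
          choice (yes m) = PermP.∈-resp-↭ (↭-sym cyc↭) (MemP.∈-++⁺ʳ W m)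
          choice (no ¬m) = PermP.∈-resp-↭ (↭-sym cyc↭) (MemP.∈-++⁺ˡ (MemP.∈-filter⁺ left? (MemP.∈-allFin v) ¬m))

        goodCyc : Good (cyc ++ take K cyc)
        goodCyc = subst Good (sym (begin
          cyc ++ take K cyc ≡⟨ cong (cyc ++_) (take-++-≤ K b₀ _ Kb₀) ⟩
          cyc ++ take K b₀ ≡⟨ ListP.++-assoc b₀ _ (take K b₀) ⟩
          b₀ ++ (concat bs′ ++ concat Lk.bs ++ T) ++ take K b₀ ≡⟨ cong (b₀ ++_) (trans (ListP.++-assoc (concat bs′) _ _) (cong (concat bs′ ++_) (ListP.++-assoc (concat Lk.bs) T _))) ⟩
          b₀ ++ concat bs′ ++ Y ∎)) (proj₁ (proj₂ absorbed))
          where open ≡-Reasoning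

      result : HasProperlyColoredTightHamCycle k n H φ
      result = Cycle.hamilton cyc (Unique-↭ (↭-sym cyc↭) uniqueAll) covered goodCyc h₁₄

  -- Constants

  0<blowConst : ∀ t m {β} → 0 < β → 0 < blowConst t m β
  0<blowConst t zero h = h
  0<blowConst t (suc m) {β} h = *-mono-≤ pos (0<blowConst t m pos)
    where
    2β : 0 < 2 * β
    2β = *-mono-≤ (s≤s {n = 1} z≤n) h
    pos : 0 < 2 * (2 * β * (2 * β) ^ t)
    pos = *-mono-≤ (s≤s {n = 1} z≤n) (*-mono-≤ 2β (m^n>0 (2 * β) ⦃ >-nonZero 2β ⦄ t))

  suc≤2^ : ∀ j → suc j ≤ 2 ^ j
  suc≤2^ zero = s≤s z≤n
  suc≤2^ (suc j) = ≤-trans (+-mono-≤ (≤-trans (s≤s z≤n) (suc≤2^ j)) (suc≤2^ j)) (≤-reflexive (cong (2 ^ j +_) (sym (+-identityʳ _))))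

  -- With `j = ⌊s / (2d)⌋` the number `N` is at most linear in `j + 1` with a slope that `s` was
  -- chosen to beat, so `N < (j + 1)²`. From `j + 1 ≤ 2^j` one gets `N < 4^j`, and the `d`-th power
  -- of the right side is at most `2^s`.
  power<exponential : ∀ N d X s → 0 < d → N ≤ 2 * X * s → 2 * d * (4 * d * X) ≤ s → N ^ d < 2 ^ s
  power<exponential N d@(suc _) X s 0<d NX sX = begin-strict
    N ^ d <⟨ ^-monoˡ-< d N< ⟩
    (suc j * suc j) ^ d ≤⟨ ^-monoˡ-≤ d (*-mono-≤ (suc≤2^ j) (suc≤2^ j)) ⟩
    (2 ^ j * 2 ^ j) ^ d ≡⟨ cong (_^ d) (sym (^-distribˡ-+-* 2 j j)) ⟩
    (2 ^ (j + j)) ^ d ≡⟨ ^-*-assoc 2 (j + j) d ⟩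
    2 ^ ((j + j) * d) ≤⟨ ^-monoʳ-≤ 2 (≤-trans (≤-reflexive (r₁ j d)) (m/n*n≤m s (2 * d))) ⟩
    2 ^ s ∎
    where
    open ≤-Reasoning
    j = s / (2 * d)
    r₁ : ∀ j d → (j + j) * d ≡ j * (2 * d)
    r₁ = solve-∀
    s< : s < 2 * d * suc j
    s< = begin-strict
      s ≡⟨ m≡m%n+[m/n]*n s (2 * d) ⟩
      s % (2 * d) + j * (2 * d) <⟨ +-monoˡ-< (j * (2 * d)) (m%n<n s (2 * d)) ⟩
      2 * d + j * (2 * d) ≡⟨ *-comm (suc j) (2 * d) ⟩
      2 * d * suc j ∎
    j-big : 4 * d * X ≤ j
    j-big = s≤s⁻¹ (*-cancelˡ-< (2 * d) _ _ (≤-trans (s≤s sX) s<))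
    N< : N < suc j * suc j
    N< = begin-strict
      N ≤⟨ NX ⟩
      2 * X * s ≤⟨ *-monoʳ-≤ (2 * X) (<⇒≤ s<) ⟩
      2 * X * (2 * d * suc j) ≡⟨ r₂ X d (suc j) ⟩
      4 * d * X * suc j ≤⟨ *-monoˡ-≤ (suc j) j-big ⟩
      j * suc j <⟨ m<n+m (j * suc j) (s≤s z≤n) ⟩
      suc j * suc j ∎
      where
      r₂ : ∀ X d j → 2 * X * (2 * d * j) ≡ 4 * d * X * j
      r₂ = solve-∀

  -- Every quantity of the construction is a constant times s = ⌊n / X⌋.
  module Constants (r q : ℕ) where

    DA EA Lc Ec Dc Y P X h e s₀ n₀ : ℕ
    DA = (r + r) + (r + r)
    EA = 4 * (2 * q ^ DA)
    Lc = r + r * suc r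
    Ec = 4 * (2 * connDensity r q)
    Dc = connDim r
    -- The order of these choices avoids a circle. `s * Y` absorbers per vertex serve `s` uncovered
    -- vertices and a reservoir of `s * Ec * Dc`; `P * s` bounds all vertices set aside, and `X`
    -- makes this a small part of `n`. None of them involves the tiles, so `h` may exceed `X * Lc`,
    -- which leaves too few tiles to exhaust the reservoir, and `e = 2 * X` brings the uncovered
    -- vertices below `s`.
    Y = 1 + Ec * Dc
    P = Y * EA * (DA + Lc) + Ec * Dc
    X = suc (absorbConst r q * (2 + Y * EA * DA) + connConst r q * (1 + DA + P) + q * DA + 2 * q * (P + 2))
    h = suc (X * Lc + r)
    e = 2 * X
    s₀ = suc (h + 4 * r + tileConst r q h e * suc (h + h) + ((r + r) + suc r) + 2 * DA * (4 * DA * X))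
    n₀ = X * s₀

    colBound : ℕ
    colBound = absorbConst r q + connConst r q + 2 * tileKappa q h + tileConst r q h e

    1≤n₀ : 1 ≤ n₀
    1≤n₀ = s≤s z≤n

    module _ (2≤r : 2 ≤ r) (2≤q : 2 ≤ q) where

      0<connDensity : 0 < connDensity r q
      0<connDensity = 0<blowConst (suc r) (r + (r + r)) (*-mono-≤ qr (*-mono-≤ qr qr))
        where
        qr : 0 < q ^ r
        qr = m^n>0 q ⦃ >-nonZero (≤-trans (s≤s z≤n) 2≤q) ⦄ r

      0<tileConst : 0 < tileConst r q h e
      0<tileConst = *-mono-≤ {1} (*-mono-≤ (s≤s {n = 1} z≤n) (0<blowConst (suc (double h)) r 0<β))
        (≤-trans (*-mono-≤ {1} (≤-trans 1≤r (m≤m+n r _)) 1≤r) (m≤n+m _ _))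
        where
        1≤r : 1 ≤ r
        1≤r = ≤-trans (s≤s z≤n) 2≤r
        0<qh : 0 < 2 * q * h
        0<qh = *-mono-≤ {1} (*-mono-≤ (s≤s {n = 1} z≤n) (≤-trans (s≤s z≤n) 2≤q)) (s≤s z≤n)
        hh : 0 < (h + h) ^ h
        hh = m^n>0 (h + h) h
        0<β : 0 < tileBeta r q h e
        0<β = *-mono-≤ {1} (*-mono-≤ {1} (m^n>0 (2 * e) ⦃ >-nonZero {2 * e} (s≤s z≤n) ⦄ r) (*-mono-≤ (s≤s {n = 1} z≤n) (*-mono-≤ 0<qh 0<qh))) (*-mono-≤ hh hh)

      module Bounds (N s : ℕ) (XN : X * s ≤ N) (NX : N ≤ 2 * X * s) (big : s₀ ≤ s) where
        open ≤-Reasoning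

        1≤s : 1 ≤ s
        1≤s = ≤-trans (s≤s z≤n) big

        sA : ℕ
        sA = s * Y

        private
          scale : ∀ {c} → c ≤ X → c * s ≤ N
          scale le = ≤-trans (*-monoˡ-≤ s le) XN

          X₁ : absorbConst r q * (2 + Y * EA * DA) ≤ X
          X₁ = m≤n⇒m≤1+n (≤-trans (m≤m+n _ _) (≤-trans (m≤m+n _ _) (m≤m+n _ _)))
          X₂ : connConst r q * (1 + DA + P) ≤ X
          X₂ = m≤n⇒m≤1+n (≤-trans (m≤n+m _ (absorbConst r q * (2 + Y * EA * DA))) (≤-trans (m≤m+n _ _) (m≤m+n _ _)))
          X₃ : q * DA ≤ X
          X₃ = m≤n⇒m≤1+n (≤-trans (m≤n+m _ (absorbConst r q * (2 + Y * EA * DA) + connConst r q * (1 + DA + P))) (m≤m+n _ _))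
          X₄ : 2 * q * (P + 2) ≤ X
          X₄ = m≤n⇒m≤1+n (m≤n+m _ (absorbConst r q * (2 + Y * EA * DA) + connConst r q * (1 + DA + P) + q * DA))

          s₁ : h ≤ s
          s₁ = ≤-trans (m≤n⇒m≤1+n (≤-trans (m≤m+n _ _) (≤-trans (m≤m+n _ _) (≤-trans (m≤m+n _ _) (m≤m+n _ _))))) big
          s₂ : 4 * r ≤ s
          s₂ = ≤-trans (m≤n⇒m≤1+n (≤-trans (m≤n+m _ h) (≤-trans (m≤m+n _ _) (≤-trans (m≤m+n _ _) (m≤m+n _ _))))) big
          s₃ : tileConst r q h e * suc (h + h) ≤ s
          s₃ = ≤-trans (m≤n⇒m≤1+n (≤-trans (m≤n+m _ (h + 4 * r)) (≤-trans (m≤m+n _ _) (m≤m+n _ _)))) big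
          s₄ : (r + r) + suc r ≤ s
          s₄ = ≤-trans (m≤n⇒m≤1+n (≤-trans (m≤n+m _ (h + 4 * r + tileConst r q h e * suc (h + h))) (m≤m+n _ _))) big
          s₅ : 2 * DA * (4 * DA * X) ≤ s
          s₅ = ≤-trans (m≤n⇒m≤1+n (m≤n+m _ (h + 4 * r + tileConst r q h e * suc (h + h) + ((r + r) + suc r)))) big

          s≤N : s ≤ N
          s≤N = ≤-trans (≤-trans (≤-reflexive (sym (*-identityˡ s))) (*-monoˡ-≤ s {1} {X} (s≤s z≤n))) XN

          1≤DA : 1 ≤ DA
          1≤DA = ≤-trans (≤-trans (s≤s z≤n) 2≤r) (≤-trans (m≤m+n r r) (m≤m+n (r + r) (r + r)))

          grow : ∀ c → c ≤ c * s
          grow c = ≤-trans (≤-reflexive (sym (*-identityʳ c))) (*-monoʳ-≤ c 1≤s)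

        tot : ℕ
        tot = sA * EA * (DA + Lc) + s * Ec * Dc

        tot≡ : tot ≡ P * s
        tot≡ = t s Y EA (DA + Lc) Ec Dc
          where
          t : ∀ s Y EA D Ec Dc → s * Y * EA * D + s * Ec * Dc ≡ (Y * EA * D + Ec * Dc) * s
          t = solve-∀

        0<N : 0 < N
        0<N = ≤-trans 1≤s s≤N

        h₁ : absorbConst r q * suc (suc (sA * EA * DA)) ≤ N
        h₁ = begin
          absorbConst r q * (2 + sA * EA * DA) ≤⟨ *-monoʳ-≤ (absorbConst r q) (+-monoˡ-≤ _ (grow 2)) ⟩
          absorbConst r q * (2 * s + s * Y * EA * DA) ≡⟨ t (absorbConst r q) s Y EA DA ⟩
          absorbConst r q * (2 + Y * EA * DA) * s ≤⟨ scale X₁ ⟩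
          N ∎
          where
          t : ∀ a s Y E D → a * (2 * s + s * Y * E * D) ≡ a * (2 + Y * E * D) * s
          t = solve-∀

        h₃ : N ^ DA < 2 ^ s
        h₃ = power<exponential N DA X s 1≤DA NX s₅

        h₂ : N ^ 1 < 2 ^ sA
        h₂ = ≤-trans (s≤s (^-monoʳ-≤ N ⦃ >-nonZero 0<N ⦄ 1≤DA)) (≤-trans h₃ (^-monoʳ-≤ 2 (≤-trans (≤-reflexive (sym (*-identityʳ s))) (*-monoʳ-≤ s (s≤s z≤n)))))

        h₄ : connConst r q * suc (DA + tot) ≤ N
        h₄ = begin
          connConst r q * (1 + DA + tot) ≤⟨ *-monoʳ-≤ (connConst r q) (+-mono-≤ (grow (1 + DA)) (≤-reflexive tot≡)) ⟩
          connConst r q * ((1 + DA) * s + P * s) ≡⟨ t (connConst r q) (1 + DA) P s ⟩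
          connConst r q * (1 + DA + P) * s ≤⟨ scale X₂ ⟩
          N ∎
          where
          t : ∀ c d p s → c * (d * s + p * s) ≡ c * (d + p) * s
          t = solve-∀

        h₅ : q * DA ≤ N
        h₅ = ≤-trans (grow (q * DA)) (scale X₃)

        h₆ : 2 * q * (tot + double h) ≤ N
        h₆ = begin
          2 * q * (tot + double h) ≡⟨ cong₂ (λ a b → 2 * q * (a + b)) tot≡ (double≡ h) ⟩
          2 * q * (P * s + (h + h)) ≤⟨ *-monoʳ-≤ (2 * q) (+-monoʳ-≤ (P * s) (+-mono-≤ s₁ s₁)) ⟩
          2 * q * (P * s + (s + s)) ≡⟨ t q P s ⟩
          2 * q * (P + 2) * s ≤⟨ scale X₄ ⟩
          N ∎
          where
          t : ∀ q p s → 2 * q * (p * s + (s + s)) ≡ 2 * q * (p + 2) * s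
          t = solve-∀

        h₇ : 2 * e * r ≤ N
        h₇ = ≤-trans (≤-reflexive (t X r)) (≤-trans (*-monoʳ-≤ X s₂) XN)
          where
          t : ∀ X r → 2 * (2 * X) * r ≡ X * (4 * r)
          t = solve-∀

        h₉ : tileConst r q h e * suc (h + h) ≤ N
        h₉ = ≤-trans s₃ s≤N

        h₁₁ : s + s * Ec * Dc ≤ sA
        h₁₁ = ≤-reflexive (t s Ec Dc)
          where
          t : ∀ s a b → s + s * a * b ≡ s * (1 + a * b)
          t = solve-∀

        h₁₂ : N * Lc < s * double h
        h₁₂ = begin-strict
          N * Lc ≤⟨ *-monoˡ-≤ Lc NX ⟩
          2 * X * s * Lc ≡⟨ t₁ X s Lc ⟩
          s * (X * Lc + X * Lc) <⟨ *-monoʳ-< s ⦃ >-nonZero 1≤s ⦄ (+-mono-< (s≤s (m≤m+n (X * Lc) r)) (s≤s (m≤m+n (X * Lc) r))) ⟩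
          s * (h + h) ≡⟨ cong (s *_) (sym (double≡ h)) ⟩
          s * double h ∎
          where
          t₁ : ∀ X s l → 2 * X * s * l ≡ s * (X * l + X * l)
          t₁ = solve-∀

        h₁₃ : r + r ≤ double h
        h₁₃ = ≤-trans (+-mono-≤ r≤h r≤h) (≤-reflexive (sym (double≡ h)))
          where
          r≤h : r ≤ h
          r≤h = m≤n⇒m≤1+n (m≤n+m r (X * Lc))

        h₁₄ : (r + r) + suc r ≤ N
        h₁₄ = ≤-trans s₄ s≤N

  hamilton-ℕ : (r q : ℕ) → 2 ≤ r → 2 ≤ q → let open Constants r q in
    (n : ℕ) → n₀ ≤ n → (C : ℕ) → colBound ≤ C → (H : Subset n → Bool) (φ : Subset n → ℕ) → IsKGraph (suc r) n H →
    (∀ S → ∣ S ∣ ≡ r → (q + 2) * n ≤ 2 * q * deg H S) → (∀ i S → ∣ S ∣ ≡ r → C * colDeg H φ i S ≤ n) →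
    HasProperlyColoredTightHamCycle (suc r) n H φ
  hamilton-ℕ r q 2≤r 2≤q n n-big C colC H φ size deg-H deg-col =
    Hypergraph.Assembly.result n r q C H φ 2≤r 2≤q size deg-H deg-col s B.sA Cs.h Cs.e
      (≤-trans (≤-trans (m≤m+n _ _) (≤-trans (m≤m+n _ _) (m≤m+n _ _))) colC)
      (≤-trans (≤-trans (m≤n+m _ (absorbConst r q)) (≤-trans (m≤m+n _ _) (m≤m+n _ _))) colC)
      (≤-trans (≤-trans (m≤n+m _ (absorbConst r q + connConst r q)) (m≤m+n _ _)) colC)
      (≤-trans (m≤n+m _ (absorbConst r q + connConst r q + 2 * tileKappa q Cs.h)) colC)
      B.h₁ B.h₂ B.h₃ B.h₄ B.h₅ B.h₆ B.h₇ (Cs.0<tileConst 2≤r 2≤q) B.h₉ NX B.h₁₁ B.h₁₂ B.h₁₃ (s≤s z≤n)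
      (subst ((r + r) + suc r ≤_) length-allFin B.h₁₄) B.0<N (Cs.0<connDensity 2≤r 2≤q)
    where
    module Cs = Constants r q
    X = Cs.X
    s = n / X
    big : Cs.s₀ ≤ s
    big = s≤s⁻¹ (*-cancelˡ-< X _ _ (≤-trans (s≤s n-big) (begin-strict
      n ≡⟨ m≡m%n+[m/n]*n n X ⟩
      n % X + s * X <⟨ +-monoˡ-< (s * X) (m%n<n n X) ⟩
      X + s * X ≡⟨ *-comm (suc s) X ⟩
      X * suc s ∎)))
      where open ≤-Reasoning
    XN : X * s ≤ length (allFin n)
    XN = ≤-trans (≤-reflexive (*-comm X s)) (≤-trans (m/n*n≤m n X) (≤-reflexive (sym (length-allFin {n}))))
    NX : length (allFin n) ≤ 2 * X * s
    NX = begin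
      length (allFin n) ≡⟨ length-allFin {n} ⟩
      n ≡⟨ m≡m%n+[m/n]*n n X ⟩
      n % X + s * X ≤⟨ +-monoˡ-≤ (s * X) (<⇒≤ (m%n<n n X)) ⟩
      X + s * X ≤⟨ +-monoˡ-≤ (s * X) (≤-trans (≤-reflexive (sym (*-identityˡ X))) (*-monoˡ-≤ X (≤-trans (s≤s z≤n) big))) ⟩
      s * X + s * X ≡⟨ t s X ⟩
      2 * X * s ∎
      where
      open ≤-Reasoning
      t : ∀ s X → s * X + s * X ≡ 2 * X * s
      t = solve-∀
    module B = Cs.Bounds 2≤r 2≤q (length (allFin n)) s XN NX big

  -- From rational hypotheses to inequalities in ℕ

  module Rationals where
    open import Data.Integer as ℤ using (+_)
    import Data.Integer.Properties as ℤP
    open import Data.Rational as ℚ using (ℚ; ½; 0ℚ; fromℚᵘ; toℚᵘ)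
    import Data.Rational.Properties as ℚP
    open import Data.Rational.Unnormalised as ℚᵘ using (mkℚᵘ; *<*)
    import Data.Rational.Unnormalised.Properties as ℚᵘP

    -- If γ has denominator suc b then γ ≥ 1 / q for this q.
    qOf : ℕ → ℕ
    qOf b = 2 * suc b

    2≤qOf : ∀ b → 2 ≤ qOf b
    2≤qOf b = *-monoʳ-≤ 2 (s≤s z≤n)

    -- reciprocal C is 1 / (C + 1).
    reciprocal : ℕ → ℚ
    reciprocal C = fromℚᵘ (mkℚᵘ (+ 1) C)

    0<reciprocal : ∀ C → 0ℚ ℚ.< reciprocal C
    0<reciprocal C = ℚP.toℚᵘ-cancel-< (ℚᵘP.<-respʳ-≃ (ℚᵘP.≃-sym (ℚP.toℚᵘ-fromℚᵘ (mkℚᵘ (+ 1) C))) (*<* (ℤ.+<+ (s≤s z≤n))))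

    ℕ→ℚᵘ : ∀ m → toℚᵘ (ℕ→ℚ m) ℚᵘ.≃ mkℚᵘ (+ m) 0
    ℕ→ℚᵘ m = ℚP.toℚᵘ-fromℚᵘ (mkℚᵘ (+ m) 0)

    color-bound : ∀ C x n → ℕ→ℚ x ℚ.≤ reciprocal C ℚ.* ℕ→ℚ n → suc C * x ≤ n
    color-bound C x n le = ≤-trans (≤-reflexive (t₁ C x)) (≤-trans (ℤP.drop‿+≤+ (subst₂ ℤ._≤_ e₁ e₂ (ℚᵘP.drop-*≤* le′))) (≤-reflexive (t₂ n)))
      where
      le′ : mkℚᵘ (+ x) 0 ℚᵘ.≤ mkℚᵘ (+ 1) C ℚᵘ.* mkℚᵘ (+ n) 0
      le′ = ℚᵘP.≤-respˡ-≃ (ℕ→ℚᵘ x) (ℚᵘP.≤-respʳ-≃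
        (ℚᵘP.≃-trans (ℚP.toℚᵘ-homo-* (reciprocal C) (ℕ→ℚ n)) (ℚᵘP.*-cong (ℚP.toℚᵘ-fromℚᵘ (mkℚᵘ (+ 1) C)) (ℕ→ℚᵘ n)))
        (ℚP.toℚᵘ-mono-≤ le))
      e₁ : + x ℤ.* + (suc C * 1) ≡ + (x * (suc C * 1))
      e₁ = sym (ℤP.pos-* x (suc C * 1))
      e₂ : + 1 ℤ.* + n ℤ.* + 1 ≡ + (1 * n * 1)
      e₂ = trans (cong (ℤ._* + 1) (sym (ℤP.pos-* 1 n))) (sym (ℤP.pos-* (1 * n) 1))
      t₁ : ∀ C x → (1 + C) * x ≡ x * ((1 + C) * 1)
      t₁ = solve-∀
      t₂ : ∀ n → 1 * n * 1 ≡ n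
      t₂ = solve-∀

    degree-bound : ∀ γ a b n d → toℚᵘ γ ≡ mkℚᵘ (+ suc a) b → (½ ℚ.+ γ) ℚ.* ℕ→ℚ n ℚ.≤ ℕ→ℚ d → (qOf b + 2) * n ≤ 2 * qOf b * d
    degree-bound γ a b n d γ≡ le = begin
      -- The slack given away is the excess of `γ` over `1 / q`, multiplied by `4 * suc b * n`.
      (2 * suc b + 2) * n ≤⟨ m≤m+n _ (4 * a * n + 2 * n) ⟩
      (2 * suc b + 2) * n + (4 * a * n + 2 * n) ≡⟨ t₁ a b n ⟩
      2 * ((1 * suc b + suc a * 2) * n * 1) ≤⟨ *-monoʳ-≤ 2 (ℤP.drop‿+≤+ (subst₂ ℤ._≤_ e₁ e₂ (ℚᵘP.drop-*≤* le′))) ⟩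
      2 * (d * (2 * suc b * 1)) ≡⟨ t₂ b d ⟩
      2 * (2 * suc b) * d ∎
      where
      open ≤-Reasoning
      le′ : (mkℚᵘ (+ 1) 1 ℚᵘ.+ mkℚᵘ (+ suc a) b) ℚᵘ.* mkℚᵘ (+ n) 0 ℚᵘ.≤ mkℚᵘ (+ d) 0
      le′ = ℚᵘP.≤-respˡ-≃ (ℚᵘP.≃-trans (ℚP.toℚᵘ-homo-* (½ ℚ.+ γ) (ℕ→ℚ n)) (ℚᵘP.*-cong (subst (λ g → toℚᵘ (½ ℚ.+ γ) ℚᵘ.≃ mkℚᵘ (+ 1) 1 ℚᵘ.+ g) γ≡ (ℚP.toℚᵘ-homo-+ ½ γ)) (ℕ→ℚᵘ n)))
        (ℚᵘP.≤-respʳ-≃ (ℕ→ℚᵘ d) (ℚP.toℚᵘ-mono-≤ le))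
      e₁ : (+ 1 ℤ.* + suc b ℤ.+ + suc a ℤ.* + 2) ℤ.* + n ℤ.* + 1 ≡ + ((1 * suc b + suc a * 2) * n * 1)
      e₁ = trans (cong (λ z → z ℤ.* + n ℤ.* + 1) (trans (cong₂ ℤ._+_ (sym (ℤP.pos-* 1 (suc b))) (sym (ℤP.pos-* (suc a) 2))) (sym (ℤP.pos-+ (1 * suc b) (suc a * 2)))))
        (trans (cong (ℤ._* + 1) (sym (ℤP.pos-* (1 * suc b + suc a * 2) n))) (sym (ℤP.pos-* ((1 * suc b + suc a * 2) * n) 1)))
      e₂ : + d ℤ.* + (2 * suc b * 1) ≡ + (d * (2 * suc b * 1))
      e₂ = sym (ℤP.pos-* d (2 * suc b * 1))
      t₁ : ∀ a b n → (2 * (1 + b) + 2) * n + (4 * a * n + 2 * n) ≡ 2 * ((1 * (1 + b) + (1 + a) * 2) * n * 1)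
      t₁ = solve-∀
      t₂ : ∀ b d → 2 * (d * (2 * (1 + b) * 1)) ≡ 2 * (2 * (1 + b)) * d
      t₂ = solve-∀

open import Defs
open import Data.Nat using (ℕ; _≥_; _∸_)
open import Data.Product using (Σ; _×_)
open import Data.Bool using (Bool)
open import Data.Fin.Subset using (Subset; ∣_∣)
open import Relation.Binary.PropositionalEquality using (_≡_)
open import Data.Rational using (ℚ; 0ℚ; ½; _<_; _≤_; _+_; _*_)
open import Data.Nat using (zero; suc; s≤s)
open import Data.Nat.Properties using (n≤1+n)
open import Data.Product using (_,_)
open import Data.Integer using (+_; -[1+_]; +<+)
open import Data.Rational using (mkℚ; *<*)
open import Relation.Binary.PropositionalEquality using (refl)
open Proof using (hamilton-ℕ; module Constants)
open Proof.Rationals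

theorem1p2 : (k : ℕ) → k ≥ 3 → (γ : ℚ) → 0ℚ < γ →
    Σ ℚ λ c → 0ℚ < c × Σ ℕ λ n₀ → n₀ ≥ 1 ×
    ((n : ℕ) → n ≥ n₀ → (H : Subset n → Bool) → (φ : Subset n → ℕ) →
    IsKGraph k n H →
    ((S : Subset n) → ∣ S ∣ ≡ k ∸ 1 → (½ + γ) * ℕ→ℚ n ≤ ℕ→ℚ (deg H S)) →
    ((i : ℕ) → (S : Subset n) → ∣ S ∣ ≡ k ∸ 1 → ℕ→ℚ (colDeg H φ i S) ≤ c * ℕ→ℚ n) →
    HasProperlyColoredTightHamCycle k n H φ)
theorem1p2 (suc r) (s≤s 2≤r) γ@(mkℚ (+ suc a) b _) 0<γ =
  reciprocal colBound , 0<reciprocal colBound , n₀ , 1≤n₀ ,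
  λ n n≥n₀ H φ size deg-H deg-col →
    hamilton-ℕ r (qOf b) 2≤r (2≤qOf b) n n≥n₀ (suc colBound) (n≤1+n colBound) H φ size
      (λ S ∣S∣ → degree-bound γ a b n (deg H S) refl (deg-H S ∣S∣))
      (λ i S ∣S∣ → color-bound colBound (colDeg H φ i S) n (deg-col i S ∣S∣))
  where open Constants r (qOf b)
theorem1p2 (suc r) _ (mkℚ (+ zero) b _) (*<* (+<+ ()))
theorem1p2 (suc r) _ (mkℚ -[1+ a ] b _) (*<* ())
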